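{- Let $Y$ be the complete graph on $n$ vertices and let $Y^f$ be a connected cyclic 2ev-cover of $Y$. Then $Y^f$ is a drackn, i.e. a distance-regular antipodal cover of the complete graph $K_n$.
   Context: All graphs are finite, simple and undirected. Covers: let $Y=(V,E)$ be a connected graph and $G$ a permutation group on $R=\{1,\dots,r\}$. A symmetric arc function is a function $f:V\times V\to G\cup\{0\}$ such that $f(u,v)=0$ if and only if $\{u,v\}\notin E$, and $f(u,v)=f(v,u)^{ -1}$ whenever $f(u,v)\in G$. The cover $Y^f$ (of index $r$, or $r$-fold) is the graph with vertex set $V\times R$ in which $(v,j)$ is adjacent to $(u,k)$ exactly when $v$ is adjacent to $u$ in $Y$ and $f(u,v)j=k$. The function $f$ is normalized if $f(u,v)=\mathrm{id}$ for all edges $\{u,v\}$ of some spanning tree of $Y$. Denote by $\langle f\rangle$ the subgroup of $\mathrm{Sym}(r)$ generated by the (non-zero) values of $f$. Standing assumptions: $f$ is normalized and $\langle f\rangle$ acts regularly (i.e. simply transitively) on $\{1,\dots,r\}$. The cover is called cyclic if $\langle f\rangle$ is a cyclic group. Two-eigenvalue cover (2ev-cover): $\mathrm{Spec}(A)$ denotes the spectrum of $A$ as a multiset, and $A(\cdot)$ the adjacency matrix. One has $\mathrm{Spec}(A(Y))\subseteq\mathrm{Spec}(A(Y^f))$ as multisets, and $Y^f$ is a 2ev-cover of $Y$ if the multiset difference $\mathrm{Spec}(A(Y^f))\setminus\mathrm{Spec}(A(Y))$ has exactly two distinct elements. Distance-regular has its standard meaning: a connected graph of diameter $d$ such that for vertices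 $v,w$ at distance $i$, the numbers $b_i$ and $c_i$ of neighbours of $w$ at distance $i+1$, respectively $i-1$, from $v$ depend only on $i$. A graph of diameter $d$ is antipodal if the relation "equal or at distance $d$" is an equivalence relation on its vertices. The antipodal quotient of an antipodal distance-regular graph $X$ is the graph whose vertices are the antipodal classes (the classes of this relation), two distinct classes being adjacent if some edge of $X$ has one end in each. A drackn (distance-regular antipodal cover of $K_n$) is an antipodal distance-regular graph $X$ that is a cover of its antipodal quotient, this quotient being the complete graph $K_n$. -}

module Defs where

open import Algebra.Apartness.Bundles using (HeytingField; HeytingCommutativeRing)
open import Algebra.Bundles using (CommutativeRing)
open import Algebra.Bundles.Raw using (RawRing)
import Algebra.Definitions.RawSemiring as RawSemiringDefs
open import Data.Bool.Base using (if_then_else_)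
open import Data.Fin.Base using (Fin; zero; suc; toℕ; punchIn)
open import Data.Fin.Permutation as Perm
  using (Permutation′; _⟨$⟩ʳ_; _∘ₚ_; flip; inverseʳ)
open import Data.Fin.Properties using (*↔×) renaming (_≟_ to _≟ᶠ_)
open import Data.List.Base using (List; []; _∷_; _++_; length; map; foldr)
open import Data.List.Membership.Propositional using () renaming (_∈_ to _∈ˡ_)
import Data.List.Membership.Setoid as SetoidMembership
import Data.List.Relation.Binary.Permutation.Setoid as SetoidPermutation
open import Data.List.Relation.Unary.All using (All)
open import Data.List.Relation.Unary.Unique.Propositional using (Unique)
open import Data.Maybe.Base using (Maybe; just; nothing)
open import Data.Nat.Base using (ℕ; zero; suc; _≤_; _<_) renaming (_*_ to _*ℕ_)
open import Data.Product.Base using (Σ; ∃; ∃-syntax; _×_; _,_; proj₁; proj₂)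
open import Data.Product using (∃!)
open import Data.Product.Function.NonDependent.Propositional using (_×-↔_)
open import Data.Sum.Base using (_⊎_)
open import Function.Bundles using (_↔_; _⇔_; Inverse; Equivalence)
open import Function.Construct.Composition using (_↔-∘_)
open import Function.Construct.Identity using (↔-id)
open import Function.Definitions using (StrictlySurjective)
open import Level using (Level; 0ℓ; _⊔_)
open import Relation.Binary.Core using (Rel)
open import Relation.Binary.Definitions using (Decidable; Symmetric; Irreflexive)
open import Relation.Binary.PropositionalEquality
  using (_≡_; _≢_; refl; sym; trans; cong)
open import Relation.Binary.Structures using (IsEquivalence)
open import Relation.Nullary using (¬_; yes; no; does; contradiction)
open import Relation.Nullary.Decidable using (¬?; map′)
open import Relation.Unary using (Pred; _∈_; _≐_)

private
  variable
    c ℓ ℓ₁ ℓ₂ : Level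

------------------------------------------------------------------------
-- Graphs

record FiniteSet : Set₁ where
  field
    Carrier     : Set
    size        : ℕ
    enumeration : Fin size ↔ Carrier

open FiniteSet using (Carrier; size; enumeration)

finᶠ : ℕ → FiniteSet
finᶠ n = record { Carrier = Fin n ; size = n ; enumeration = ↔-id (Fin n) }

infixr 2 _×ᶠ_

_×ᶠ_ : FiniteSet → FiniteSet → FiniteSet
V ×ᶠ W = record
  { Carrier     = Carrier V × Carrier W
  ; size        = size V *ℕ size W
  ; enumeration = (enumeration V ×-↔ enumeration W) ↔-∘ *↔×
  }

-- P has exactly k elements.
HasCardinality : {A : Set} → Pred A 0ℓ → ℕ → Set
HasCardinality {A} P k =
  Σ (List A) λ xs → Unique xs × (∀ x → x ∈ˡ xs ⇔ P x) × length xs ≡ k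

record Graph (V : FiniteSet) : Set₁ where
  infix 4 _~_ _~?_
  field
    _~_      : Rel (Carrier V) 0ℓ
    _~?_     : Decidable _~_
    ~-sym    : Symmetric _~_
    ~-irrefl : Irreflexive _≡_ _~_

complete : (n : ℕ) → Graph (finᶠ n)
complete n = record
  { _~_      = _≢_
  ; _~?_     = λ u v → ¬? (u ≟ᶠ v)
  ; ~-sym    = λ u≢v v≡u → u≢v (sym v≡u)
  ; ~-irrefl = λ u≡v u≢v → u≢v u≡v
  }

module _ {V : FiniteSet} (X : Graph V) where
  open Graph X

  data Walk : Carrier V → Carrier V → ℕ → Set where
    stop : ∀ {u} → Walk u u 0
    step : ∀ {u v w k} → u ~ v → Walk v w k → Walk u w (suc k)

  vertices : ∀ {u v k} → Walk u v k → List (Carrier V)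
  vertices {u} stop       = u ∷ []
  vertices {u} (step _ p) = u ∷ vertices p

  Connected : Set
  Connected = ∀ u v → ∃[ k ] Walk u v k

  -- A cycle is a path with at least three vertices whose ends are adjacent.
  Acyclic : Set
  Acyclic = ∀ {u v k} (p : Walk u v (suc (suc k))) → Unique (vertices p) → ¬ (v ~ u)

  IsTree : Set
  IsTree = Connected × Acyclic

  AtDistance : ℕ → Rel (Carrier V) 0ℓ
  AtDistance d u v = Walk u v d × (∀ {k} → k < d → ¬ Walk u v k)

  HasDiameter : ℕ → Set
  HasDiameter d =
    (∀ u v → ∃[ k ] (k ≤ d × AtDistance k u v)) × (∃[ u ] ∃[ v ] AtDistance d u v)

  -- For i = 0 the condition suc k ≡ i is unsatisfiable, which forces c 0 ≡ 0.
  IsDistanceRegular : ℕ → Set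
  IsDistanceRegular d =
    Connected × HasDiameter d ×
    (Σ (ℕ → ℕ) λ b → Σ (ℕ → ℕ) λ c → ∀ i v w → AtDistance i v w →
      HasCardinality (λ u → w ~ u × AtDistance (suc i) v u) (b i) ×
      HasCardinality (λ u → w ~ u × (∃[ k ] (suc k ≡ i × AtDistance k v u))) (c i))

  EqualOrAtDistance : ℕ → Rel (Carrier V) 0ℓ
  EqualOrAtDistance d u v = u ≡ v ⊎ AtDistance d u v

  IsAntipodal : ℕ → Set
  IsAntipodal d = IsEquivalence (EqualOrAtDistance d)

-- T is a subgraph of X with the same vertex set.
_SpanningSubgraphOf_ : {V : FiniteSet} → Graph V → Graph V → Set
T SpanningSubgraphOf X = ∀ {u v} → Graph._~_ T u v → Graph._~_ X u v

------------------------------------------------------------------------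
-- Permutation groups

_≈ₚ_ : ∀ {r} → Rel (Permutation′ r) 0ℓ
_≈ₚ_ = Perm._≈_

-- The subgroup of Sym(r) generated by S; permutations are compared
-- pointwise, so membership is closed under _≈ₚ_.
data ⟨_⟩ {r : ℕ} (S : Pred (Permutation′ r) 0ℓ) : Pred (Permutation′ r) 0ℓ where
  generator   : ∀ {σ} → S σ → σ ∈ ⟨ S ⟩
  identity    : Perm.id ∈ ⟨ S ⟩
  composition : ∀ {σ τ} → σ ∈ ⟨ S ⟩ → τ ∈ ⟨ S ⟩ → (σ ∘ₚ τ) ∈ ⟨ S ⟩
  inverse     : ∀ {σ} → σ ∈ ⟨ S ⟩ → flip σ ∈ ⟨ S ⟩
  respects    : ∀ {σ τ} → σ ≈ₚ τ → σ ∈ ⟨ S ⟩ → τ ∈ ⟨ S ⟩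

ActsRegularly : ∀ {r} → Pred (Permutation′ r) 0ℓ → Set
ActsRegularly H = ∀ i j → ∃! _≈ₚ_ λ σ → σ ∈ H × σ ⟨$⟩ʳ i ≡ j

IsCyclic : ∀ {r} → Pred (Permutation′ r) 0ℓ → Set
IsCyclic {r} H = ∃[ σ ] H ≐ ⟨ (λ (τ : Permutation′ r) → σ ≈ₚ τ) ⟩

------------------------------------------------------------------------
-- Covers

-- The value 0 is represented by nothing.  The ambient permutation group is
-- taken to be Sym(r): it enters only through the values of the function.
record SymmetricArcFunction {V : FiniteSet} (Y : Graph V) (r : ℕ) : Set where
  open Graph Y
  field
    value         : Carrier V → Carrier V → Maybe (Permutation′ r)
    nothing⇔      : ∀ u v → value u v ≡ nothing ⇔ (¬ (u ~ v))
    value-inverse : ∀ {u v σ τ} → value u v ≡ just σ → value v u ≡ just τ → σ ≈ₚ flip τ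

module _ {V : FiniteSet} {Y : Graph V} {r : ℕ} (f : SymmetricArcFunction Y r) where
  open Graph Y
  open SymmetricArcFunction f

  Values : Pred (Permutation′ r) 0ℓ
  Values σ = ∃[ u ] ∃[ v ] value u v ≡ just σ

  IsNormalized : Set₁
  IsNormalized = Σ (Graph V) λ T → T SpanningSubgraphOf Y × IsTree T ×
    (∀ {u v} → Graph._~_ T u v → ∃[ σ ] (value u v ≡ just σ × σ ≈ₚ Perm.id))

  CoverAdjacent : Rel (Carrier V × Fin r) 0ℓ
  CoverAdjacent (v , j) (u , k) =
    v ~ u × (∃[ σ ] (value u v ≡ just σ × σ ⟨$⟩ʳ j ≡ k))

  private
    coverAdjacent? : Decidable CoverAdjacent
    coverAdjacent? (v , j) (u , k) with v ~? u | value u v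
    ... | no ¬a | _       = no λ (a , _) → ¬a a
    ... | yes a | nothing = no λ { (_ , _ , () , _) }
    ... | yes a | just σ  = map′ (λ e → a , σ , refl , e)
                                 (λ { (_ , _ , refl , e) → e })
                                 ((σ ⟨$⟩ʳ j) ≟ᶠ k)

    coverAdjacent-sym : Symmetric CoverAdjacent
    coverAdjacent-sym {v , j} {u , k} (a , σ , eq , σj≡k)
      with value v u in eq′
    ... | nothing = contradiction a (Equivalence.to (nothing⇔ v u) eq′)
    ... | just τ  = ~-sym a , τ , refl ,
      trans (cong (τ ⟨$⟩ʳ_) (trans (sym σj≡k) (value-inverse eq eq′ j)))
            (inverseʳ τ)

  cover : Graph (V ×ᶠ finᶠ r)
  cover = record
    { _~_      = CoverAdjacent
    ; _~?_     = coverAdjacent?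
    ; ~-sym    = coverAdjacent-sym
    ; ~-irrefl = λ { refl (a , _) → ~-irrefl refl a }
    }

------------------------------------------------------------------------
-- Polynomials, determinants, spectra

-- A polynomial is the list of its coefficients in order of increasing
-- degree; trailing zeros are allowed, so equality is coefficientwise.
module Polynomials (R : RawRing c ℓ) where
  open RawRing R renaming (Carrier to A)

  coefficient : List A → ℕ → A
  coefficient []      _       = 0#
  coefficient (a ∷ p) zero    = a
  coefficient (a ∷ p) (suc k) = coefficient p k

  addₚ : List A → List A → List A
  addₚ []      q       = q
  addₚ (a ∷ p) []      = a ∷ p
  addₚ (a ∷ p) (b ∷ q) = (a + b) ∷ addₚ p q

  mulₚ : List A → List A → List A
  mulₚ []      q = []
  mulₚ (a ∷ p) q = addₚ (map (a *_) q) (0# ∷ mulₚ p q)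

  polynomials : RawRing c ℓ
  polynomials = record
    { Carrier = List A
    ; _≈_     = λ p q → ∀ k → coefficient p k ≈ coefficient q k
    ; _+_     = addₚ
    ; _*_     = mulₚ
    ; -_      = map (-_)
    ; 0#      = []
    ; 1#      = 1# ∷ []
    }

  constant : A → List A
  constant a = a ∷ []

  indeterminate : List A
  indeterminate = 0# ∷ 1# ∷ []

Matrix : Set c → ℕ → Set c
Matrix A n = Fin n → Fin n → A

module Determinant (R : RawRing c ℓ) where
  open RawRing R renaming (Carrier to A)
  open RawSemiringDefs rawSemiring using (sum; _^_)

  -- Cofactor expansion along the first row.
  det : ∀ {n} → Matrix A n → A
  det {zero}  M = 1#
  det {suc n} M = sum λ j →
    ((- 1#) ^ toℕ j) * (M zero j * det (λ i k → M (suc i) (punchIn j k)))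

-- Eigenvalues are taken in a field K; classically a Heyting field is just a
-- field.  For K = ℝ this is the usual spectrum of a real symmetric matrix.
module Spectra (K : HeytingField c ℓ₁ ℓ₂) where
  open HeytingField K using (heytingCommutativeRing)
  open HeytingCommutativeRing heytingCommutativeRing using (commutativeRing)
  open CommutativeRing commutativeRing public
    using (_≈_; _≉_; 0#; 1#; setoid; rawRing) renaming (Carrier to A)
  open RawSemiringDefs (RawRing.rawSemiring rawRing) using () renaming (_×_ to _·_)
  open Polynomials rawRing using (polynomials; constant; indeterminate)
  open RawRing polynomials
    using () renaming (_≈_ to _≈ₓ_; _+_ to _+ₓ_; _*_ to _*ₓ_; -_ to -ₓ_; 0# to 0ₓ; 1# to 1ₓ)
  open SetoidMembership setoid using () renaming (_∈_ to _∈ₖ_)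
  open SetoidPermutation setoid using (_↭_)

  CharacteristicZero : Set ℓ₁
  CharacteristicZero = ∀ n → (suc n · 1#) ≉ 0#

  adjacencyMatrix : {V : FiniteSet} (X : Graph V) → Matrix A (size V)
  adjacencyMatrix {V} X i j =
    if does (Inverse.to (enumeration V) i ~? Inverse.to (enumeration V) j)
    then 1# else 0#
    where open Graph X

  characteristicPolynomial : ∀ {n} → Matrix A n → List A
  characteristicPolynomial M = Determinant.det polynomials λ i j →
    (if does (i ≟ᶠ j) then indeterminate else 0ₓ) +ₓ (-ₓ constant (M i j))

  -- The roots of the characteristic polynomial with multiplicities, as a
  -- list up to order; its existence says that the polynomial splits over K.
  IsSpectrum : ∀ {n} → Matrix A n → List A → Set ℓ₁
  IsSpectrum M eigenvalues =
    characteristicPolynomial M ≈ₓ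
    foldr (λ θ p → (indeterminate +ₓ (-ₓ constant θ)) *ₓ p) 1ₓ eigenvalues

  HasExactlyTwoDistinctElements : List A → Set (c ⊔ ℓ₁)
  HasExactlyTwoDistinctElements xs =
    ∃[ θ ] ∃[ τ ] (θ ≉ τ × θ ∈ₖ xs × τ ∈ₖ xs × All (λ x → x ≈ θ ⊎ x ≈ τ) xs)

  -- difference is the multiset Spec(A(Y^f)) ∖ Spec(A(Y)).
  record IsTwoEigenvalueCover {V : FiniteSet} {Y : Graph V} {r : ℕ}
         (f : SymmetricArcFunction Y r) : Set (c ⊔ ℓ₁) where
    field
      spectrumY     : List A
      spectrumCover : List A
      difference    : List A
      isSpectrumY     : IsSpectrum (adjacencyMatrix Y) spectrumY
      isSpectrumCover : IsSpectrum (adjacencyMatrix (cover f)) spectrumCover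
      isDifference    : spectrumCover ↭ spectrumY ++ difference
      twoEigenvalues  : HasExactlyTwoDistinctElements difference

open Spectra public using (CharacteristicZero; IsTwoEigenvalueCover)

------------------------------------------------------------------------
-- Distance-regular antipodal covers of complete graphs

-- Q is the antipodal quotient of X (of diameter d), with π sending a vertex
-- to its antipodal class: the vertices of Q are the classes, up to bijection.
record IsAntipodalQuotient {V W : FiniteSet} (X : Graph V) (d : ℕ) (Q : Graph W)
       (π : Carrier V → Carrier W) : Set where
  field
    surjective : StrictlySurjective _≡_ π
    classes    : ∀ u v → π u ≡ π v ⇔ EqualOrAtDistance X d u v
    adjacency  : ∀ a b → Graph._~_ Q a b ⇔
                 (a ≢ b × (∃[ u ] ∃[ v ] (π u ≡ a × π v ≡ b × Graph._~_ X u v)))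

-- X is isomorphic to a cover Y^g, with π corresponding to the projection
-- of Y^g onto Y.
record IsCoverAlong {V W : FiniteSet} (X : Graph V) (Y : Graph W)
       (π : Carrier V → Carrier W) : Set where
  field
    index       : ℕ
    arcFunction : SymmetricArcFunction Y index
    bijection   : Carrier V ↔ (Carrier W × Fin index)
    adjacency   : ∀ u v → Graph._~_ X u v ⇔
                  CoverAdjacent arcFunction (Inverse.to bijection u) (Inverse.to bijection v)
    projection  : ∀ u → proj₁ (Inverse.to bijection u) ≡ π u

record IsDrackn {V : FiniteSet} (X : Graph V) (n : ℕ) : Set where
  field
    diameter            : ℕ
    isDistanceRegular   : IsDistanceRegular X diameter
    isAntipodal         : IsAntipodal X diameter
    class               : Carrier V → Fin n
    isAntipodalQuotient : IsAntipodalQuotient X diameter (complete n) class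
    isCover             : IsCoverAlong X (complete n) class

{-# OPTIONS --safe #-}
module Submission where

-- The two-eigenvalue hypothesis enters only through power sums.  Let A be the
-- adjacency matrix of the cover, B that of K_n, and P_k = tr A^k - tr B^k, the k-th
-- power sum of the new eigenvalues.  As these take two values, the Hankel
-- determinant of P_0, …, P_4 vanishes; as P_1 = 0 and P_2 = (n - 1) P_0, it yields
-- P_0 P_2 P_4 = P_0 P_3² + P_2³, an identity between integers.  Counting closed walks, it
-- says that a variance is zero: among pairs of vertices in distinct fibres, the number
-- of common neighbours is an affine function of adjacency.  Two distinct vertices of a
-- fibre have no common neighbour, so the cover is distance-regular of diameter 3 as
-- soon as nonadjacent vertices of distinct fibres have a common neighbour, which
-- connectedness forces.
--
-- That the k-th power sum of the roots of det (x - M) is tr M^k, over any commutative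
-- ring, follows from (x - M) adj (x - M) = det (x - M) and (det (x - M))′ = tr adj (x - M):
-- these determine the traces recursively from the characteristic polynomial, and
-- a diagonal matrix with the given roots has the same one.

open import Defs
open import Level using (Level; 0ℓ; _⊔_)
open import Data.Nat.Base using (ℕ)
open import Algebra.Apartness.Bundles using (HeytingField; HeytingCommutativeRing)
open import Algebra.Bundles using (CommutativeRing; Semiring)
open import Algebra.Bundles.Raw using (RawRing)
import Algebra.Definitions.RawSemiring as RawSemiringDefs
import Algebra.Properties.CommutativeMonoid.Mult as CommMonoidMult
import Algebra.Properties.Ring as RingProperties
import Algebra.Properties.Semiring.Mult as SemiringMult
import Algebra.Properties.Semiring.Sum as SemiringSum
import Algebra.Solver.Ring.NaturalCoefficients.Default as SemiringSolver
open import Data.Bool.Base using (if_then_else_; true; false)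
open import Data.Empty using (⊥)
open import Data.Fin.Base using (Fin; zero; suc; toℕ; punchIn; combine; _↑ˡ_; _↑ʳ_)
open import Data.Fin.Permutation using (_⟨$⟩ʳ_)
open import Data.Fin.Properties using (remQuot-combine) renaming (_≟_ to _≟ᶠ_)
open import Data.List.Base using (List; []; _∷_; _++_; length; lookup; foldr; map; filter; tabulate)
open import Data.List.Membership.Propositional using () renaming (_∈_ to _∈ˡ_)
open import Data.List.Membership.Propositional.Properties using (∈-filter⁺; ∈-filter⁻; ∈-tabulate⁺)
import Data.List.Relation.Binary.Permutation.Homogeneous as Homogeneous
import Data.List.Relation.Binary.Permutation.Setoid as SetoidPermutation
open import Data.List.Relation.Binary.Pointwise.Base using ([]; _∷_) renaming (Pointwise to ListPointwise)
open import Data.List.Relation.Unary.All using (All; []; _∷_)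
open import Data.List.Relation.Unary.AllPairs using ([])
open import Data.List.Relation.Unary.Unique.Propositional.Properties using (filter⁺; tabulate⁺)
open import Data.Maybe.Base using (just; nothing)
open import Data.Maybe.Properties using (just-injective)
open import Data.Nat.Base as ℕ using (zero; suc; z≤n; s≤s; NonZero)
import Data.Nat.Properties as ℕ
open import Data.Nat.Solver using (module +-*-Solver)
open import Data.Product.Base using (∃-syntax; _×_; _,_; proj₁; proj₂)
open import Data.Product.Properties using (≡-dec)
open import Data.Sum.Base using (_⊎_; inj₁; inj₂)
open import Function.Base using (_∘_)
open import Function.Bundles using (Inverse; mk⇔; module Equivalence)
open import Function.Construct.Identity using (↔-id; ⇔-id)
open import Relation.Binary.Definitions using (DecidableEquality; tri<; tri≈; tri>)
open import Relation.Binary.PropositionalEquality as ≡ using (_≡_; _≢_; _≗_)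
import Relation.Binary.Reasoning.Setoid as SetoidReasoning
open import Relation.Nullary using (Dec; ¬_; does; yes; no; contradiction)
open import Relation.Nullary.Decidable using (¬?; dec-true; dec-false; _×-dec_)
open import Relation.Unary using (Pred)

-- Given a spectral theorem, A² = (θ + τ) A - θ τ would hold on the new part of the spectrum, and
-- common neighbours would be affine in adjacency at once. Here K is an abstract field, and all that
-- is known is how two characteristic polynomials factor; diagonalizability is not at hand. Traces
-- do without it. The positivity that takes its place is that of integers: a sum of squares that
-- vanishes has vanishing terms. Case distinctions also belong to ℕ, where equality is decidable, as
-- it need not be in K. The bridge is the map sending k to k · 1, injective in characteristic zero.
-- To remain in ℕ, every equation carries its negative terms on the other side, and (p - q)² ≥ 0
-- takes the form 2pq ≤ p² + q². The variance is the residual of a least-squares line, whose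
-- coefficients are the constants `w`, `g` and `h`.

-- Polynomials as coefficient lists: ring laws and the derivative.

module PolynomialRing {c ℓ} (R : CommutativeRing c ℓ) where
  open CommutativeRing R hiding (zero) renaming (Carrier to A)
  open RingProperties ring using (-0#≈0#)
  open SemiringMult semiring using (×-congʳ; ×-comm-*) renaming (_×_ to _·_)
  open CommMonoidMult +-commutativeMonoid using (×-distrib-+)
  open Polynomials rawRing
  open RawRing polynomials using () renaming (_≈_ to _≈ₓ_)
  open SetoidReasoning setoid
  open SemiringSolver commutativeSemiring using (solve; _:=_; _:+_; _:*_)

  -- Multiplication by the indeterminate, on coefficient sequences.
  shift : (ℕ → A) → ℕ → A
  shift g zero    = 0#
  shift g (suc k) = g k

  shift-cong : ∀ {g h} → (∀ k → g k ≈ h k) → ∀ k → shift g k ≈ shift h k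
  shift-cong g≈h zero    = refl
  shift-cong g≈h (suc k) = g≈h k

  shift-zero : ∀ k → shift (λ _ → 0#) k ≈ 0#
  shift-zero zero    = refl
  shift-zero (suc k) = refl

  shift-+ : ∀ g h k → shift (λ i → g i + h i) k ≈ shift g k + shift h k
  shift-+ g h zero    = sym (+-identityˡ 0#)
  shift-+ g h (suc k) = refl

  shift-* : ∀ a g k → shift (λ i → a * g i) k ≈ a * shift g k
  shift-* a g zero    = sym (zeroʳ a)
  shift-* a g (suc k) = refl

  coefficient-0∷ : ∀ p k → coefficient (0# ∷ p) k ≈ shift (coefficient p) k
  coefficient-0∷ p zero    = refl
  coefficient-0∷ p (suc k) = refl

  coefficient-add : ∀ p q k → coefficient (addₚ p q) k ≈ coefficient p k + coefficient q k
  coefficient-add []      q       k       = sym (+-identityˡ _)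
  coefficient-add (a ∷ p) []      k       = sym (+-identityʳ _)
  coefficient-add (a ∷ p) (b ∷ q) zero    = refl
  coefficient-add (a ∷ p) (b ∷ q) (suc k) = coefficient-add p q k

  coefficient-scale : ∀ a p k → coefficient (map (a *_) p) k ≈ a * coefficient p k
  coefficient-scale a []      k       = sym (zeroʳ a)
  coefficient-scale a (b ∷ p) zero    = refl
  coefficient-scale a (b ∷ p) (suc k) = coefficient-scale a p k

  coefficient-neg : ∀ p k → coefficient (map (-_) p) k ≈ - coefficient p k
  coefficient-neg []      k       = sym -0#≈0#
  coefficient-neg (b ∷ p) zero    = refl
  coefficient-neg (b ∷ p) (suc k) = coefficient-neg p k

  -- A product whose second factor is only a coefficient sequence. Lists that differ by trailing
  -- zeros are equal polynomials; a sequence forgets such zeros, so congruence and linearity in this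
  -- argument hold entry by entry.
  conv : List A → (ℕ → A) → ℕ → A
  conv []      g k = 0#
  conv (a ∷ p) g k = a * g k + shift (conv p g) k

  coefficient-mul : ∀ p q k → coefficient (mulₚ p q) k ≈ conv p (coefficient q) k
  coefficient-mul []      q k = refl
  coefficient-mul (a ∷ p) q k = begin
    coefficient (addₚ (map (a *_) q) (0# ∷ mulₚ p q)) k
      ≈⟨ coefficient-add (map (a *_) q) (0# ∷ mulₚ p q) k ⟩
    coefficient (map (a *_) q) k + coefficient (0# ∷ mulₚ p q) k
      ≈⟨ +-cong (coefficient-scale a q k) (coefficient-0∷ (mulₚ p q) k) ⟩
    a * coefficient q k + shift (coefficient (mulₚ p q)) k
      ≈⟨ +-congˡ (shift-cong (coefficient-mul p q) k) ⟩
    a * coefficient q k + shift (conv p (coefficient q)) k ∎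

  conv-congʳ : ∀ p {g h} → (∀ k → g k ≈ h k) → ∀ k → conv p g k ≈ conv p h k
  conv-congʳ []      g≈h k = refl
  conv-congʳ (a ∷ p) g≈h k = +-cong (*-congˡ (g≈h k)) (shift-cong (conv-congʳ p g≈h) k)

  conv-+ʳ : ∀ p g h k → conv p (λ i → g i + h i) k ≈ conv p g k + conv p h k
  conv-+ʳ []      g h k = sym (+-identityˡ 0#)
  conv-+ʳ (a ∷ p) g h k = begin
    a * (g k + h k) + shift (conv p (λ i → g i + h i)) k
      ≈⟨ +-congˡ (trans (shift-cong (conv-+ʳ p g h) k) (shift-+ (conv p g) (conv p h) k)) ⟩
    a * (g k + h k) + (shift (conv p g) k + shift (conv p h) k)
      ≈⟨ solve 5 (λ a x y s t → a :* (x :+ y) :+ (s :+ t) := (a :* x :+ s) :+ (a :* y :+ t))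
           refl a (g k) (h k) (shift (conv p g) k) (shift (conv p h) k) ⟩
    (a * g k + shift (conv p g) k) + (a * h k + shift (conv p h) k) ∎

  conv-shiftʳ : ∀ p g k → conv p (shift g) k ≈ shift (conv p g) k
  conv-shiftʳ []      g zero    = refl
  conv-shiftʳ []      g (suc k) = refl
  conv-shiftʳ (a ∷ p) g zero    = trans (+-identityʳ _) (zeroʳ a)
  conv-shiftʳ (a ∷ p) g (suc k) = +-congˡ (conv-shiftʳ p g k)

  conv-constantʳ : ∀ p a k → conv p (coefficient (a ∷ [])) k ≈ a * coefficient p k
  conv-constantʳ []      a k       = sym (zeroʳ a)
  conv-constantʳ (b ∷ p) a zero    = trans (+-identityʳ _) (*-comm b a)
  conv-constantʳ (b ∷ p) a (suc k) =
    trans (+-cong (zeroʳ b) (conv-constantʳ p a k)) (+-identityˡ _)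

  conv-zeroʳ : ∀ p k → conv p (coefficient []) k ≈ 0#
  conv-zeroʳ []      k       = refl
  conv-zeroʳ (a ∷ p) zero    = trans (+-identityʳ _) (zeroʳ a)
  conv-zeroʳ (a ∷ p) (suc k) = trans (+-cong (zeroʳ a) (conv-zeroʳ p k)) (+-identityˡ 0#)

  coefficient-∷ : ∀ a p k → coefficient (a ∷ p) k ≈ coefficient (a ∷ []) k + shift (coefficient p) k
  coefficient-∷ a p zero    = sym (+-identityʳ a)
  coefficient-∷ a p (suc k) = sym (+-identityˡ _)

  -- Induction on `p` alone suffices: as a sequence, `a ∷ p` is the constant `a` plus the shift of
  -- `p`, and a product is linear in its second argument and commutes with shifts there.
  conv-comm : ∀ p q k → conv p (coefficient q) k ≈ conv q (coefficient p) k
  conv-comm []      q k = sym (conv-zeroʳ q k)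
  conv-comm (a ∷ p) q k = begin
    a * coefficient q k + shift (conv p (coefficient q)) k
      ≈⟨ +-cong (sym (conv-constantʳ q a k)) (shift-cong (conv-comm p q) k) ⟩
    conv q (coefficient (a ∷ [])) k + shift (conv q (coefficient p)) k
      ≈⟨ +-congˡ (sym (conv-shiftʳ q (coefficient p) k)) ⟩
    conv q (coefficient (a ∷ [])) k + conv q (shift (coefficient p)) k
      ≈⟨ sym (conv-+ʳ q _ _ k) ⟩
    conv q (λ i → coefficient (a ∷ []) i + shift (coefficient p) i) k
      ≈⟨ conv-congʳ q (λ i → sym (coefficient-∷ a p i)) k ⟩
    conv q (coefficient (a ∷ p)) k ∎

  -- The recursion of `conv` follows its first list, and equal polynomials may be lists of different
  -- lengths. Commutativity moves them to the argument where only coefficients count.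
  conv-congˡ : ∀ {p q} r → p ≈ₓ q → ∀ k → conv p (coefficient r) k ≈ conv q (coefficient r) k
  conv-congˡ {p} {q} r p≈q k = begin
    conv p (coefficient r) k ≈⟨ conv-comm p r k ⟩
    conv r (coefficient p) k ≈⟨ conv-congʳ r p≈q k ⟩
    conv r (coefficient q) k ≈⟨ conv-comm r q k ⟩
    conv q (coefficient r) k ∎

  conv-addˡ : ∀ p q g k → conv (addₚ p q) g k ≈ conv p g k + conv q g k
  conv-addˡ []      q       g k = sym (+-identityˡ _)
  conv-addˡ (a ∷ p) []      g k = sym (+-identityʳ _)
  conv-addˡ (a ∷ p) (b ∷ q) g k = begin
    (a + b) * g k + shift (conv (addₚ p q) g) k
      ≈⟨ +-congˡ (trans (shift-cong (conv-addˡ p q g) k) (shift-+ (conv p g) (conv q g) k)) ⟩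
    (a + b) * g k + (shift (conv p g) k + shift (conv q g) k)
      ≈⟨ solve 5 (λ a b x s t → (a :+ b) :* x :+ (s :+ t) := (a :* x :+ s) :+ (b :* x :+ t))
           refl a b (g k) (shift (conv p g) k) (shift (conv q g) k) ⟩
    (a * g k + shift (conv p g) k) + (b * g k + shift (conv q g) k) ∎

  conv-scaleˡ : ∀ a p g k → conv (map (a *_) p) g k ≈ a * conv p g k
  conv-scaleˡ a []      g k = sym (zeroʳ a)
  conv-scaleˡ a (b ∷ p) g k = begin
    (a * b) * g k + shift (conv (map (a *_) p) g) k
      ≈⟨ +-cong (*-assoc a b (g k))
           (trans (shift-cong (conv-scaleˡ a p g) k) (shift-* a (conv p g) k)) ⟩
    a * (b * g k) + a * shift (conv p g) k
      ≈⟨ sym (distribˡ a _ _) ⟩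
    a * (b * g k + shift (conv p g) k) ∎

  conv-assoc : ∀ p q g k → conv (mulₚ p q) g k ≈ conv p (conv q g) k
  conv-assoc []      q g k = refl
  conv-assoc (a ∷ p) q g k = begin
    conv (addₚ (map (a *_) q) (0# ∷ mulₚ p q)) g k
      ≈⟨ conv-addˡ (map (a *_) q) (0# ∷ mulₚ p q) g k ⟩
    conv (map (a *_) q) g k + (0# * g k + shift (conv (mulₚ p q) g) k)
      ≈⟨ +-cong (conv-scaleˡ a q g k) (trans (+-congʳ (zeroˡ _)) (+-identityˡ _)) ⟩
    a * conv q g k + shift (conv (mulₚ p q) g) k
      ≈⟨ +-congˡ (shift-cong (conv-assoc p q g) k) ⟩
    a * conv q g k + shift (conv p (conv q g)) k ∎

  private
    viaConv : ∀ {p q p′ q′} → (∀ k → conv p (coefficient q) k ≈ conv p′ (coefficient q′) k) →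
              mulₚ p q ≈ₓ mulₚ p′ q′
    viaConv {p} {q} {p′} {q′} eq k =
      trans (coefficient-mul p q k) (trans (eq k) (sym (coefficient-mul p′ q′ k)))

  addₚ-cong : ∀ {p p′ q q′} → p ≈ₓ p′ → q ≈ₓ q′ → addₚ p q ≈ₓ addₚ p′ q′
  addₚ-cong {p} {p′} {q} {q′} p≈p′ q≈q′ k = begin
    coefficient (addₚ p q) k           ≈⟨ coefficient-add p q k ⟩
    coefficient p k + coefficient q k  ≈⟨ +-cong (p≈p′ k) (q≈q′ k) ⟩
    coefficient p′ k + coefficient q′ k ≈⟨ sym (coefficient-add p′ q′ k) ⟩
    coefficient (addₚ p′ q′) k         ∎

  addₚ-comm : ∀ p q → addₚ p q ≈ₓ addₚ q p
  addₚ-comm p q k = begin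
    coefficient (addₚ p q) k          ≈⟨ coefficient-add p q k ⟩
    coefficient p k + coefficient q k ≈⟨ +-comm _ _ ⟩
    coefficient q k + coefficient p k ≈⟨ sym (coefficient-add q p k) ⟩
    coefficient (addₚ q p) k          ∎

  addₚ-assoc : ∀ p q s → addₚ (addₚ p q) s ≈ₓ addₚ p (addₚ q s)
  addₚ-assoc p q s k = begin
    coefficient (addₚ (addₚ p q) s) k
      ≈⟨ trans (coefficient-add (addₚ p q) s k) (+-congʳ (coefficient-add p q k)) ⟩
    (coefficient p k + coefficient q k) + coefficient s k
      ≈⟨ +-assoc _ _ _ ⟩
    coefficient p k + (coefficient q k + coefficient s k)
      ≈⟨ sym (trans (coefficient-add p (addₚ q s) k) (+-congˡ (coefficient-add q s k))) ⟩
    coefficient (addₚ p (addₚ q s)) k ∎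

  negₚ-inverseʳ : ∀ p → addₚ p (map (-_) p) ≈ₓ []
  negₚ-inverseʳ p k = begin
    coefficient (addₚ p (map (-_) p)) k            ≈⟨ coefficient-add p (map (-_) p) k ⟩
    coefficient p k + coefficient (map (-_) p) k   ≈⟨ +-congˡ (coefficient-neg p k) ⟩
    coefficient p k + - coefficient p k            ≈⟨ -‿inverseʳ _ ⟩
    0# ∎

  mulₚ-comm : ∀ p q → mulₚ p q ≈ₓ mulₚ q p
  mulₚ-comm p q = viaConv {p} {q} {q} {p} (conv-comm p q)

  mulₚ-identityˡ : ∀ p → mulₚ (1# ∷ []) p ≈ₓ p
  mulₚ-identityˡ p k = trans (coefficient-mul (1# ∷ []) p k) (begin
    1# * coefficient p k + shift (λ _ → 0#) k ≈⟨ +-cong (*-identityˡ _) (shift-zero k) ⟩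
    coefficient p k + 0#                      ≈⟨ +-identityʳ _ ⟩
    coefficient p k ∎)

  mulₚ-assoc : ∀ p q s → mulₚ (mulₚ p q) s ≈ₓ mulₚ p (mulₚ q s)
  mulₚ-assoc p q s = viaConv {mulₚ p q} {s} {p} {mulₚ q s} λ k →
    trans (conv-assoc p q (coefficient s) k)
          (conv-congʳ p (λ i → sym (coefficient-mul q s i)) k)

  mulₚ-cong : ∀ {p p′ q q′} → p ≈ₓ p′ → q ≈ₓ q′ → mulₚ p q ≈ₓ mulₚ p′ q′
  mulₚ-cong {p} {p′} {q} {q′} p≈p′ q≈q′ = viaConv {p} {q} {p′} {q′} λ k →
    trans (conv-congˡ {p} {p′} q p≈p′ k) (conv-congʳ p′ q≈q′ k)

  mulₚ-distribʳ : ∀ s p q → mulₚ (addₚ p q) s ≈ₓ addₚ (mulₚ p s) (mulₚ q s)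
  mulₚ-distribʳ s p q k = begin
    coefficient (mulₚ (addₚ p q) s) k
      ≈⟨ trans (coefficient-mul (addₚ p q) s k) (conv-addˡ p q (coefficient s) k) ⟩
    conv p (coefficient s) k + conv q (coefficient s) k
      ≈⟨ sym (trans (coefficient-add (mulₚ p s) (mulₚ q s) k)
                    (+-cong (coefficient-mul p s k) (coefficient-mul q s k))) ⟩
    coefficient (addₚ (mulₚ p s) (mulₚ q s)) k ∎

  polynomialRing : CommutativeRing c ℓ
  polynomialRing = record
    { RawRing polynomials
    ; isCommutativeRing = record
      { isRing = record
        { +-isAbelianGroup = record
          { isGroup = record
            { isMonoid = record
              { isSemigroup = record
                { isMagma = record
                  { isEquivalence = record
                    { refl  = λ k → refl
                    ; sym   = λ eq k → sym (eq k)
                    ; trans = λ eq eq′ k → trans (eq k) (eq′ k)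
                    }
                  ; ∙-cong = λ {p} {p′} {q} {q′} → addₚ-cong {p} {p′} {q} {q′}
                  }
                ; assoc = addₚ-assoc
                }
              ; identity = (λ p k → refl) , λ p → addₚ-comm p []
              }
            ; inverse = (λ p k → trans (addₚ-comm (map (-_) p) p k) (negₚ-inverseʳ p k)) , negₚ-inverseʳ
            ; ⁻¹-cong = λ {p} {q} p≈q k →
                trans (coefficient-neg p k) (trans (-‿cong (p≈q k)) (sym (coefficient-neg q k)))
            }
          ; comm = addₚ-comm
          }
        ; *-cong = λ {p} {p′} {q} {q′} → mulₚ-cong {p} {p′} {q} {q′}
        ; *-assoc = mulₚ-assoc
        ; *-identity = mulₚ-identityˡ , λ p k → trans (mulₚ-comm p (1# ∷ []) k) (mulₚ-identityˡ p k)
        ; distrib = (λ s p q k → trans (mulₚ-comm s (addₚ p q) k)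
                       (trans (mulₚ-distribʳ s p q k)
                              (addₚ-cong {mulₚ p s} {mulₚ s p} {mulₚ q s} {mulₚ s q}
                                         (mulₚ-comm p s) (mulₚ-comm q s) k)))
                  , mulₚ-distribʳ
        }
      ; *-comm = mulₚ-comm
      }
    }

  -- Horner form of the product rule: (a + x p)′ = p + x p′.
  derivative : List A → List A
  derivative []      = []
  derivative (a ∷ p) = addₚ p (0# ∷ derivative p)

  coefficient-derivative : ∀ p k → coefficient (derivative p) k ≈ suc k · coefficient p (suc k)
  coefficient-derivative []      k       = sym (n·0 (suc k))
    where
    n·0 : ∀ n → n · 0# ≈ 0#
    n·0 zero    = refl
    n·0 (suc n) = trans (+-identityˡ _) (n·0 n)
  coefficient-derivative (a ∷ p) zero    = coefficient-add p (0# ∷ derivative p) zero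
  coefficient-derivative (a ∷ p) (suc k) =
    trans (coefficient-add p (0# ∷ derivative p) (suc k)) (+-congˡ (coefficient-derivative p k))

  derivative-cong : ∀ {p q} → p ≈ₓ q → derivative p ≈ₓ derivative q
  derivative-cong {p} {q} p≈q k = begin
    coefficient (derivative p) k  ≈⟨ coefficient-derivative p k ⟩
    suc k · coefficient p (suc k) ≈⟨ ×-congʳ (suc k) (p≈q (suc k)) ⟩
    suc k · coefficient q (suc k) ≈⟨ sym (coefficient-derivative q k) ⟩
    coefficient (derivative q) k  ∎

  derivative-add : ∀ p q → derivative (addₚ p q) ≈ₓ addₚ (derivative p) (derivative q)
  derivative-add p q k = begin
    coefficient (derivative (addₚ p q)) k
      ≈⟨ coefficient-derivative (addₚ p q) k ⟩
    suc k · coefficient (addₚ p q) (suc k)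
      ≈⟨ trans (×-congʳ (suc k) (coefficient-add p q (suc k))) (×-distrib-+ _ _ (suc k)) ⟩
    suc k · coefficient p (suc k) + suc k · coefficient q (suc k)
      ≈⟨ sym (+-cong (coefficient-derivative p k) (coefficient-derivative q k)) ⟩
    coefficient (derivative p) k + coefficient (derivative q) k
      ≈⟨ sym (coefficient-add (derivative p) (derivative q) k) ⟩
    coefficient (addₚ (derivative p) (derivative q)) k ∎

  derivative-scale : ∀ a p → derivative (map (a *_) p) ≈ₓ map (a *_) (derivative p)
  derivative-scale a p k = begin
    coefficient (derivative (map (a *_) p)) k
      ≈⟨ coefficient-derivative (map (a *_) p) k ⟩
    suc k · coefficient (map (a *_) p) (suc k)
      ≈⟨ trans (×-congʳ (suc k) (coefficient-scale a p (suc k))) (sym (×-comm-* (suc k) a _)) ⟩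
    a * (suc k · coefficient p (suc k))
      ≈⟨ sym (trans (coefficient-scale a (derivative p) k) (*-congˡ (coefficient-derivative p k))) ⟩
    coefficient (map (a *_) (derivative p)) k ∎

  private
    ∷-cong : ∀ {p q} → p ≈ₓ q → (0# ∷ p) ≈ₓ (0# ∷ q)
    ∷-cong p≈q zero    = refl
    ∷-cong p≈q (suc k) = p≈q k

    0∷-add : ∀ p q → (0# ∷ addₚ p q) ≈ₓ addₚ (0# ∷ p) (0# ∷ q)
    0∷-add p q zero    = sym (+-identityˡ 0#)
    0∷-add p q (suc k) = refl

    mul-0∷ : ∀ p q → mulₚ (0# ∷ p) q ≈ₓ (0# ∷ mulₚ p q)
    mul-0∷ p q k = begin
      coefficient (addₚ (map (0# *_) q) (0# ∷ mulₚ p q)) k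
        ≈⟨ coefficient-add (map (0# *_) q) (0# ∷ mulₚ p q) k ⟩
      coefficient (map (0# *_) q) k + coefficient (0# ∷ mulₚ p q) k
        ≈⟨ +-congʳ (trans (coefficient-scale 0# q k) (zeroˡ _)) ⟩
      0# + coefficient (0# ∷ mulₚ p q) k
        ≈⟨ +-identityˡ _ ⟩
      coefficient (0# ∷ mulₚ p q) k ∎

  -- Induction along (a + x p) q = a q + x (p q): its derivative a q′ + p q + x (p′ q + p q′)
  -- regroups as (p + x p′) q + (a + x p) q′.
  derivative-mul : ∀ p q → derivative (mulₚ p q) ≈ₓ addₚ (mulₚ (derivative p) q) (mulₚ p (derivative q))
  derivative-mul []      q = λ k → refl
  derivative-mul (a ∷ p) q k = begin
    coefficient (derivative (addₚ aq (0# ∷ pq))) k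
      ≈⟨ trans (derivative-add aq (0# ∷ pq) k)
               (coefficient-add (derivative aq) (addₚ pq (0# ∷ derivative pq)) k) ⟩
    coefficient (derivative aq) k + coefficient (addₚ pq (0# ∷ derivative pq)) k
      ≈⟨ +-cong (derivative-scale a q k) (coefficient-add pq (0# ∷ derivative pq) k) ⟩
    aq′ + (coefficient pq k + coefficient (0# ∷ derivative pq) k)
      ≈⟨ +-congˡ (+-congˡ (∷-cong {derivative pq} (derivative-mul p q) k)) ⟩
    aq′ + (coefficient pq k + coefficient (0# ∷ addₚ (mulₚ p′ q) (mulₚ p q′)) k)
      ≈⟨ +-congˡ (+-congˡ (trans (0∷-add (mulₚ p′ q) (mulₚ p q′) k)
                                 (coefficient-add (0# ∷ mulₚ p′ q) (0# ∷ mulₚ p q′) k))) ⟩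
    aq′ + (coefficient pq k + (z + w))
      ≈⟨ solve 4 (λ x y z w → x :+ (y :+ (z :+ w)) := (y :+ z) :+ (x :+ w)) refl aq′ _ z w ⟩
    (coefficient pq k + z) + (aq′ + w)
      ≈⟨ sym (+-cong left (coefficient-add (map (a *_) q′) (0# ∷ mulₚ p q′) k)) ⟩
    coefficient (mulₚ (addₚ p (0# ∷ p′)) q) k + coefficient (mulₚ (a ∷ p) q′) k
      ≈⟨ sym (coefficient-add (mulₚ (addₚ p (0# ∷ p′)) q) (mulₚ (a ∷ p) q′) k) ⟩
    coefficient (addₚ (mulₚ (addₚ p (0# ∷ p′)) q) (mulₚ (a ∷ p) q′)) k ∎
    where
    aq = map (a *_) q
    pq = mulₚ p q
    p′ = derivative p
    q′ = derivative q
    aq′ = coefficient (map (a *_) q′) k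
    z = coefficient (0# ∷ mulₚ p′ q) k
    w = coefficient (0# ∷ mulₚ p q′) k
    left : coefficient (mulₚ (addₚ p (0# ∷ p′)) q) k ≈ coefficient pq k + z
    left = trans (mulₚ-distribʳ q p (0# ∷ p′) k)
             (trans (coefficient-add pq (mulₚ (0# ∷ p′) q) k) (+-congˡ (mul-0∷ p′ q k)))

-- Matrices over a semiring, serving ℕ, rings and polynomials alike.

module MatrixAlgebra {c ℓ} (S : Semiring c ℓ) where
  open Semiring S hiding (zero) renaming (Carrier to A)
  open SemiringSum S
  open SetoidReasoning setoid

  sum-zero : ∀ {n} {g : Fin n → A} → (∀ i → g i ≈ 0#) → sum g ≈ 0#
  sum-zero {n} g≈0 = trans (sum-cong-≋ g≈0) (sum-replicate-zero n)

  unit : ∀ {n} → Fin n → Fin n → A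
  unit i j = if does (i ≟ᶠ j) then 1# else 0#

  unit-diagonal : ∀ {n} (i : Fin n) → unit i i ≈ 1#
  unit-diagonal i with i ≟ᶠ i
  ... | yes _   = refl
  ... | no  i≢i = contradiction ≡.refl i≢i

  sum-unitʳ : ∀ {n} (x : Fin n → A) k → sum (λ j → x j * unit j k) ≈ x k
  sum-unitʳ x zero = begin
    x zero * 1# + sum (λ j → x (suc j) * 0#) ≈⟨ +-cong (*-identityʳ _) (sum-zero λ j → zeroʳ (x (suc j))) ⟩
    x zero + 0#                              ≈⟨ +-identityʳ _ ⟩
    x zero                                   ∎
  sum-unitʳ x (suc k) = begin
    x zero * 0# + sum (λ j → x (suc j) * unit j k) ≈⟨ +-cong (zeroʳ _) (sum-unitʳ (x ∘ suc) k) ⟩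
    0# + x (suc k)                                 ≈⟨ +-identityˡ _ ⟩
    x (suc k)                                      ∎

  sum-unitˡ : ∀ {n} (x : Fin n → A) k → sum (λ j → unit k j * x j) ≈ x k
  sum-unitˡ x zero = begin
    1# * x zero + sum (λ j → 0# * x (suc j)) ≈⟨ +-cong (*-identityˡ _) (sum-zero λ j → zeroˡ (x (suc j))) ⟩
    x zero + 0#                              ≈⟨ +-identityʳ _ ⟩
    x zero                                   ∎
  sum-unitˡ x (suc k) = begin
    0# * x zero + sum (λ j → unit k j * x (suc j)) ≈⟨ +-cong (zeroˡ _) (sum-unitˡ (x ∘ suc) k) ⟩
    0# + x (suc k)                                 ≈⟨ +-identityˡ _ ⟩
    x (suc k)                                      ∎

  infixl 7 _∙_
  _∙_ : ∀ {n} → Matrix A n → Matrix A n → Matrix A n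
  (M ∙ N) i j = sum λ k → M i k * N k j

  -- New factors enter on the right, the order in which `pairing-step` produces them.
  power : ∀ {n} → Matrix A n → ℕ → Matrix A n
  power M zero    = unit
  power M (suc k) = power M k ∙ M

  trace : ∀ {n} → Matrix A n → A
  trace M = sum λ i → M i i

  ∙-congʳ : ∀ {n} {M M′ : Matrix A n} N → (∀ i j → M i j ≈ M′ i j) → ∀ i j → (M ∙ N) i j ≈ (M′ ∙ N) i j
  ∙-congʳ {n} N M≈M′ i j = sum-cong-≋ {n} λ k → *-congʳ (M≈M′ i k)

  ∙-assoc : ∀ {n} (L M N : Matrix A n) i j → ((L ∙ M) ∙ N) i j ≈ (L ∙ (M ∙ N)) i j
  ∙-assoc {n} L M N i j = begin
    (sum λ l → (sum λ k → L i k * M k l) * N l j)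
      ≈⟨ sum-cong-≋ {n} (λ l → trans (*-distribʳ-sum (N l j) (λ k → L i k * M k l))
                                     (sum-cong-≋ {n} λ k → *-assoc (L i k) (M k l) (N l j))) ⟩
    (sum λ l → sum λ k → L i k * (M k l * N l j))
      ≈⟨ ∑-comm (λ l k → L i k * (M k l * N l j)) ⟩
    (sum λ k → sum λ l → L i k * (M k l * N l j))
      ≈⟨ sum-cong-≋ {n} (λ k → sym (*-distribˡ-sum (L i k) (λ l → M k l * N l j))) ⟩
    (sum λ k → L i k * (M ∙ N) k j) ∎

  module _ {n} (M : Matrix A n) where
    power-1 : ∀ i j → power M 1 i j ≈ M i j
    power-1 i j = sum-unitˡ (λ k → M k j) i

    power-2 : ∀ i j → power M 2 i j ≈ (M ∙ M) i j
    power-2 = ∙-congʳ M power-1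

    trace-power-3 : trace (power M 3) ≈ sum λ i → sum λ j → (M ∙ M) i j * M j i
    trace-power-3 = sum-cong-≋ {n} λ i → ∙-congʳ M power-2 i i

    trace-power-4 : trace (power M 4) ≈ sum λ i → sum λ j → (M ∙ M) i j * (M ∙ M) j i
    trace-power-4 = sum-cong-≋ {n} λ i →
      trans (∙-assoc (power M 2) M M i i) (∙-congʳ (M ∙ M) power-2 i i)

-- Determinants: alternation, cofactors and derivations.

lift : ∀ {m n} → (Fin m → Fin n) → Fin (suc m) → Fin (suc n)
lift σ zero    = zero
lift σ (suc i) = suc (σ i)

module DeterminantTheory {c ℓ} (R : CommutativeRing c ℓ) where
  open CommutativeRing R hiding (zero) renaming (Carrier to A)
  open RingProperties ring using (-‿involutive; -1*x≈-x; +-cancelˡ)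
  open SemiringSum semiring
  open RawSemiringDefs (RawRing.rawSemiring rawRing) using (_^_)
  open Determinant rawRing
  open MatrixAlgebra semiring
  open SetoidReasoning setoid
  open SemiringSolver commutativeSemiring using (solve; _:=_; _:+_; _:*_; con)

  sgn : ∀ {n} → Fin n → A
  sgn j = (- 1#) ^ toℕ j

  minor : ∀ {n} → Matrix A (suc n) → Fin (suc n) → Matrix A n
  minor M j i k = M (suc i) (punchIn j k)

  sum-linear : ∀ {m n} {w : Fin n → A} (x : Fin m → A) (u : Fin m → Fin n → A) →
               (∀ j → w j ≈ sum λ s → x s * u s j) → sum w ≈ sum λ s → x s * sum (u s)
  sum-linear {w = w} x u eq = begin
    sum w                           ≈⟨ sum-cong-≋ eq ⟩
    sum (λ j → sum λ s → x s * u s j) ≈⟨ ∑-comm (λ j s → x s * u s j) ⟩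
    sum (λ s → sum λ j → x s * u s j) ≈⟨ sum-cong-≋ (λ s → sym (*-distribˡ-sum (x s) (u s))) ⟩
    sum (λ s → x s * sum (u s))     ∎

  *-*-distrib-sum : ∀ {n} a b (u : Fin n → A) → a * (b * sum u) ≈ sum λ s → a * (b * u s)
  *-*-distrib-sum a b u = trans (*-congˡ (*-distribˡ-sum b u)) (*-distribˡ-sum a (λ s → b * u s))

  det-cong : ∀ {n} {M N : Matrix A n} → (∀ i j → M i j ≈ N i j) → det M ≈ det N
  det-cong {zero}  M≈N = refl
  det-cong {suc n} M≈N = sum-cong-≋ λ j →
    *-congˡ {sgn j} (*-cong (M≈N zero j) (det-cong λ i k → M≈N (suc i) (punchIn j k)))

  -- Recursion on the row index, rather than a test for equality, lets a replacement below row 0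
  -- commute with taking minors by computation. Rows are removed one at a time, hence rectangular
  -- matrices.
  replaceRow : ∀ {m n} → (Fin m → Fin n → A) → Fin m → (Fin n → A) → Fin m → Fin n → A
  replaceRow M zero    x zero    = x
  replaceRow M zero    x (suc k) = M (suc k)
  replaceRow M (suc i) x zero    = M zero
  replaceRow M (suc i) x (suc k) = replaceRow (M ∘ suc) i x k

  replaceRow-same : ∀ {m n} (M : Fin m → Fin n → A) i x → replaceRow M i x i ≡ x
  replaceRow-same M zero    x = ≡.refl
  replaceRow-same M (suc i) x = replaceRow-same (M ∘ suc) i x

  replaceRow-other : ∀ {m n} (M : Fin m → Fin n → A) i x k → i ≢ k → replaceRow M i x k ≡ M k
  replaceRow-other M zero    x zero    i≢k = contradiction ≡.refl i≢k
  replaceRow-other M zero    x (suc k) i≢k = ≡.refl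
  replaceRow-other M (suc i) x zero    i≢k = ≡.refl
  replaceRow-other M (suc i) x (suc k) i≢k = replaceRow-other (M ∘ suc) i x k (i≢k ∘ ≡.cong suc)

  replaceRow-self : ∀ {m n} (M : Fin m → Fin n → A) i k → replaceRow M i (M i) k ≡ M k
  replaceRow-self M zero    zero    = ≡.refl
  replaceRow-self M zero    (suc k) = ≡.refl
  replaceRow-self M (suc i) zero    = ≡.refl
  replaceRow-self M (suc i) (suc k) = replaceRow-self (M ∘ suc) i k

  replaceRow-cong : ∀ {m n} (M : Fin m → Fin n → A) i {x y} → (∀ j → x j ≈ y j) →
                    ∀ k j → replaceRow M i x k j ≈ replaceRow M i y k j
  replaceRow-cong M zero    x≈y zero    j = x≈y j
  replaceRow-cong M zero    x≈y (suc k) j = refl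
  replaceRow-cong M (suc i) x≈y zero    j = refl
  replaceRow-cong M (suc i) x≈y (suc k) j = replaceRow-cong (M ∘ suc) i x≈y k j

  replaceRow-columns : ∀ {l m n} (M : Fin l → Fin n → A) i x (σ : Fin m → Fin n) k j →
                       replaceRow M i x k (σ j) ≡ replaceRow (λ a b → M a (σ b)) i (x ∘ σ) k j
  replaceRow-columns M zero    x σ zero    j = ≡.refl
  replaceRow-columns M zero    x σ (suc k) j = ≡.refl
  replaceRow-columns M (suc i) x σ zero    j = ≡.refl
  replaceRow-columns M (suc i) x σ (suc k) j = replaceRow-columns (M ∘ suc) i x σ k j

  det-minor-replaceRow : ∀ {n} (M : Matrix A (suc n)) i x j →
    det (minor (replaceRow M (suc i) x) j) ≈ det (replaceRow (minor M j) i (x ∘ punchIn j))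
  det-minor-replaceRow M i x j = det-cong λ k l →
    reflexive (replaceRow-columns (M ∘ suc) i x (punchIn j) k l)

  -- Linear combinations of any length are allowed because `cofactor-expansion` writes a row as a
  -- combination of all the unit rows; additivity is the case of two terms.
  det-linear : ∀ {m n} (M : Matrix A n) i (x : Fin m → A) (X : Fin m → Fin n → A) →
    det (replaceRow M i (λ k → sum λ s → x s * X s k)) ≈ sum λ s → x s * det (replaceRow M i (X s))
  det-linear M zero x X = sum-linear x (λ s j → sgn j * (X s j * det (minor M j))) λ j → begin
    sgn j * ((sum λ s → x s * X s j) * det (minor M j))
      ≈⟨ *-congˡ (*-distribʳ-sum (det (minor M j)) (λ s → x s * X s j)) ⟩
    sgn j * (sum λ s → x s * X s j * det (minor M j))
      ≈⟨ *-distribˡ-sum (sgn j) (λ s → x s * X s j * det (minor M j)) ⟩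
    (sum λ s → sgn j * (x s * X s j * det (minor M j)))
      ≈⟨ sum-cong-≋ (λ s → solve 4 (λ a b c d → a :* (b :* c :* d) := b :* (a :* (c :* d)))
           refl (sgn j) (x s) (X s j) (det (minor M j))) ⟩
    (sum λ s → x s * (sgn j * (X s j * det (minor M j)))) ∎
  det-linear {n = suc n} M (suc i) x X =
    sum-linear x (λ s j → sgn j * (M zero j * det (minor (replaceRow M (suc i) (X s)) j))) λ j → begin
    sgn j * (M zero j * det (minor (replaceRow M (suc i) (λ k → sum λ s → x s * X s k)) j))
      ≈⟨ *-congˡ (*-congˡ (trans (det-minor-replaceRow M i _ j)
                                 (det-linear (minor M j) i x (λ s k → X s (punchIn j k))))) ⟩
    sgn j * (M zero j * (sum λ s → x s * det (replaceRow (minor M j) i (X s ∘ punchIn j))))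
      ≈⟨ *-*-distrib-sum (sgn j) (M zero j) (λ s → x s * det (replaceRow (minor M j) i (X s ∘ punchIn j))) ⟩
    (sum λ s → sgn j * (M zero j * (x s * det (replaceRow (minor M j) i (X s ∘ punchIn j)))))
      ≈⟨ sum-cong-≋ (λ s → trans
           (solve 4 (λ a b c d → a :* (b :* (c :* d)) := c :* (a :* (b :* d)))
             refl (sgn j) (M zero j) (x s) _)
           (*-congˡ (*-congˡ (*-congˡ (sym (det-minor-replaceRow M i (X s) j)))))) ⟩
    (sum λ s → x s * (sgn j * (M zero j * det (minor (replaceRow M (suc i) (X s)) j)))) ∎

  det-additive : ∀ {n} (M : Matrix A n) i (x y : Fin n → A) →
    det (replaceRow M i (λ k → x k + y k)) ≈ det (replaceRow M i x) + det (replaceRow M i y)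
  det-additive M i x y = begin
    det (replaceRow M i (λ k → x k + y k))
      ≈⟨ det-cong (replaceRow-cong M i λ k → sym (1*-+ (x k) (y k))) ⟩
    det (replaceRow M i (λ k → sum λ s → 1# * X s k))
      ≈⟨ det-linear M i (λ _ → 1#) X ⟩
    (sum λ s → 1# * det (replaceRow M i (X s)))
      ≈⟨ 1*-+ _ _ ⟩
    det (replaceRow M i x) + det (replaceRow M i y) ∎
    where
    X : Fin 2 → Fin _ → A
    X zero    = x
    X (suc _) = y
    1*-+ : ∀ a b → 1# * a + (1# * b + 0#) ≈ a + b
    1*-+ a b = +-cong (*-identityˡ a) (trans (+-identityʳ _) (*-identityˡ b))

  -- In a double expansion along two equal rows, the term that deletes column 0
  -- and then column k + 1 cancels the one that deletes column k + 1 and then column 0.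
  expansion-cancels : ∀ m (x : Fin (2 ℕ.+ m) → A) (D : (Fin m → Fin (2 ℕ.+ m)) → A) →
    (∀ {σ τ} → σ ≗ τ → D σ ≈ D τ) →
    (sum λ j → sum λ k → sgn j * (x j * (sgn k * (x (punchIn j k) * D (λ i → punchIn j (punchIn k i)))))) ≈ 0#
  expansion-cancels m x D D-cong = begin
    sum (F zero) + sum (λ j → F (suc j) zero + sum (λ k → F (suc j) (suc k)))
      ≈⟨ +-congˡ (∑-distrib-+ (λ j → F (suc j) zero) (λ j → sum (λ k → F (suc j) (suc k)))) ⟩
    sum (F zero) + (sum (λ j → F (suc j) zero) + sum (λ j → sum (λ k → F (suc j) (suc k))))
      ≈⟨ sym (+-assoc _ _ _) ⟩
    (sum (F zero) + sum (λ j → F (suc j) zero)) + sum (λ j → sum (λ k → F (suc j) (suc k)))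
      ≈⟨ +-cong (trans (sym (∑-distrib-+ (F zero) (λ j → F (suc j) zero))) (sum-zero first)) (rest m x D D-cong) ⟩
    0# + 0#
      ≈⟨ +-identityˡ 0# ⟩
    0# ∎
    where
    F : Fin (2 ℕ.+ m) → Fin (suc m) → A
    F j k = sgn j * (x j * (sgn k * (x (punchIn j k) * D (λ i → punchIn j (punchIn k i)))))

    first : ∀ k → F zero k + F (suc k) zero ≈ 0#
    first k = begin
      1# * (x zero * (sgn k * (x (suc k) * d))) + (- 1# * sgn k) * (x (suc k) * (1# * (x zero * D _)))
        ≈⟨ +-congˡ (*-congˡ (*-congˡ (*-congˡ (*-congˡ (D-cong λ i → ≡.refl))))) ⟩
      1# * (x zero * (sgn k * (x (suc k) * d))) + (- 1# * sgn k) * (x (suc k) * (1# * (x zero * d)))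
        ≈⟨ solve 5 (λ m s a b d → con 1 :* (a :* (s :* (b :* d))) :+ (m :* s) :* (b :* (con 1 :* (a :* d)))
                                  := (con 1 :+ m) :* (s :* (a :* (b :* d))))
             refl (- 1#) (sgn k) (x zero) (x (suc k)) d ⟩
      (1# + - 1#) * (sgn k * (x zero * (x (suc k) * d)))
        ≈⟨ trans (*-congʳ (-‿inverseʳ 1#)) (zeroˡ _) ⟩
      0# ∎
      where d = D (λ i → suc (punchIn k i))

    -- When neither deleted column is column 0, the two signs gain a factor (-1)² = 1 and column 0
    -- survives both deletions. What remains is the same double sum over one column fewer, with
    -- column 0 put back by `lift`.
    rest : ∀ m (x : Fin (2 ℕ.+ m) → A) (D : (Fin m → Fin (2 ℕ.+ m)) → A) →
      (∀ {σ τ} → σ ≗ τ → D σ ≈ D τ) →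
      (sum λ (j : Fin (suc m)) → sum λ (k : Fin m) → sgn (suc j) * (x (suc j) *
        (sgn (suc k) * (x (suc (punchIn j k)) * D (λ i → punchIn (suc j) (punchIn (suc k) i)))))) ≈ 0#
    rest zero    x D D-cong = +-identityˡ 0#
    rest (suc m) x D D-cong = trans
      (sum-cong-≋ λ j → sum-cong-≋ λ k → begin
        (- 1# * sgn j) * (x (suc j) * ((- 1# * sgn k) * (x (suc (punchIn j k)) * D _)))
          ≈⟨ *-congˡ (*-congˡ (*-congˡ (*-congˡ (D-cong (commutes j k))))) ⟩
        (- 1# * sgn j) * (x (suc j) * ((- 1# * sgn k) * (x (suc (punchIn j k)) * D (lift _))))
          ≈⟨ solve 6 (λ m s a t b d → (m :* s) :* (a :* ((m :* t) :* (b :* d)))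
                                      := (m :* m) :* (s :* (a :* (t :* (b :* d)))))
               refl (- 1#) (sgn j) (x (suc j)) (sgn k) (x (suc (punchIn j k))) _ ⟩
        (- 1# * - 1#) * (sgn j * (x (suc j) * (sgn k * (x (suc (punchIn j k)) * D (lift _)))))
          ≈⟨ trans (*-congʳ (trans (-1*x≈-x (- 1#)) (-‿involutive 1#))) (*-identityˡ _) ⟩
        sgn j * (x (suc j) * (sgn k * (x (suc (punchIn j k)) * D (lift (λ i → punchIn j (punchIn k i)))))) ∎)
      (expansion-cancels m (x ∘ suc) (D ∘ lift) λ {σ} {τ} σ≗τ → D-cong (lift-cong σ≗τ))
      where
      lift-cong : ∀ {m n} {σ τ : Fin m → Fin n} → σ ≗ τ → lift σ ≗ lift τ
      lift-cong σ≗τ zero    = ≡.refl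
      lift-cong σ≗τ (suc i) = ≡.cong suc (σ≗τ i)
      commutes : ∀ j k (i : Fin (suc m)) →
        punchIn (suc j) (punchIn (suc k) i) ≡ lift (λ i → punchIn j (punchIn k i)) i
      commutes j k zero    = ≡.refl
      commutes j k (suc i) = ≡.refl

  -- Expanding along rows 0 and 1 gives the double sum of `expansion-cancels`, where `D σ` is the
  -- determinant of the remaining rows on the columns selected by `σ`.
  det-equal-first-rows : ∀ {n} (M : Matrix A (2 ℕ.+ n)) →
    (∀ j → M zero j ≈ M (suc zero) j) → det M ≈ 0#
  det-equal-first-rows {n} M eq = trans
    (sum-cong-≋ λ j → trans
      (*-congˡ {sgn j} (*-cong (eq j) refl))
      (*-*-distrib-sum (sgn j) (M (suc zero) j) λ k →
        sgn k * (M (suc zero) (punchIn j k) * det λ i l → M (suc (suc i)) (punchIn j (punchIn k l)))))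
    (expansion-cancels n (M (suc zero)) (λ σ → det λ i k → M (suc (suc i)) (σ k))
      λ σ≗τ → det-cong λ i k → reflexive (≡.cong (M (suc (suc i))) (σ≗τ k)))

  EqualRowsVanish : ℕ → Set _
  EqualRowsVanish n = (M : Matrix A n) → ∀ i k → i ≢ k → (∀ j → M i j ≈ M k j) → det M ≈ 0#

  det-equal-later-rows : ∀ {n} → EqualRowsVanish n → (M : Matrix A (suc n)) → ∀ i k → i ≢ k →
    (∀ j → M (suc i) j ≈ M (suc k) j) → det M ≈ 0#
  det-equal-later-rows vanish M i k i≢k eq = sum-zero λ j → begin
    sgn j * (M zero j * det (minor M j))
      ≈⟨ *-congˡ (*-congˡ (vanish (minor M j) i k i≢k (λ l → eq (punchIn j l)))) ⟩
    sgn j * (M zero j * 0#) ≈⟨ trans (*-congˡ (zeroʳ _)) (zeroʳ _) ⟩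
    0# ∎

  -- Antisymmetry in rows 1 and k moves the row equal to row 0 next to it.
  det-equal-row-zero : ∀ {n} → EqualRowsVanish n → (M : Matrix A (suc n)) → ∀ k →
    (∀ j → M zero j ≈ M (suc k) j) → det M ≈ 0#
  det-equal-row-zero vanish M zero    eq = det-equal-first-rows M eq
  det-equal-row-zero {suc (suc n)} vanish M (suc k) eq = begin
    det M
      ≈⟨ det-cong (λ i j → sym (reflexive (≡.cong (λ w → w j) (replaceRow-self′ i)))) ⟩
    g y z
      ≈⟨ sym (+-identityˡ _) ⟩
    0# + g y z
      ≈⟨ +-congʳ (sym (g-diagonal y)) ⟩
    g y y + g y z
      ≈⟨ sym (+-identityʳ _) ⟩
    g y y + g y z + 0#
      ≈⟨ +-congˡ (sym (trans (+-cong zero-row (g-diagonal z)) (+-identityˡ 0#))) ⟩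
    g y y + g y z + (g z y + g z z)
      ≈⟨ +-cong (sym (det-additive (replaceRow M one y) two y z)) (sym (det-additive (replaceRow M one z) two y z)) ⟩
    g y y+z + g z y+z
      ≈⟨ sym (+-cong (g-swap y y+z) (g-swap z y+z)) ⟩
    g′ y+z y + g′ y+z z
      ≈⟨ sym (det-additive (replaceRow M two y+z) one y z) ⟩
    g′ y+z y+z
      ≈⟨ trans (g-swap y+z y+z) (g-diagonal y+z) ⟩
    0# ∎
    where
    one two : Fin (suc (suc (suc n)))
    one = suc zero
    two = suc (suc k)
    y = M one
    z = M two
    y+z : Fin _ → A
    y+z j = y j + z j
    -- `det-additive` splits the row that was replaced last, so additivity in both rows calls for
    -- both orders of replacement.
    g g′ : (Fin _ → A) → (Fin _ → A) → A
    g  u v = det (replaceRow (replaceRow M one u) two v)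
    g′ v u = det (replaceRow (replaceRow M two v) one u)
    replaceRow-self′ : ∀ i → replaceRow (replaceRow M one y) two z i ≡ M i
    replaceRow-self′ zero          = ≡.refl
    replaceRow-self′ (suc zero)    = ≡.refl
    replaceRow-self′ (suc (suc i)) = replaceRow-self (λ i → M (suc (suc i))) k i
    g-swap : ∀ u v → g′ v u ≈ g u v
    g-swap u v = det-cong {M = replaceRow (replaceRow M two v) one u} {replaceRow (replaceRow M one u) two v} λ where
      zero          j → refl
      (suc zero)    j → refl
      (suc (suc i)) j → refl
    g-diagonal : ∀ u → g u u ≈ 0#
    g-diagonal u = det-equal-later-rows vanish (replaceRow (replaceRow M one u) two u) zero (suc k) (λ ())
      λ j → reflexive (≡.cong (λ w → w j) (≡.sym (replaceRow-same (λ i → M (suc (suc i))) k u)))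
    zero-row : g z y ≈ 0#
    zero-row = det-equal-first-rows (replaceRow (replaceRow M one z) two y) eq

  det-equal-rows : ∀ n → EqualRowsVanish n
  det-equal-rows (suc n) M zero    zero    i≢k eq = contradiction ≡.refl i≢k
  det-equal-rows (suc n) M zero    (suc k) i≢k eq = det-equal-row-zero (det-equal-rows n) M k eq
  det-equal-rows (suc n) M (suc i) zero    i≢k eq =
    det-equal-row-zero (det-equal-rows n) M i (λ j → sym (eq j))
  det-equal-rows (suc n) M (suc i) (suc k) i≢k eq =
    det-equal-later-rows (det-equal-rows n) M i k (i≢k ∘ ≡.cong suc) eq

  -- With a unit row in place of a signed minor there are no signs to track, and the derivative of a
  -- row of x - M has exactly this form. The adjugate is the transpose.
  cofactor : ∀ {n} → Matrix A n → Matrix A n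
  cofactor M i j = det (replaceRow M i (unit j))

  -- Linearity in row `i` turns the sum into the determinant of `M` with row `k` copied into row
  -- `i`: this is `M` itself when `k` equals `i`, and has two equal rows otherwise.
  cofactor-expansion : ∀ {n} (M : Matrix A n) i k →
    (sum λ j → M k j * cofactor M i j) ≈ unit k i * det M
  cofactor-expansion M i k = begin
    (sum λ j → M k j * cofactor M i j)
      ≈⟨ sym (det-linear M i (M k) unit) ⟩
    det (replaceRow M i (λ l → sum λ j → M k j * unit j l))
      ≈⟨ det-cong (replaceRow-cong M i (sum-unitʳ (M k))) ⟩
    det (replaceRow M i (M k))
      ≈⟨ evaluate ⟩
    unit k i * det M ∎
    where
    evaluate : det (replaceRow M i (M k)) ≈ unit k i * det M
    evaluate with k ≟ᶠ i
    ... | yes ≡.refl = trans (det-cong λ a b → reflexive (≡.cong (λ w → w b) (replaceRow-self M i a)))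
                             (sym (*-identityˡ _))
    ... | no  k≢i    = trans
      (det-equal-rows _ (replaceRow M i (M k)) i k (k≢i ∘ ≡.sym) λ j →
        reflexive (≡.cong (λ w → w j) (≡.trans (replaceRow-same M i (M k))
                                              (≡.sym (replaceRow-other M i (M k) k (k≢i ∘ ≡.sym))))))
      (sym (zeroˡ _))

  det-first-row : ∀ {n} (M : Matrix A (suc n)) → (∀ j → M zero (suc j) ≈ 0#) →
    det M ≈ M zero zero * det (minor M zero)
  det-first-row M eq = begin
    1# * (M zero zero * det (minor M zero)) + (sum λ j → sgn (suc j) * (M zero (suc j) * det (minor M (suc j))))
      ≈⟨ +-cong (*-identityˡ _) (sum-zero λ j → trans (*-congˡ {sgn (suc j)} (trans (*-congʳ (eq j)) (zeroˡ _))) (zeroʳ (sgn (suc j)))) ⟩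
    M zero zero * det (minor M zero) + 0#
      ≈⟨ +-identityʳ _ ⟩
    M zero zero * det (minor M zero) ∎

  module Derivation
    (∂ : A → A)
    (∂-cong : ∀ {a b} → a ≈ b → ∂ a ≈ ∂ b)
    (∂-+ : ∀ a b → ∂ (a + b) ≈ ∂ a + ∂ b)
    (∂-* : ∀ a b → ∂ (a * b) ≈ ∂ a * b + a * ∂ b)
    where

    private
      idempotent⇒0 : ∀ {a} → a ≈ a + a → a ≈ 0#
      idempotent⇒0 {a} eq = +-cancelˡ a a 0# (trans (sym eq) (sym (+-identityʳ a)))

    ∂-0 : ∂ 0# ≈ 0#
    ∂-0 = idempotent⇒0 (trans (∂-cong (sym (+-identityˡ 0#))) (∂-+ 0# 0#))

    ∂-1 : ∂ 1# ≈ 0#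
    ∂-1 = idempotent⇒0 (trans (∂-cong (sym (*-identityˡ 1#)))
            (trans (∂-* 1# 1#) (+-cong (*-identityʳ _) (*-identityˡ _))))

    ∂-−1 : ∂ (- 1#) ≈ 0#
    ∂-−1 = begin
      ∂ (- 1#)          ≈⟨ sym (+-identityˡ _) ⟩
      0# + ∂ (- 1#)     ≈⟨ +-congʳ (sym ∂-1) ⟩
      ∂ 1# + ∂ (- 1#)   ≈⟨ sym (∂-+ 1# (- 1#)) ⟩
      ∂ (1# + - 1#)     ≈⟨ trans (∂-cong (-‿inverseʳ 1#)) ∂-0 ⟩
      0#                ∎

    ∂-sgn : ∀ k → ∂ ((- 1#) ^ k) ≈ 0#
    ∂-sgn zero    = ∂-1
    ∂-sgn (suc k) = begin
      ∂ (- 1# * (- 1#) ^ k)                       ≈⟨ ∂-* _ _ ⟩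
      ∂ (- 1#) * (- 1#) ^ k + - 1# * ∂ ((- 1#) ^ k) ≈⟨ +-cong (trans (*-congʳ ∂-−1) (zeroˡ _)) (trans (*-congˡ (∂-sgn k)) (zeroʳ _)) ⟩
      0# + 0#                                     ≈⟨ +-identityˡ 0# ⟩
      0# ∎

    ∂-sum : ∀ {n} (g : Fin n → A) → ∂ (sum g) ≈ sum (∂ ∘ g)
    ∂-sum {zero}  g = ∂-0
    ∂-sum {suc n} g = trans (∂-+ _ _) (+-congˡ (∂-sum (g ∘ suc)))

    -- The Leibniz rule for a function linear in each row: the signs of the expansion are powers of
    -- -1, which every derivation kills. For x - M the differentiated rows are unit rows, so the
    -- result is the trace of the adjugate.
    det-derivation : ∀ {n} (M : Matrix A n) → ∂ (det M) ≈ sum λ i → det (replaceRow M i (∂ ∘ M i))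
    det-derivation {zero}  M = ∂-1
    det-derivation {suc n} M = begin
      ∂ (det M)
        ≈⟨ ∂-sum (λ j → sgn j * (M zero j * det (minor M j))) ⟩
      (sum λ j → ∂ (sgn j * (M zero j * det (minor M j))))
        ≈⟨ sum-cong-≋ expand ⟩
      (sum λ j → sgn j * (∂ (M zero j) * det (minor M j)) + sgn j * (M zero j * ∂ (det (minor M j))))
        ≈⟨ ∑-distrib-+ (λ j → sgn j * (∂ (M zero j) * det (minor M j)))
                       (λ j → sgn j * (M zero j * ∂ (det (minor M j)))) ⟩
      det (replaceRow M zero (∂ ∘ M zero)) + (sum λ j → sgn j * (M zero j * ∂ (det (minor M j))))
        ≈⟨ +-congˡ (trans (sum-cong-≋ lower) (∑-comm (λ j i → later i j))) ⟩
      det (replaceRow M zero (∂ ∘ M zero)) + (sum λ i → det (replaceRow M (suc i) (∂ ∘ M (suc i)))) ∎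
      where
      later : Fin n → Fin (suc n) → A
      later i j = sgn j * (M zero j * det (minor (replaceRow M (suc i) (∂ ∘ M (suc i))) j))

      expand : ∀ j → ∂ (sgn j * (M zero j * det (minor M j))) ≈
                     sgn j * (∂ (M zero j) * det (minor M j)) + sgn j * (M zero j * ∂ (det (minor M j)))
      expand j = begin
        ∂ (sgn j * (M zero j * det (minor M j)))
          ≈⟨ ∂-* _ _ ⟩
        ∂ (sgn j) * (M zero j * det (minor M j)) + sgn j * ∂ (M zero j * det (minor M j))
          ≈⟨ +-cong (trans (*-congʳ (∂-sgn (toℕ j))) (zeroˡ _)) (*-congˡ (∂-* _ _)) ⟩
        0# + sgn j * (∂ (M zero j) * det (minor M j) + M zero j * ∂ (det (minor M j)))
          ≈⟨ trans (+-identityˡ _) (distribˡ _ _ _) ⟩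
        sgn j * (∂ (M zero j) * det (minor M j)) + sgn j * (M zero j * ∂ (det (minor M j))) ∎

      lower : ∀ j → sgn j * (M zero j * ∂ (det (minor M j))) ≈ sum λ i → later i j
      lower j = begin
        sgn j * (M zero j * ∂ (det (minor M j)))
          ≈⟨ *-congˡ (*-congˡ (trans (det-derivation (minor M j)) (sum-cong-≋ λ i →
               sym (det-minor-replaceRow M i (∂ ∘ M (suc i)) j)))) ⟩
        sgn j * (M zero j * (sum λ i → det (minor (replaceRow M (suc i) (∂ ∘ M (suc i))) j)))
          ≈⟨ *-*-distrib-sum (sgn j) (M zero j)
               (λ i → det (minor (replaceRow M (suc i) (∂ ∘ M (suc i))) j)) ⟩
        (sum λ i → later i j) ∎

-- Traces of powers from the characteristic polynomial, by Newton's recursion.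

module Traces {c ℓ} (R : CommutativeRing c ℓ) where
  open CommutativeRing R hiding (zero) renaming (Carrier to A)
  open RingProperties ring using (+-cancelʳ; -0#≈0#)
  open SemiringSum semiring
  open RawSemiringDefs (RawRing.rawSemiring rawRing) using (_^_)
  open Polynomials rawRing
  open RawRing polynomials
    using () renaming (_≈_ to _≈ₓ_; _+_ to _+ₓ_; _*_ to _*ₓ_; -_ to -ₓ_; 0# to 0ₓ; 1# to 1ₓ)
  open PolynomialRing R
  open MatrixAlgebra semiring
  private
    module P = CommutativeRing polynomialRing
    module PMat = MatrixAlgebra P.semiring
    module PDet = DeterminantTheory polynomialRing
    module PSum = SemiringSum P.semiring
    module ∂Det = PDet.Derivation derivative
      (λ {p} {q} → derivative-cong {p} {q}) derivative-add derivative-mul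
  open SetoidReasoning setoid
  open SemiringSolver commutativeSemiring using (solve; _:=_; _:*_; con)

  powerSum : ℕ → List A → A
  powerSum k = foldr (λ x s → x ^ k + s) 0#

  -- Spelled as in `characteristicPolynomial`, so that a spectrum in the sense of `IsSpectrum` is by
  -- definition an equation between `charPoly` and `fromRoots`.
  charMatrix : ∀ {n} → Matrix A n → Matrix (List A) n
  charMatrix M i j = (if does (i ≟ᶠ j) then indeterminate else 0ₓ) +ₓ (-ₓ constant (M i j))

  charPoly : ∀ {n} → Matrix A n → List A
  charPoly M = Determinant.det polynomials (charMatrix M)

  fromRoots : List A → List A
  fromRoots = foldr (λ θ p → (indeterminate +ₓ (-ₓ constant θ)) *ₓ p) 1ₓ

  coefficient-sum : ∀ {n} (g : Fin n → List A) k →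
    coefficient (PSum.sum g) k ≈ sum λ i → coefficient (g i) k
  coefficient-sum {zero}  g k = refl
  coefficient-sum {suc n} g k =
    trans (coefficient-add (g zero) _ k) (+-congˡ (coefficient-sum (g ∘ suc) k))

  shift-sum : ∀ {n} (g : Fin n → ℕ → A) k → shift (λ m → sum λ i → g i m) k ≈ sum λ i → shift (g i) k
  shift-sum {n} g zero    = sym (sum-replicate-zero n)
  shift-sum g (suc k) = refl

  coefficient-vanishes : ∀ p k → length p ℕ.≤ k → coefficient p k ≈ 0#
  coefficient-vanishes []      k       _       = refl
  coefficient-vanishes (a ∷ p) (suc k) (s≤s le) = coefficient-vanishes p k le

  private
    conv-neg-constant : ∀ a g k → conv (-ₓ constant a) g k ≈ - a * g k
    conv-neg-constant a g zero    = +-identityʳ _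
    conv-neg-constant a g (suc k) = +-identityʳ _

    conv-indeterminate : ∀ g k → conv indeterminate g k ≈ shift g k
    conv-indeterminate g zero    = trans (+-identityʳ _) (zeroˡ _)
    conv-indeterminate g (suc k) = begin
      0# * g (suc k) + (1# * g k + shift (λ _ → 0#) k)
        ≈⟨ +-cong (zeroˡ _) (+-cong (*-identityˡ _) (shift-zero k)) ⟩
      0# + (g k + 0#) ≈⟨ trans (+-identityˡ _) (+-identityʳ _) ⟩
      g k ∎

    coefficient-root-mul : ∀ a p k →
      coefficient ((indeterminate +ₓ (-ₓ constant a)) *ₓ p) k ≈ shift (coefficient p) k + - a * coefficient p k
    coefficient-root-mul a p k = begin
      coefficient ((indeterminate +ₓ (-ₓ constant a)) *ₓ p) k
        ≈⟨ trans (coefficient-mul (indeterminate +ₓ (-ₓ constant a)) p k)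
                 (conv-addˡ indeterminate (-ₓ constant a) (coefficient p) k) ⟩
      conv indeterminate (coefficient p) k + conv (-ₓ constant a) (coefficient p) k
        ≈⟨ +-cong (conv-indeterminate (coefficient p) k) (conv-neg-constant a (coefficient p) k) ⟩
      shift (coefficient p) k + - a * coefficient p k ∎

    -- The unit matrix is transposed on the right so that the sum over `j` in
    -- `adjugate-coefficients` collapses through `sum-unitʳ`.
    coefficient-charMatrix-mul : ∀ {n} (M : Matrix A n) i j p k →
      coefficient (charMatrix M i j *ₓ p) k ≈ shift (coefficient p) k * unit j i + - M i j * coefficient p k
    coefficient-charMatrix-mul M i j p k with i ≟ᶠ j | j ≟ᶠ i
    ... | yes _   | yes _   = trans (coefficient-root-mul (M i j) p k) (+-congʳ (sym (*-identityʳ _)))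
    ... | no _    | no _    = begin
      coefficient ((-ₓ constant (M i j)) *ₓ p) k
        ≈⟨ trans (coefficient-mul (-ₓ constant (M i j)) p k) (conv-neg-constant (M i j) (coefficient p) k) ⟩
      - M i j * coefficient p k
        ≈⟨ sym (trans (+-congʳ (zeroʳ _)) (+-identityˡ _)) ⟩
      shift (coefficient p) k * 0# + - M i j * coefficient p k ∎
    ... | yes i≡j | no j≢i  = contradiction (≡.sym i≡j) j≢i
    ... | no i≢j  | yes j≡i = contradiction (≡.sym j≡i) i≢j

  fromRoots-vanishes : ∀ xs k → length xs ℕ.< k → coefficient (fromRoots xs) k ≈ 0#
  fromRoots-vanishes []       (suc k) _        = refl
  fromRoots-vanishes (x ∷ xs) (suc k) (s≤s lt) = begin
    coefficient (fromRoots (x ∷ xs)) (suc k)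
      ≈⟨ coefficient-root-mul x (fromRoots xs) (suc k) ⟩
    coefficient (fromRoots xs) k + - x * coefficient (fromRoots xs) (suc k)
      ≈⟨ +-cong (fromRoots-vanishes xs k lt)
           (trans (*-congˡ (fromRoots-vanishes xs (suc k) (ℕ.m<n⇒m<1+n lt))) (zeroʳ _)) ⟩
    0# + 0# ≈⟨ +-identityˡ 0# ⟩
    0# ∎

  fromRoots-monic : ∀ xs → coefficient (fromRoots xs) (length xs) ≈ 1#
  fromRoots-monic []       = refl
  fromRoots-monic (x ∷ xs) = begin
    coefficient (fromRoots (x ∷ xs)) (suc (length xs))
      ≈⟨ coefficient-root-mul x (fromRoots xs) (suc (length xs)) ⟩
    coefficient (fromRoots xs) (length xs) + - x * coefficient (fromRoots xs) (suc (length xs))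
      ≈⟨ +-cong (fromRoots-monic xs)
           (trans (*-congˡ (fromRoots-vanishes xs (suc (length xs)) ℕ.≤-refl)) (zeroʳ _)) ⟩
    1# + 0# ≈⟨ +-identityʳ 1# ⟩
    1# ∎

  -- With C(x) the adjugate of x - M, the sequence β k lists the coefficients of
  -- tr(M^k C(x)), and t k = tr(M^k).
  record NewtonSystem (p : List A) (t : ℕ → A) : Set (c ⊔ ℓ) where
    field
      β          : ℕ → ℕ → A
      bound      : ℕ
      β-initial  : ∀ m → β 0 m ≈ coefficient (derivative p) m
      β-step     : ∀ k m → shift (β k) m ≈ β (suc k) m + t k * coefficient p m
      β-vanishes : ∀ k m → bound ℕ.≤ m → β k m ≈ 0#

  module _ {p : List A} (d : ℕ) (monic : coefficient p d ≈ 1#)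
           (above : ∀ m → d ℕ.< m → coefficient p m ≈ 0#) where

    -- Degree `d` of `β-step` isolates `t k`: there `p` has coefficient 1, and `β (suc k)` is
    -- already zero, as the adjugate has degree below `d`.
    newton-leading : ∀ {t} (S : NewtonSystem p t) k → shift (NewtonSystem.β S k) d ≈ t k
    newton-leading {t} S k = begin
      shift (β k) d                      ≈⟨ β-step k d ⟩
      β (suc k) d + t k * coefficient p d ≈⟨ +-cong (vanishes bound (suc k) d ℕ.≤-refl (ℕ.m≤n+m bound d))
                                                    (trans (*-congˡ monic) (*-identityʳ _)) ⟩
      0# + t k                           ≈⟨ +-identityˡ _ ⟩
      t k                                ∎
      where
      open NewtonSystem S
      -- Above degree `d` the recursion reads β k m ≈ β (suc k) (suc m), so the degree can be raised
      -- until it passes `bound`. Any crude bound thus yields the sharp one, without estimating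
      -- degrees of cofactors.
      vanishes : ∀ e k m → d ℕ.≤ m → bound ℕ.≤ m ℕ.+ e → β k m ≈ 0#
      vanishes zero    k m d≤m b≤m = β-vanishes k m (≡.subst (bound ℕ.≤_) (ℕ.+-identityʳ m) b≤m)
      vanishes (suc e) k m d≤m b≤m = begin
        β k m                                          ≈⟨ β-step k (suc m) ⟩
        β (suc k) (suc m) + t k * coefficient p (suc m)
          ≈⟨ +-cong (vanishes e (suc k) (suc m) (ℕ.m≤n⇒m≤1+n d≤m) (≡.subst (bound ℕ.≤_) (ℕ.+-suc m e) b≤m))
                    (trans (*-congˡ (above (suc m) (s≤s d≤m))) (zeroʳ _)) ⟩
        0# + 0#                                        ≈⟨ +-identityˡ 0# ⟩
        0#                                             ∎

    -- β 0 is the derivative of `p`; each `β k` yields `t k` as its leading coefficient, and the two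
    -- together yield `β (suc k)`. Nothing is divided, whence the validity over any commutative
    -- ring.
    newton-unique : ∀ {t t′} → NewtonSystem p t → NewtonSystem p t′ → ∀ k → t k ≈ t′ k
    newton-unique {t} {t′} S S′ k = agree⇒ k (agree k)
      where
      open NewtonSystem S
      open NewtonSystem S′ renaming (β to β′; β-step to β′-step; β-initial to β′-initial) using ()
      agree⇒ : ∀ k → (∀ m → β k m ≈ β′ k m) → t k ≈ t′ k
      agree⇒ k eq = trans (sym (newton-leading S k)) (trans (shift-cong eq d) (newton-leading S′ k))
      agree : ∀ k m → β k m ≈ β′ k m
      agree zero    m = trans (β-initial m) (sym (β′-initial m))
      agree (suc k) m = +-cancelʳ (t k * coefficient p m) _ _ (begin
        β (suc k) m + t k * coefficient p m   ≈⟨ sym (β-step k m) ⟩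
        shift (β k) m                         ≈⟨ shift-cong (agree k) m ⟩
        shift (β′ k) m                        ≈⟨ β′-step k m ⟩
        β′ (suc k) m + t′ k * coefficient p m ≈⟨ +-congˡ (*-congʳ (sym (agree⇒ k (agree k)))) ⟩
        β′ (suc k) m + t k * coefficient p m  ∎)

  private
    bounded : ∀ {n} (g : Fin n → ℕ) → ∃[ b ] (∀ i → g i ℕ.≤ b)
    bounded {zero}  g = 0 , λ ()
    bounded {suc n} g with bounded (g ∘ suc)
    ... | b , le = g zero ℕ.⊔ b , λ where
      zero    → ℕ.m≤m⊔n _ _
      (suc i) → ℕ.≤-trans (le i) (ℕ.m≤n⊔m (g zero) b)

  module _ {n} (M : Matrix A n) where
    private
      C : Fin n → Fin n → ℕ → A
      C i j = coefficient (PDet.cofactor (charMatrix M) i j)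

      p : ℕ → A
      p = coefficient (charPoly M)

      coefficient-unit : ∀ k i m → coefficient (PMat.unit {n} k i *ₓ charPoly M) m ≈ unit k i * p m
      coefficient-unit k i m with k ≟ᶠ i
      ... | yes _ = trans (mulₚ-identityˡ (charPoly M) m) (sym (*-identityˡ _))
      ... | no  _ = sym (zeroˡ _)

      -- The coefficients of (x - M) adj (x - M) = det (x - M), with the term of M moved across.
      adjugate-coefficients : ∀ i k m → shift (C i k) m ≈ (sum λ j → M k j * C i j m) + unit k i * p m
      adjugate-coefficients i k m = begin
        shift (C i k) m
          ≈⟨ trans (sym (+-identityʳ _)) (+-congˡ (sym cancel)) ⟩
        shift (C i k) m + ((sum λ j → - M k j * C i j m) + (sum λ j → M k j * C i j m))
          ≈⟨ sym (+-assoc _ _ _) ⟩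
        (shift (C i k) m + (sum λ j → - M k j * C i j m)) + (sum λ j → M k j * C i j m)
          ≈⟨ +-congʳ (sym expansion) ⟩
        unit k i * p m + (sum λ j → M k j * C i j m)
          ≈⟨ +-comm _ _ ⟩
        (sum λ j → M k j * C i j m) + unit k i * p m ∎
        where
        cancel : (sum λ j → - M k j * C i j m) + (sum λ j → M k j * C i j m) ≈ 0#
        cancel = trans (sym (∑-distrib-+ (λ j → - M k j * C i j m) (λ j → M k j * C i j m)))
          (sum-zero {n} λ j → trans (sym (distribʳ _ _ _)) (trans (*-congʳ (-‿inverseˡ _)) (zeroˡ _)))
        expansion : unit k i * p m ≈ shift (C i k) m + (sum λ j → - M k j * C i j m)
        expansion = begin
          unit k i * p m
            ≈⟨ sym (coefficient-unit k i m) ⟩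
          coefficient (PMat.unit {n} k i *ₓ charPoly M) m
            ≈⟨ sym (PDet.cofactor-expansion (charMatrix M) i k m) ⟩
          coefficient (PSum.sum λ j → charMatrix M k j *ₓ PDet.cofactor (charMatrix M) i j) m
            ≈⟨ coefficient-sum (λ j → charMatrix M k j *ₓ PDet.cofactor (charMatrix M) i j) m ⟩
          (sum λ j → coefficient (charMatrix M k j *ₓ PDet.cofactor (charMatrix M) i j) m)
            ≈⟨ sum-cong-≋ (λ j → coefficient-charMatrix-mul M k j (PDet.cofactor (charMatrix M) i j) m) ⟩
          (sum λ j → shift (C i j) m * unit j k + - M k j * C i j m)
            ≈⟨ ∑-distrib-+ (λ j → shift (C i j) m * unit j k) (λ j → - M k j * C i j m) ⟩
          (sum λ j → shift (C i j) m * unit j k) + (sum λ j → - M k j * C i j m)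
            ≈⟨ +-congʳ (sum-unitʳ (λ j → shift (C i j) m) k) ⟩
          shift (C i k) m + (sum λ j → - M k j * C i j m) ∎

      derivative-charMatrix : ∀ i j → derivative (charMatrix M i j) ≈ₓ PMat.unit i j
      derivative-charMatrix i j k with i ≟ᶠ j
      derivative-charMatrix i j zero          | yes _ = +-identityʳ 1#
      derivative-charMatrix i j (suc zero)    | yes _ = refl
      derivative-charMatrix i j (suc (suc k)) | yes _ = refl
      derivative-charMatrix i j zero          | no _  = refl
      derivative-charMatrix i j (suc k)       | no _  = refl

      -- Jacobi's formula: row i of x - M has the unit row i as its derivative.
      derivative-charPoly : ∀ m → coefficient (derivative (charPoly M)) m ≈ sum λ i → C i i m
      derivative-charPoly m = begin
        coefficient (derivative (charPoly M)) m
          ≈⟨ ∂Det.det-derivation (charMatrix M) m ⟩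
        coefficient (PSum.sum row) m
          ≈⟨ coefficient-sum row m ⟩
        (sum λ i → coefficient (row i) m)
          ≈⟨ sum-cong-≋ (λ i → PDet.det-cong
               (PDet.replaceRow-cong (charMatrix M) i (derivative-charMatrix i)) m) ⟩
        (sum λ i → C i i m) ∎
        where
        row : Fin n → List A
        row i = Determinant.det polynomials (PDet.replaceRow (charMatrix M) i (derivative ∘ charMatrix M i))

      -- The lengths of the coefficient lists suffice, since `newton-leading` sharpens any bound.
      cofactor-bound : ∃[ b ] (∀ i j m → b ℕ.≤ m → C i j m ≈ 0#)
      cofactor-bound with bounded (λ i → proj₁ (bounded (size i)))
        where
        size : Fin n → Fin n → ℕ
        size i j = length (PDet.cofactor (charMatrix M) i j)
      ... | b , le = b , λ i j m b≤m → coefficient-vanishes (PDet.cofactor (charMatrix M) i j) m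
        (ℕ.≤-trans (proj₂ (bounded (λ j → length (PDet.cofactor (charMatrix M) i j))) j)
                   (ℕ.≤-trans (le i) b≤m))

      -- The coefficients of tr(N adj (x - M)); both indices run in the same order because `C` holds
      -- cofactors, the transpose of the adjugate.
      pairing : Matrix A n → ℕ → A
      pairing N m = sum λ i → sum λ j → N i j * C i j m

      -- Multiply x adj (x - M) = M adj (x - M) + det (x - M) by N on the left and take traces.
      pairing-step : ∀ N m → shift (pairing N) m ≈ pairing (N ∙ M) m + trace N * p m
      pairing-step N m = begin
        shift (pairing N) m
          ≈⟨ trans (shift-sum (λ i m → sum λ j → N i j * C i j m) m)
               (sum-cong-≋ λ i → trans (shift-sum (λ j m → N i j * C i j m) m)
                 (sum-cong-≋ λ j → shift-* (N i j) (C i j) m)) ⟩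
        (sum λ i → sum λ j → N i j * shift (C i j) m)
          ≈⟨ sum-cong-≋ row ⟩
        (sum λ i → (sum λ l → (N ∙ M) i l * C i l m) + N i i * p m)
          ≈⟨ ∑-distrib-+ (λ i → sum λ l → (N ∙ M) i l * C i l m) (λ i → N i i * p m) ⟩
        pairing (N ∙ M) m + (sum λ i → N i i * p m)
          ≈⟨ +-congˡ (sym (*-distribʳ-sum (p m) (λ i → N i i))) ⟩
        pairing (N ∙ M) m + trace N * p m ∎
        where
        row : ∀ i → (sum λ j → N i j * shift (C i j) m) ≈ (sum λ l → (N ∙ M) i l * C i l m) + N i i * p m
        row i = begin
          (sum λ j → N i j * shift (C i j) m)
            ≈⟨ sum-cong-≋ (λ j → trans (*-congˡ (adjugate-coefficients i j m)) (distribˡ _ _ _)) ⟩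
          (sum λ j → N i j * (sum λ l → M j l * C i l m) + N i j * (unit j i * p m))
            ≈⟨ ∑-distrib-+ (λ j → N i j * (sum λ l → M j l * C i l m)) (λ j → N i j * (unit j i * p m)) ⟩
          (sum λ j → N i j * (sum λ l → M j l * C i l m)) + (sum λ j → N i j * (unit j i * p m))
            ≈⟨ +-cong left right ⟩
          (sum λ l → (N ∙ M) i l * C i l m) + N i i * p m ∎
          where
          left : (sum λ j → N i j * (sum λ l → M j l * C i l m)) ≈ (sum λ l → (N ∙ M) i l * C i l m)
          left = begin
            (sum λ j → N i j * (sum λ l → M j l * C i l m))
              ≈⟨ sum-cong-≋ (λ j → trans (*-distribˡ-sum (N i j) (λ l → M j l * C i l m))
                   (sum-cong-≋ λ l → sym (*-assoc (N i j) (M j l) (C i l m)))) ⟩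
            (sum λ j → sum λ l → N i j * M j l * C i l m)
              ≈⟨ ∑-comm (λ j l → N i j * M j l * C i l m) ⟩
            (sum λ l → sum λ j → N i j * M j l * C i l m)
              ≈⟨ sum-cong-≋ (λ l → sym (*-distribʳ-sum (C i l m) (λ j → N i j * M j l))) ⟩
            (sum λ l → (N ∙ M) i l * C i l m) ∎
          right : (sum λ j → N i j * (unit j i * p m)) ≈ N i i * p m
          right = trans (sum-cong-≋ λ j → solve 3 (λ a b c → a :* (b :* c) := (a :* c) :* b)
                          refl (N i j) (unit j i) (p m))
                        (sum-unitʳ (λ j → N i j * p m) i)

      pairing-unit : ∀ m → pairing unit m ≈ sum λ i → C i i m
      pairing-unit m = begin
        (sum λ i → sum λ j → unit i j * C i j m)
          ≈⟨ ∑-comm (λ i j → unit i j * C i j m) ⟩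
        (sum λ j → sum λ i → unit i j * C i j m)
          ≈⟨ sum-cong-≋ (λ j → trans (sum-cong-≋ λ i → *-comm (unit i j) (C i j m)) (sum-unitʳ (λ i → C i j m) j)) ⟩
        (sum λ j → C j j m) ∎

    traceSystem : NewtonSystem (charPoly M) (trace ∘ power M)
    traceSystem = record
      { β          = λ k → pairing (power M k)
      ; bound      = proj₁ cofactor-bound
      ; β-initial  = λ m → trans (pairing-unit m) (sym (derivative-charPoly m))
      ; β-step     = λ k m → pairing-step (power M k) m
      ; β-vanishes = λ k m b≤m → sum-zero {n} λ i → sum-zero {n} λ j →
          trans (*-congˡ (proj₂ cofactor-bound i j m b≤m)) (zeroʳ _)
      }

  NewtonSystem-respects : ∀ {p q t} → p ≈ₓ q → NewtonSystem p t → NewtonSystem q t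
  NewtonSystem-respects {p} {q} p≈q S = record
    { NewtonSystem S hiding (β-initial; β-step)
    ; β-initial = λ m → trans (β-initial m) (derivative-cong {p} {q} p≈q m)
    ; β-step    = λ k m → trans (β-step k m) (+-congˡ (*-congˡ (p≈q m)))
    }
    where open NewtonSystem S

  diagonal : (xs : List A) → Matrix A (length xs)
  diagonal xs i j = lookup xs i * unit i j

  -- The first row is zero off the diagonal, and the minor left over is the characteristic matrix
  -- for the remaining roots, so the expansion splits off one linear factor at a time.
  charPoly-diagonal : ∀ xs → charPoly (diagonal xs) ≈ₓ fromRoots xs
  charPoly-diagonal []       k = refl
  charPoly-diagonal (x ∷ xs) k = begin
    coefficient (charPoly (diagonal (x ∷ xs))) k
      ≈⟨ PDet.det-first-row (charMatrix (diagonal (x ∷ xs))) offDiagonal k ⟩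
    coefficient ((indeterminate +ₓ (-ₓ constant (x * 1#))) *ₓ
                 Determinant.det polynomials (PDet.minor (charMatrix (diagonal (x ∷ xs))) zero)) k
      ≈⟨ coefficient-root-mul (x * 1#) (charPoly (diagonal xs)) k ⟩
    shift (coefficient (charPoly (diagonal xs))) k + - (x * 1#) * coefficient (charPoly (diagonal xs)) k
      ≈⟨ +-cong (shift-cong (charPoly-diagonal xs) k)
                (*-cong (-‿cong (*-identityʳ x)) (charPoly-diagonal xs k)) ⟩
    shift (coefficient (fromRoots xs)) k + - x * coefficient (fromRoots xs) k
      ≈⟨ sym (coefficient-root-mul x (fromRoots xs) k) ⟩
    coefficient (fromRoots (x ∷ xs)) k ∎
    where
    offDiagonal : ∀ j → charMatrix (diagonal (x ∷ xs)) zero (suc j) ≈ₓ 0ₓ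
    offDiagonal j zero    = trans (-‿cong (zeroʳ x)) -0#≈0#
    offDiagonal j (suc k) = refl

  power-diagonal : ∀ xs k i j → power (diagonal xs) k i j ≈ lookup xs i ^ k * unit i j
  power-diagonal xs zero    i j = sym (*-identityˡ _)
  power-diagonal xs (suc k) i j = begin
    (sum λ l → power (diagonal xs) k i l * (lookup xs l * unit l j))
      ≈⟨ sum-cong-≋ {length xs} (λ l → sym (*-assoc _ _ _)) ⟩
    (sum λ l → power (diagonal xs) k i l * lookup xs l * unit l j)
      ≈⟨ sum-unitʳ (λ l → power (diagonal xs) k i l * lookup xs l) j ⟩
    power (diagonal xs) k i j * lookup xs j
      ≈⟨ *-congʳ (power-diagonal xs k i j) ⟩
    lookup xs i ^ k * unit i j * lookup xs j
      ≈⟨ diagonalEntry ⟩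
    lookup xs i * lookup xs i ^ k * unit i j ∎
    where
    diagonalEntry : lookup xs i ^ k * unit i j * lookup xs j ≈ lookup xs i * lookup xs i ^ k * unit i j
    diagonalEntry with i ≟ᶠ j
    ... | yes ≡.refl = solve 2 (λ a b → a :* con 1 :* b := b :* a :* con 1) refl (lookup xs i ^ k) (lookup xs i)
    ... | no  _      = trans (*-congʳ (zeroʳ _)) (trans (zeroˡ _) (sym (zeroʳ _)))

  trace-power-diagonal : ∀ xs k → trace (power (diagonal xs) k) ≈ powerSum k xs
  trace-power-diagonal xs k = trans (sum-cong-≋ λ i → trans (power-diagonal xs k i i)
                                (trans (*-congˡ (unit-diagonal i)) (*-identityʳ _)))
                              (sum-lookup xs)
    where
    sum-lookup : ∀ xs → (sum λ i → lookup xs i ^ k) ≈ powerSum k xs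
    sum-lookup []       = refl
    sum-lookup (x ∷ xs) = +-congˡ (sum-lookup xs)

  trace-power : ∀ {n} (M : Matrix A n) xs → charPoly M ≈ₓ fromRoots xs →
                ∀ k → trace (power M k) ≈ powerSum k xs
  trace-power M xs eq k = trans
    (newton-unique (length xs) (fromRoots-monic xs) (fromRoots-vanishes xs)
      (NewtonSystem-respects {charPoly M} {fromRoots xs} eq (traceSystem M))
      (NewtonSystem-respects {charPoly (diagonal xs)} {fromRoots xs} (charPoly-diagonal xs)
        (traceSystem (diagonal xs))) k)
    (trace-power-diagonal xs k)

-- Power sums of a two-valued list, and their transfer to natural numbers.

module ℕSum = SemiringSum ℕ.+-*-semiring
module ℕMatrix = MatrixAlgebra ℕ.+-*-semiring

module TwoEigenvalues {c ℓ} (R : CommutativeRing c ℓ) where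
  open CommutativeRing R hiding (zero) renaming (Carrier to A)
  open RingProperties ring using (+-cancelˡ)
  open SemiringMult semiring using (×-homo-+; ×1-homo-*) renaming (_×_ to _·_)
  open SemiringSum semiring
  open MatrixAlgebra semiring
  open RawSemiringDefs (RawRing.rawSemiring rawRing) using (_^_)
  open Polynomials rawRing
  open RawRing polynomials using () renaming (_≈_ to _≈ₓ_)
  open Traces R using (powerSum; charPoly; fromRoots; trace-power)
  open SetoidPermutation setoid using (_↭_)
  open SetoidReasoning setoid
  open SemiringSolver commutativeSemiring using (solve; _:=_; _:+_; _:*_; con)

  ι : ℕ → A
  ι n = n · 1#

  ι-+ : ∀ m n → ι (m ℕ.+ n) ≈ ι m + ι n
  ι-+ = ×-homo-+ 1#

  ι-* : ∀ m n → ι (m ℕ.* n) ≈ ι m * ι n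
  ι-* = ×1-homo-*

  -- Cancelling 1 from both sides reduces any two distinct numbers to zero and a successor, which is
  -- where characteristic zero applies.
  ι-injective : (∀ n → ι (suc n) ≉ 0#) → ∀ {m n} → ι m ≈ ι n → m ≡ n
  ι-injective char0 {zero}  {zero}  eq = ≡.refl
  ι-injective char0 {zero}  {suc n} eq = contradiction (sym eq) (char0 n)
  ι-injective char0 {suc m} {zero}  eq = contradiction eq (char0 m)
  ι-injective char0 {suc m} {suc n} eq = ≡.cong suc (ι-injective char0 (+-cancelˡ 1# _ _ eq))

  ι-sum : ∀ {n} (g : Fin n → ℕ) → ι (ℕSum.sum g) ≈ sum (ι ∘ g)
  ι-sum {zero}  g = refl
  ι-sum {suc n} g = trans (ι-+ (g zero) _) (+-congˡ (ι-sum (g ∘ suc)))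

  ι-trace-power : ∀ {n} (M : Matrix A n) (a : Matrix ℕ n) → (∀ i j → M i j ≈ ι (a i j)) →
                  ∀ k → trace (power M k) ≈ ι (ℕMatrix.trace (ℕMatrix.power a k))
  ι-trace-power {n} M a M≈a k =
    trans (sum-cong-≋ {n} λ i → ι-power k i i) (sym (ι-sum λ i → ℕMatrix.power a k i i))
    where
    ι-power : ∀ k i j → power M k i j ≈ ι (ℕMatrix.power a k i j)
    ι-power zero    i j with does (i ≟ᶠ j)
    ... | true  = sym (+-identityʳ 1#)
    ... | false = refl
    ι-power (suc k) i j = begin
      (sum λ l → power M k i l * M l j)
        ≈⟨ sum-cong-≋ {n} (λ l → trans (*-cong (ι-power k i l) (M≈a l j)) (sym (ι-* (ℕMatrix.power a k i l) (a l j)))) ⟩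
      (sum λ l → ι (ℕMatrix.power a k i l ℕ.* a l j))
        ≈⟨ sym (ι-sum λ l → ℕMatrix.power a k i l ℕ.* a l j) ⟩
      ι (ℕMatrix.power a (suc k) i j) ∎

  ^-cong : ∀ k {x y} → x ≈ y → x ^ k ≈ y ^ k
  ^-cong zero    x≈y = refl
  ^-cong (suc k) x≈y = *-cong x≈y (^-cong k x≈y)

  powerSum-0 : ∀ xs → powerSum 0 xs ≈ ι (length xs)
  powerSum-0 []       = refl
  powerSum-0 (x ∷ xs) = +-congˡ (powerSum-0 xs)

  powerSum-++ : ∀ k xs ys → powerSum k (xs ++ ys) ≈ powerSum k xs + powerSum k ys
  powerSum-++ k []       ys = sym (+-identityˡ _)
  powerSum-++ k (x ∷ xs) ys = trans (+-congˡ (powerSum-++ k xs ys)) (sym (+-assoc _ _ _))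

  powerSum-↭ : ∀ k {xs ys} → xs ↭ ys → powerSum k xs ≈ powerSum k ys
  powerSum-↭ k (Homogeneous.refl xs≋ys) = pointwise xs≋ys
    where
    pointwise : ∀ {xs ys} → ListPointwise _≈_ xs ys → powerSum k xs ≈ powerSum k ys
    pointwise []            = refl
    pointwise (x≈y ∷ xs≋ys) = +-cong (^-cong k x≈y) (pointwise xs≋ys)
  powerSum-↭ k (Homogeneous.prep x≈y p) = +-cong (^-cong k x≈y) (powerSum-↭ k p)
  powerSum-↭ k (Homogeneous.swap {xs} {ys} {x} {y} {x′} {y′} x≈x′ y≈y′ p) = begin
    x ^ k + (y ^ k + powerSum k xs)   ≈⟨ solve 3 (λ a b c → a :+ (b :+ c) := b :+ (a :+ c)) refl (x ^ k) (y ^ k) _ ⟩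
    y ^ k + (x ^ k + powerSum k xs)   ≈⟨ +-cong (^-cong k y≈y′) (+-cong (^-cong k x≈x′) (powerSum-↭ k p)) ⟩
    y′ ^ k + (x′ ^ k + powerSum k ys) ∎
  powerSum-↭ k (Homogeneous.trans p q) = trans (powerSum-↭ k p) (powerSum-↭ k q)

  -- `a` and `b` are the multiplicities of `θ` and `τ`, taken as ring elements; what matters is that
  -- they do not depend on the exponent.
  powerSum-two-valued : ∀ θ τ xs → All (λ x → x ≈ θ ⊎ x ≈ τ) xs →
    ∃[ a ] ∃[ b ] (∀ k → powerSum k xs ≈ a * θ ^ k + b * τ ^ k)
  powerSum-two-valued θ τ []       []         = 0# , 0# , λ k →
    sym (trans (+-cong (zeroˡ _) (zeroˡ _)) (+-identityˡ 0#))
  powerSum-two-valued θ τ (x ∷ xs) (x∈ ∷ xs∈) with powerSum-two-valued θ τ xs xs∈ | x∈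
  ... | a , b , eq | inj₁ x≈θ = 1# + a , b , λ k → trans (+-cong (^-cong k x≈θ) (eq k))
    (solve 4 (λ a b t s → t :+ (a :* t :+ b :* s) := (con 1 :+ a) :* t :+ b :* s) refl a b (θ ^ k) (τ ^ k))
  ... | a , b , eq | inj₂ x≈τ = a , 1# + b , λ k → trans (+-cong (^-cong k x≈τ) (eq k))
    (solve 4 (λ a b t s → s :+ (a :* t :+ b :* s) := a :* t :+ (con 1 :+ b) :* s) refl a b (θ ^ k) (τ ^ k))

  -- The 3 × 3 Hankel matrix of the power sums of a two-valued list has rank at most 2;
  -- this is the vanishing of its determinant, with negative terms moved across.
  hankel : ∀ θ τ xs → All (λ x → x ≈ θ ⊎ x ≈ τ) xs → powerSum 1 xs ≈ 0# →
    powerSum 0 xs * powerSum 2 xs * powerSum 4 xs ≈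
    powerSum 0 xs * (powerSum 3 xs * powerSum 3 xs) + powerSum 2 xs * powerSum 2 xs * powerSum 2 xs
  hankel θ τ xs xs∈ P₁≈0 with powerSum-two-valued θ τ xs xs∈
  ... | a , b , eq = begin
    P 0 * P 2 * P 4
      -- The terms containing `P 1` are restored first: only the full determinant vanishes
      -- identically in `a`, `b`, `θ` and `τ`.
      ≈⟨ sym (trans (+-congˡ (trans (*-congˡ (trans (*-congʳ (*-congʳ P₁≈0)) (trans (*-congʳ (zeroˡ _)) (zeroˡ _)))) (zeroʳ _))) (+-identityʳ _)) ⟩
    P 0 * P 2 * P 4 + (1# + 1#) * (P 1 * P 2 * P 3)
      ≈⟨ +-cong (*-cong (*-cong (eq 0) (eq 2)) (eq 4)) (*-congˡ (*-cong (*-cong (eq 1) (eq 2)) (eq 3))) ⟩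
    Q 0 * Q 2 * Q 4 + (1# + 1#) * (Q 1 * Q 2 * Q 3)
      ≈⟨ solve 4 (λ a b t s →
           let q₀ = a :* con 1 :+ b :* con 1
               q₁ = a :* (t :* con 1) :+ b :* (s :* con 1)
               q₂ = a :* (t :* (t :* con 1)) :+ b :* (s :* (s :* con 1))
               q₃ = a :* (t :* (t :* (t :* con 1))) :+ b :* (s :* (s :* (s :* con 1)))
               q₄ = a :* (t :* (t :* (t :* (t :* con 1)))) :+ b :* (s :* (s :* (s :* (s :* con 1))))
           in q₀ :* q₂ :* q₄ :+ (con 1 :+ con 1) :* (q₁ :* q₂ :* q₃)
              := (q₀ :* (q₃ :* q₃) :+ q₂ :* q₂ :* q₂) :+ q₁ :* (q₁ :* q₄)) refl a b θ τ ⟩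
    (Q 0 * (Q 3 * Q 3) + Q 2 * Q 2 * Q 2) + Q 1 * (Q 1 * Q 4)
      ≈⟨ sym (+-cong (+-cong (*-cong (eq 0) (*-cong (eq 3) (eq 3))) (*-cong (*-cong (eq 2) (eq 2)) (eq 2)))
                     (*-congʳ (eq 1))) ⟩
    (P 0 * (P 3 * P 3) + P 2 * P 2 * P 2) + P 1 * (Q 1 * Q 4)
      ≈⟨ trans (+-congˡ (trans (*-congʳ P₁≈0) (zeroˡ _))) (+-identityʳ _) ⟩
    P 0 * (P 3 * P 3) + P 2 * P 2 * P 2 ∎
    where
    P Q : ℕ → A
    P k = powerSum k xs
    Q k = a * θ ^ k + b * τ ^ k

  module _ {m n} (M : Matrix A m) (N : Matrix A n) (a : Matrix ℕ m) (b : Matrix ℕ n)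
    (M≈a : ∀ i j → M i j ≈ ι (a i j)) (N≈b : ∀ i j → N i j ≈ ι (b i j))
    (xs ys ds : List A) (M-roots : charPoly M ≈ₓ fromRoots xs) (N-roots : charPoly N ≈ₓ fromRoots ys)
    (xs↭ : xs ↭ ys ++ ds) (char0 : ∀ n → ι (suc n) ≉ 0#) where

    private
      s t : ℕ → ℕ
      s k = ℕMatrix.trace (ℕMatrix.power a k)
      t k = ℕMatrix.trace (ℕMatrix.power b k)

      difference : ∀ k → ι (s k) ≈ ι (t k) + powerSum k ds
      difference k = begin
        ι (s k)                         ≈⟨ sym (ι-trace-power M a M≈a k) ⟩
        trace (power M k)               ≈⟨ trace-power M xs M-roots k ⟩
        powerSum k xs                   ≈⟨ trans (powerSum-↭ k xs↭) (powerSum-++ k ys ds) ⟩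
        powerSum k ys + powerSum k ds   ≈⟨ +-congʳ (sym (trace-power N ys N-roots k)) ⟩
        trace (power N k) + powerSum k ds ≈⟨ +-congʳ (ι-trace-power N b N≈b k) ⟩
        ι (t k) + powerSum k ds         ∎

      difference-ι : ∀ k d → s k ≡ t k ℕ.+ d → powerSum k ds ≈ ι d
      difference-ι k d eq = +-cancelˡ (ι (t k)) _ _ (trans (sym (difference k))
        (trans (reflexive (≡.cong ι eq)) (ι-+ (t k) d)))

    trace-power-0 : s 0 ≡ t 0 ℕ.+ length ds
    trace-power-0 = ι-injective char0 (trans (difference 0)
      (trans (+-congˡ (powerSum-0 ds)) (sym (ι-+ (t 0) (length ds)))))

    -- This is P_0 P_2 P_4 = P_0 P_3² + P_2³ with P_3 = s 3 - t 3 and P_4 = s 4 - t 4 expanded and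
    -- the negative terms moved across. P_0 and P_2 enter as the natural numbers `d₀` and `d₂`.
    trace-hankel : ∀ θ τ → All (λ x → x ≈ θ ⊎ x ≈ τ) ds → ∀ d₀ d₂ →
      s 0 ≡ t 0 ℕ.+ d₀ → s 1 ≡ t 1 → s 2 ≡ t 2 ℕ.+ d₂ →
      d₀ ℕ.* d₂ ℕ.* s 4 ℕ.+ 2 ℕ.* (d₀ ℕ.* t 3 ℕ.* s 3) ≡
      d₀ ℕ.* (s 3 ℕ.* s 3) ℕ.+ d₀ ℕ.* (t 3 ℕ.* t 3) ℕ.+ d₂ ℕ.* d₂ ℕ.* d₂ ℕ.+ d₀ ℕ.* d₂ ℕ.* t 4
    trace-hankel θ τ ds∈ d₀ d₂ eq₀ eq₁ eq₂ = ι-injective char0 (begin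
      ι (d₀ ℕ.* d₂ ℕ.* s 4 ℕ.+ 2 ℕ.* (d₀ ℕ.* t 3 ℕ.* s 3))
        ≈⟨ ι-solve-left ⟩
      ι d₀ * ι d₂ * ι (s 4) + (1# + 1#) * (ι d₀ * ι (t 3) * ι (s 3))
        ≈⟨ +-cong (*-cong (*-cong (sym D₀) (sym D₂)) (difference 4))
                  (*-congˡ (*-cong (*-congʳ (sym D₀)) (difference 3))) ⟩
      D 0 * D 2 * (ι (t 4) + D 4) + (1# + 1#) * (D 0 * ι (t 3) * (ι (t 3) + D 3))
        ≈⟨ solve 6 (λ d₀ d₂ d₃ d₄ t₃ t₄ →
             d₀ :* d₂ :* (t₄ :+ d₄) :+ (con 1 :+ con 1) :* (d₀ :* t₃ :* (t₃ :+ d₃))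
             := d₀ :* d₂ :* d₄ :+ (d₀ :* d₂ :* t₄ :+ (con 1 :+ con 1) :* (d₀ :* t₃ :* (t₃ :+ d₃))))
             refl (D 0) (D 2) (D 3) (D 4) (ι (t 3)) (ι (t 4)) ⟩
      D 0 * D 2 * D 4 + (D 0 * D 2 * ι (t 4) + (1# + 1#) * (D 0 * ι (t 3) * (ι (t 3) + D 3)))
        ≈⟨ +-congʳ (hankel θ τ ds ds∈ (difference-ι 1 0 (≡.trans eq₁ (≡.sym (ℕ.+-identityʳ _))))) ⟩
      D 0 * (D 3 * D 3) + D 2 * D 2 * D 2 + (D 0 * D 2 * ι (t 4) + (1# + 1#) * (D 0 * ι (t 3) * (ι (t 3) + D 3)))
        ≈⟨ solve 5 (λ d₀ d₂ d₃ t₃ t₄ →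
             d₀ :* (d₃ :* d₃) :+ d₂ :* d₂ :* d₂ :+ (d₀ :* d₂ :* t₄ :+ (con 1 :+ con 1) :* (d₀ :* t₃ :* (t₃ :+ d₃)))
             := d₀ :* ((t₃ :+ d₃) :* (t₃ :+ d₃)) :+ d₀ :* (t₃ :* t₃) :+ d₂ :* d₂ :* d₂ :+ d₀ :* d₂ :* t₄)
             refl (D 0) (D 2) (D 3) (ι (t 3)) (ι (t 4)) ⟩
      D 0 * ((ι (t 3) + D 3) * (ι (t 3) + D 3)) + D 0 * (ι (t 3) * ι (t 3)) + D 2 * D 2 * D 2 + D 0 * D 2 * ι (t 4)
        ≈⟨ sym (+-cong (+-cong (+-cong (*-cong (sym D₀) (*-cong (difference 3) (difference 3)))
             (*-congʳ (sym D₀))) (*-cong (*-cong (sym D₂) (sym D₂)) (sym D₂))) (*-congʳ (*-cong (sym D₀) (sym D₂)))) ⟩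
      ι d₀ * (ι (s 3) * ι (s 3)) + ι d₀ * (ι (t 3) * ι (t 3)) + ι d₂ * ι d₂ * ι d₂ + ι d₀ * ι d₂ * ι (t 4)
        ≈⟨ sym ι-solve-right ⟩
      ι (d₀ ℕ.* (s 3 ℕ.* s 3) ℕ.+ d₀ ℕ.* (t 3 ℕ.* t 3) ℕ.+ d₂ ℕ.* d₂ ℕ.* d₂ ℕ.+ d₀ ℕ.* d₂ ℕ.* t 4) ∎)
      where
      D : ℕ → A
      D k = powerSum k ds
      D₀ : D 0 ≈ ι d₀
      D₀ = difference-ι 0 d₀ eq₀
      D₂ : D 2 ≈ ι d₂
      D₂ = difference-ι 2 d₂ eq₂
      ι-*₃ : ∀ x y z → ι (x ℕ.* y ℕ.* z) ≈ ι x * ι y * ι z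
      ι-*₃ x y z = trans (ι-* (x ℕ.* y) z) (*-congʳ (ι-* x y))
      ι-*₃′ : ∀ x y z → ι (x ℕ.* (y ℕ.* z)) ≈ ι x * (ι y * ι z)
      ι-*₃′ x y z = trans (ι-* x (y ℕ.* z)) (*-congˡ (ι-* y z))
      ι-solve-left : ι (d₀ ℕ.* d₂ ℕ.* s 4 ℕ.+ 2 ℕ.* (d₀ ℕ.* t 3 ℕ.* s 3)) ≈
                     ι d₀ * ι d₂ * ι (s 4) + (1# + 1#) * (ι d₀ * ι (t 3) * ι (s 3))
      ι-solve-left = trans (ι-+ (d₀ ℕ.* d₂ ℕ.* s 4) _) (+-cong (ι-*₃ d₀ d₂ (s 4))
        (trans (ι-* 2 (d₀ ℕ.* t 3 ℕ.* s 3)) (*-cong (+-congˡ (+-identityʳ 1#)) (ι-*₃ d₀ (t 3) (s 3)))))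
      ι-solve-right : ι (d₀ ℕ.* (s 3 ℕ.* s 3) ℕ.+ d₀ ℕ.* (t 3 ℕ.* t 3) ℕ.+ d₂ ℕ.* d₂ ℕ.* d₂ ℕ.+ d₀ ℕ.* d₂ ℕ.* t 4) ≈
        ι d₀ * (ι (s 3) * ι (s 3)) + ι d₀ * (ι (t 3) * ι (t 3)) + ι d₂ * ι d₂ * ι d₂ + ι d₀ * ι d₂ * ι (t 4)
      ι-solve-right = trans (ι-+ (d₀ ℕ.* (s 3 ℕ.* s 3) ℕ.+ d₀ ℕ.* (t 3 ℕ.* t 3) ℕ.+ d₂ ℕ.* d₂ ℕ.* d₂) _)
        (+-cong (trans (ι-+ (d₀ ℕ.* (s 3 ℕ.* s 3) ℕ.+ d₀ ℕ.* (t 3 ℕ.* t 3)) _)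
          (+-cong (trans (ι-+ (d₀ ℕ.* (s 3 ℕ.* s 3)) _) (+-cong (ι-*₃′ d₀ (s 3) (s 3)) (ι-*₃′ d₀ (t 3) (t 3))))
                  (ι-*₃ d₂ d₂ d₂)))
          (ι-*₃ d₀ d₂ (t 4)))

-- Counting by sums over finite sets.

open import Data.Nat.Base using (_+_; _*_; _∸_; _≤_)
open ≡ using (refl; sym; trans; cong; cong₂; subst; subst₂)
open ≡.≡-Reasoning
open +-*-Solver using (solve; _:=_; _:+_; _:*_; con)
open ℕSum using (sum)
open FiniteSet using (Carrier; size; enumeration)

indicator : {P : Set} → Dec P → ℕ
indicator P? = if does P? then 1 else 0

indicator-true : {P : Set} (P? : Dec P) → P → indicator P? ≡ 1
indicator-true P? p = cong (if_then 1 else 0) (dec-true P? p)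

indicator-false : {P : Set} (P? : Dec P) → ¬ P → indicator P? ≡ 0
indicator-false P? ¬p = cong (if_then 1 else 0) (dec-false P? ¬p)

indicator-cong : {P Q : Set} (P? : Dec P) (Q? : Dec Q) → (P → Q) → (Q → P) → indicator P? ≡ indicator Q?
indicator-cong P? Q? P⇒Q Q⇒P with P?
... | yes p = sym (indicator-true Q? (P⇒Q p))
... | no ¬p = sym (indicator-false Q? (¬p ∘ Q⇒P))

indicator-idem : {P : Set} (P? : Dec P) → indicator P? * indicator P? ≡ indicator P?
indicator-idem P? with does P?
... | true  = refl
... | false = refl

indicator≢0 : {P : Set} (P? : Dec P) → indicator P? ≢ 0 → P
indicator≢0 (yes p) _   = p
indicator≢0 (no ¬p) ≢0 = contradiction refl ≢0

-- Summation follows the enumeration that indexes adjacency matrices, so matrix products and traces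
-- over ℕ unfold to totals over vertices.
total : (V : FiniteSet) → (Carrier V → ℕ) → ℕ
total V g = sum {size V} λ i → g (Inverse.to (enumeration V) i)

sum-splitAt : ∀ m {n} (g : Fin (m + n) → ℕ) → sum g ≡ sum (λ i → g (i ↑ˡ n)) + sum (λ j → g (m ↑ʳ j))
sum-splitAt zero    g = refl
sum-splitAt (suc m) g = trans (cong (g zero +_) (sum-splitAt m (g ∘ suc))) (sym (ℕ.+-assoc (g zero) _ _))

sum-combine : ∀ m n (g : Fin (m * n) → ℕ) → sum g ≡ sum λ (i : Fin m) → sum λ (j : Fin n) → g (combine i j)
sum-combine zero    n g = refl
sum-combine (suc m) n g = trans (sum-splitAt n g) (cong (sum (λ i → g (i ↑ˡ (m * n))) +_) (sum-combine m n (g ∘ (n ↑ʳ_))))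

total-× : ∀ V W g → total (V ×ᶠ W) g ≡ total V λ v → total W λ w → g (v , w)
total-× V W g = trans (sum-combine (size V) (size W) _)
  (ℕSum.sum-cong-≗ λ i → ℕSum.sum-cong-≗ λ j →
    cong (λ (i , j) → g (Inverse.to (enumeration V) i , Inverse.to (enumeration W) j)) (remQuot-combine i j))

module _ (V : FiniteSet) where
  private
    at : Fin (size V) → Carrier V
    at = Inverse.to (enumeration V)
    index : Carrier V → Fin (size V)
    index = Inverse.from (enumeration V)
    at-index : ∀ x → at (index x) ≡ x
    at-index x = Inverse.inverseˡ (enumeration V) refl
    index-at : ∀ i → index (at i) ≡ i
    index-at i = Inverse.inverseʳ (enumeration V) refl

  total-cong : ∀ {g h} → (∀ x → g x ≡ h x) → total V g ≡ total V h
  total-cong g≡h = ℕSum.sum-cong-≗ λ i → g≡h (at i)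

  total-+ : ∀ g h → total V (λ x → g x + h x) ≡ total V g + total V h
  total-+ g h = ℕSum.∑-distrib-+ (g ∘ at) (h ∘ at)

  total-*ˡ : ∀ c g → total V (λ x → c * g x) ≡ c * total V g
  total-*ˡ c g = sym (ℕSum.*-distribˡ-sum c (g ∘ at))

  total-*ʳ : ∀ c g → total V (λ x → g x * c) ≡ total V g * c
  total-*ʳ c g = sym (ℕSum.*-distribʳ-sum c (g ∘ at))

  total-const : ∀ c → total V (λ _ → c) ≡ size V * c
  total-const c = const (size V)
    where
    const : ∀ n → sum {n} (λ _ → c) ≡ n * c
    const zero    = refl
    const (suc n) = cong (c +_) (const n)

  total-comm : ∀ W (h : Carrier V → Carrier W → ℕ) →
    total V (λ x → total W (h x)) ≡ total W (λ y → total V λ x → h x y)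
  total-comm W h = ℕSum.∑-comm λ i j → h (at i) (Inverse.to (enumeration W) j)

  private
    sum-term : ∀ {n} (g : Fin n → ℕ) i → g i ≤ sum g
    sum-term g zero    = ℕ.m≤m+n (g zero) _
    sum-term g (suc i) = ℕ.≤-trans (sum-term (g ∘ suc) i) (ℕ.m≤n+m _ (g zero))

    sum-witness : ∀ {n} (g : Fin n → ℕ) → sum g ≢ 0 → ∃[ i ] g i ≢ 0
    sum-witness {zero}  g ≢0 = contradiction refl ≢0
    sum-witness {suc n} g ≢0 with g zero in eq
    ... | suc _ = zero , λ eq′ → contradiction (trans (sym eq) eq′) λ ()
    ... | zero  with sum-witness (g ∘ suc) ≢0
    ...   | i , gi≢0 = suc i , gi≢0

    sum-mono : ∀ {n} (g h : Fin n → ℕ) → (∀ i → g i ≤ h i) → sum g ≤ sum h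
    sum-mono {zero}  g h g≤h = z≤n
    sum-mono {suc n} g h g≤h = ℕ.+-mono-≤ (g≤h zero) (sum-mono (g ∘ suc) (h ∘ suc) (g≤h ∘ suc))

    sum-tight : ∀ {n} (g h : Fin n → ℕ) → (∀ i → g i ≤ h i) → sum g ≡ sum h → ∀ i → g i ≡ h i
    sum-tight {suc n} g h g≤h eq = λ where
        zero    → head≡
        (suc i) → sum-tight (g ∘ suc) (h ∘ suc) (g≤h ∘ suc)
                    (ℕ.+-cancelˡ-≡ (h zero) _ _ (trans (cong (_+ _) (sym head≡)) eq)) i
      where
      head≡ : g zero ≡ h zero
      head≡ = ℕ.≤-antisym (g≤h zero) (ℕ.+-cancelʳ-≤ (sum (g ∘ suc)) (h zero) (g zero)
        (ℕ.≤-trans (ℕ.+-monoʳ-≤ (h zero) (sum-mono (g ∘ suc) (h ∘ suc) (g≤h ∘ suc))) (ℕ.≤-reflexive (sym eq))))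

  total-term : ∀ g x → g x ≤ total V g
  total-term g x = subst (λ y → g y ≤ total V g) (at-index x) (sum-term (g ∘ at) (index x))

  total-witness : ∀ g → total V g ≢ 0 → ∃[ x ] g x ≢ 0
  total-witness g ≢0 with sum-witness (g ∘ at) ≢0
  ... | i , gi≢0 = at i , gi≢0

  total-mono : ∀ g h → (∀ x → g x ≤ h x) → total V g ≤ total V h
  total-mono g h g≤h = sum-mono (g ∘ at) (h ∘ at) (λ i → g≤h (at i))

  -- The substitute in ℕ for the fact that nonnegative terms with sum zero all vanish; it is applied
  -- to 2pq ≤ p² + q².
  total-tight : ∀ g h → (∀ x → g x ≤ h x) → total V g ≡ total V h → ∀ x → g x ≡ h x
  total-tight g h g≤h eq x = subst (λ y → g y ≡ h y) (at-index x)
    (sum-tight (g ∘ at) (h ∘ at) (λ i → g≤h (at i)) eq (index x))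

  total-unique : {P : Pred (Carrier V) 0ℓ} (P? : ∀ x → Dec (P x)) → ∀ x → P x → (∀ y → P y → y ≡ x) →
    total V (indicator ∘ P?) ≡ 1
  total-unique {P} P? x px unique = trans
    (ℕSum.sum-cong-≗ λ i → trans
      (indicator-cong (P? (at i)) (i ≟ᶠ index x)
        (λ pi → trans (sym (index-at i)) (cong index (unique (at i) pi)))
        (λ { refl → subst P (sym (at-index x)) px }))
      (sym (ℕ.*-identityˡ _)))
    (ℕMatrix.sum-unitʳ (λ _ → 1) (index x))

  hasCardinality : {P : Pred (Carrier V) 0ℓ} (P? : ∀ x → Dec (P x)) → HasCardinality P (total V (indicator ∘ P?))
  hasCardinality {P} P? = filter P? (tabulate at)
    , filter⁺ P? (tabulate⁺ λ {i} {j} eq → trans (sym (index-at i)) (trans (cong index eq) (index-at j)))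
    , (λ x → mk⇔ (λ x∈ → proj₂ (∈-filter⁻ P? {xs = tabulate at} x∈))
                 (λ px → ∈-filter⁺ P? (subst (_∈ˡ tabulate at) (at-index x) (∈-tabulate⁺ (index x))) px))
    , length-filter at
    where
    length-filter : ∀ {n} (g : Fin n → Carrier V) → length (filter P? (tabulate g)) ≡ sum λ i → indicator (P? (g i))
    length-filter {zero}  g = refl
    length-filter {suc n} g with does (P? (g zero))
    ... | true  = cong suc (length-filter (g ∘ suc))
    ... | false = length-filter (g ∘ suc)

  HasCardinality-≐ : {P Q : Pred (Carrier V) 0ℓ} (P? : ∀ x → Dec (P x)) → (∀ x → P x → Q x) → (∀ x → Q x → P x) →
    ∀ {k} → total V (indicator ∘ P?) ≡ k → HasCardinality Q k
  HasCardinality-≐ P? P⇒Q Q⇒P refl with hasCardinality P?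
  ... | xs , unique , member , len = xs , unique ,
    (λ x → mk⇔ (λ x∈ → P⇒Q x (Equivalence.to (member x) x∈)) (λ qx → Equivalence.from (member x) (Q⇒P x qx))) , len

-- Closed walks in terms of adjacency and common neighbours.

natAdjacency : ∀ {V} → Graph V → Matrix ℕ (size V)
natAdjacency {V} X i j =
  indicator (Graph._~?_ X (Inverse.to (enumeration V) i) (Inverse.to (enumeration V) j))

module Walks {V} (X : Graph V) where
  open Graph X

  adjacency : Carrier V → Carrier V → ℕ
  adjacency x y = indicator (x ~? y)

  adjacency-sym : ∀ x y → adjacency x y ≡ adjacency y x
  adjacency-sym x y = indicator-cong (x ~? y) (y ~? x) ~-sym ~-sym

  adjacency-irrefl : ∀ x → adjacency x x ≡ 0
  adjacency-irrefl x = indicator-false (x ~? x) (~-irrefl refl)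

  commonNeighbours : Carrier V → Carrier V → ℕ
  commonNeighbours x y = total V λ z → adjacency x z * adjacency z y

  commonNeighbours-sym : ∀ x y → commonNeighbours x y ≡ commonNeighbours y x
  commonNeighbours-sym x y = total-cong V λ z →
    trans (ℕ.*-comm (adjacency x z) (adjacency z y)) (cong₂ _*_ (adjacency-sym z y) (adjacency-sym x z))

  commonNeighbours-diagonal : ∀ x → commonNeighbours x x ≡ total V (adjacency x)
  commonNeighbours-diagonal x = total-cong V λ z →
    trans (cong (adjacency x z *_) (adjacency-sym z x)) (indicator-idem (x ~? z))

  closedWalks : ℕ → ℕ
  closedWalks k = ℕMatrix.trace (ℕMatrix.power (natAdjacency X) k)

  closedWalks-0 : closedWalks 0 ≡ size V
  closedWalks-0 = trans (ℕSum.sum-cong-≗ {size V} ℕMatrix.unit-diagonal)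
    (trans (total-const V 1) (ℕ.*-identityʳ _))

  closedWalks-1 : closedWalks 1 ≡ 0
  closedWalks-1 = trans (ℕSum.sum-cong-≗ {size V} λ i → trans (ℕMatrix.power-1 (natAdjacency X) i i) (adjacency-irrefl _))
    (trans (total-const V 0) (ℕ.*-zeroʳ (size V)))

  closedWalks-2 : closedWalks 2 ≡ total V λ x → total V (adjacency x)
  closedWalks-2 = trans (ℕSum.sum-cong-≗ {size V} λ i → ℕMatrix.power-2 (natAdjacency X) i i)
    (total-cong V commonNeighbours-diagonal)

  closedWalks-3 : closedWalks 3 ≡ total V λ x → total V λ y → commonNeighbours x y * adjacency x y
  closedWalks-3 = trans (ℕMatrix.trace-power-3 (natAdjacency X))
    (total-cong V λ x → total-cong V λ y → cong (commonNeighbours x y *_) (adjacency-sym y x))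

  -- As A² is symmetric, the trace of A⁴ is the sum of the squares of the entries of A².
  closedWalks-4 : closedWalks 4 ≡ total V λ x → total V λ y → commonNeighbours x y * commonNeighbours x y
  closedWalks-4 = trans (ℕMatrix.trace-power-4 (natAdjacency X))
    (total-cong V λ x → total-cong V λ y → cong (commonNeighbours x y *_) (commonNeighbours-sym y x))

-- The complete graph on `n + 2` vertices.

module CompleteGraph (n : ℕ) where
  open Walks (complete (suc (suc n))) public

  private
    V : FiniteSet
    V = finᶠ (suc (suc n))

    equals-once : ∀ v → total V (λ w → indicator (v ≟ᶠ w)) ≡ 1
    equals-once v = total-unique V (v ≟ᶠ_) v refl λ _ → sym

    adjacency-complement : ∀ v w → adjacency v w + indicator (v ≟ᶠ w) ≡ 1
    adjacency-complement v w with v ≟ᶠ w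
    ... | yes _ = refl
    ... | no  _ = refl

  adjacency-≢ : ∀ {v w} → v ≢ w → adjacency v w ≡ 1
  adjacency-≢ {v} {w} v≢w = indicator-true (¬? (v ≟ᶠ w)) v≢w

  degree : ∀ v → total V (adjacency v) ≡ suc n
  degree v = ℕ.+-cancelʳ-≡ 1 _ _ (begin
    total V (adjacency v) + 1
      ≡⟨ cong (total V (adjacency v) +_) (sym (equals-once v)) ⟩
    total V (adjacency v) + total V (λ w → indicator (v ≟ᶠ w))
      ≡⟨ sym (total-+ V (adjacency v) λ w → indicator (v ≟ᶠ w)) ⟩
    total V (λ w → adjacency v w + indicator (v ≟ᶠ w))
      ≡⟨ total-cong V (adjacency-complement v) ⟩
    total V (λ _ → 1)
      ≡⟨ trans (total-const V 1) (ℕ.*-identityʳ _) ⟩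
    suc (suc n)
      ≡⟨ sym (ℕ.+-comm (suc n) 1) ⟩
    suc n + 1 ∎)

  commonNeighbours-same : ∀ v → commonNeighbours v v ≡ suc n
  commonNeighbours-same v = trans (commonNeighbours-diagonal v) (degree v)

  -- Every vertex is exactly one of `v`, `u` and a common neighbour of the two.
  commonNeighbours-≢ : ∀ {v u} → v ≢ u → commonNeighbours v u ≡ n
  commonNeighbours-≢ {v} {u} v≢u = ℕ.+-cancelʳ-≡ 2 _ _ (begin
    commonNeighbours v u + 2
      ≡⟨ cong₂ (λ a b → commonNeighbours v u + (a + b)) (sym (equals-once v)) (sym (equals-once u)) ⟩
    commonNeighbours v u + (total V (λ w → indicator (v ≟ᶠ w)) + total V (λ w → indicator (u ≟ᶠ w)))
      ≡⟨ cong (commonNeighbours v u +_) (sym (total-+ V (λ w → indicator (v ≟ᶠ w)) (λ w → indicator (u ≟ᶠ w)))) ⟩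
    commonNeighbours v u + total V (λ w → indicator (v ≟ᶠ w) + indicator (u ≟ᶠ w))
      ≡⟨ sym (total-+ V (λ w → adjacency v w * adjacency w u)
                        (λ w → indicator (v ≟ᶠ w) + indicator (u ≟ᶠ w))) ⟩
    total V (λ w → adjacency v w * adjacency w u + (indicator (v ≟ᶠ w) + indicator (u ≟ᶠ w)))
      ≡⟨ total-cong V partition ⟩
    total V (λ _ → 1)
      ≡⟨ trans (total-const V 1) (ℕ.*-identityʳ _) ⟩
    suc (suc n)
      ≡⟨ sym (ℕ.+-comm n 2) ⟩
    n + 2 ∎)
    where
    partition : ∀ w → adjacency v w * adjacency w u + (indicator (v ≟ᶠ w) + indicator (u ≟ᶠ w)) ≡ 1
    partition w with v ≟ᶠ w
    ... | yes refl = cong suc (indicator-false (u ≟ᶠ v) (v≢u ∘ sym))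
    ... | no  _ = trans (cong (_+ indicator (u ≟ᶠ w)) (trans (ℕ.*-identityˡ _) (adjacency-sym w u)))
                        (adjacency-complement u w)

  closedWalks-2-value : closedWalks 2 ≡ suc (suc n) * suc n
  closedWalks-2-value = trans closedWalks-2 (trans (total-cong V degree) (total-const V (suc n)))

  closedWalks-3-value : closedWalks 3 ≡ suc (suc n) * suc n * n
  closedWalks-3-value = begin
    closedWalks 3
      ≡⟨ closedWalks-3 ⟩
    (total V λ v → total V λ u → commonNeighbours v u * adjacency v u)
      ≡⟨ total-cong V (λ v → trans (total-cong V (term v)) (total-*ʳ V n (adjacency v))) ⟩
    (total V λ v → total V (adjacency v) * n)
      ≡⟨ trans (total-*ʳ V n (λ v → total V (adjacency v))) (cong (_* n) (trans (total-cong V degree) (total-const V (suc n)))) ⟩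
    suc (suc n) * suc n * n ∎
    where
    term : ∀ v u → commonNeighbours v u * adjacency v u ≡ adjacency v u * n
    term v u with v ≟ᶠ u
    ... | yes refl = ℕ.*-zeroʳ (commonNeighbours v v)
    ... | no  v≢u  = trans (ℕ.*-identityʳ _) (trans (commonNeighbours-≢ v≢u) (sym (ℕ.*-identityˡ n)))

  closedWalks-4-value : closedWalks 4 ≡ suc (suc n) * (suc n * suc n) + suc (suc n) * suc n * (n * n)
  closedWalks-4-value = begin
    closedWalks 4
      ≡⟨ closedWalks-4 ⟩
    (total V λ v → total V λ u → commonNeighbours v u * commonNeighbours v u)
      ≡⟨ total-cong V row ⟩
    (total V λ v → suc n * suc n + suc n * (n * n))
      ≡⟨ total-const V (suc n * suc n + suc n * (n * n)) ⟩
    suc (suc n) * (suc n * suc n + suc n * (n * n))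
      ≡⟨ trans (ℕ.*-distribˡ-+ (suc (suc n)) (suc n * suc n) (suc n * (n * n)))
           (cong (suc (suc n) * (suc n * suc n) +_) (sym (ℕ.*-assoc (suc (suc n)) (suc n) (n * n)))) ⟩
    suc (suc n) * (suc n * suc n) + suc (suc n) * suc n * (n * n) ∎
    where
    term : ∀ v u → commonNeighbours v u * commonNeighbours v u ≡
                   indicator (v ≟ᶠ u) * (suc n * suc n) + adjacency v u * (n * n)
    term v u with v ≟ᶠ u
    ... | yes refl = trans (cong (λ k → k * k) (commonNeighbours-same v)) (sym (trans (ℕ.+-identityʳ _) (ℕ.*-identityˡ _)))
    ... | no  v≢u  = trans (cong (λ k → k * k) (commonNeighbours-≢ v≢u)) (sym (ℕ.*-identityˡ _))
    row : ∀ v → (total V λ u → commonNeighbours v u * commonNeighbours v u) ≡ suc n * suc n + suc n * (n * n)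
    row v = begin
      (total V λ u → commonNeighbours v u * commonNeighbours v u)
        ≡⟨ total-cong V (term v) ⟩
      (total V λ u → indicator (v ≟ᶠ u) * (suc n * suc n) + adjacency v u * (n * n))
        ≡⟨ total-+ V (λ u → indicator (v ≟ᶠ u) * (suc n * suc n)) (λ u → adjacency v u * (n * n)) ⟩
      (total V λ u → indicator (v ≟ᶠ u) * (suc n * suc n)) + (total V λ u → adjacency v u * (n * n))
        ≡⟨ cong₂ _+_ (total-*ʳ V (suc n * suc n) λ u → indicator (v ≟ᶠ u)) (total-*ʳ V (n * n) (adjacency v)) ⟩
      total V (λ u → indicator (v ≟ᶠ u)) * (suc n * suc n) + total V (adjacency v) * (n * n)
        ≡⟨ cong₂ _+_ (trans (cong (_* (suc n * suc n)) (equals-once v)) (ℕ.*-identityˡ (suc n * suc n)))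
                     (cong (_* (n * n)) (degree v)) ⟩
      suc n * suc n + suc n * (n * n) ∎

-- Counting in a cover of the complete graph.

module CoverOfComplete {n r} (f : SymmetricArcFunction (complete (suc (suc n))) r) where
  open SymmetricArcFunction f
  open Walks (cover f) public
  module K = CompleteGraph n

  X : Graph (finᶠ (suc (suc n)) ×ᶠ finᶠ r)
  X = cover f
  open Graph X public

  base fibre vertices′ : FiniteSet
  base  = finᶠ (suc (suc n))
  fibre = finᶠ r
  vertices′ = base ×ᶠ fibre

  Vertex : Set
  Vertex = Carrier vertices′

  _≟_ : DecidableEquality Vertex
  _≟_ = ≡-dec _≟ᶠ_ _≟ᶠ_

  ~⇒≢ : ∀ {x y} → x ~ y → proj₁ x ≢ proj₁ y
  ~⇒≢ = proj₁

  -- Together with `lift-unique` and symmetry: the edges between two distinct fibres form a perfect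
  -- matching.
  lift-exists : ∀ v j u → v ≢ u → ∃[ k ] ((v , j) ~ (u , k))
  lift-exists v j u v≢u with value u v in eq
  ... | just σ  = σ ⟨$⟩ʳ j , v≢u , σ , refl , refl
  ... | nothing = contradiction (v≢u ∘ sym) (Equivalence.to (nothing⇔ u v) eq)

  lift-unique : ∀ {x u k k′} → x ~ (u , k) → x ~ (u , k′) → k ≡ k′
  lift-unique {_ , j} (_ , σ , eq , σj≡k) (_ , τ , eq′ , τj≡k′) =
    trans (sym σj≡k) (trans (cong (_⟨$⟩ʳ j) (just-injective (trans (sym eq) eq′))) τj≡k′)

  fibre-adjacency : ∀ x u → (total fibre λ k → adjacency x (u , k)) ≡ K.adjacency (proj₁ x) u
  fibre-adjacency (v , j) u = cases (v ≟ᶠ u)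
    where
    cases : Dec (v ≡ u) → (total fibre λ k → adjacency (v , j) (u , k)) ≡ K.adjacency v u
    cases (yes v≡u) = trans
      (total-cong fibre λ k → indicator-false ((v , j) ~? (u , k)) (λ a → ~⇒≢ a v≡u))
      (trans (trans (total-const fibre 0) (ℕ.*-zeroʳ r)) (sym (indicator-false (¬? (v ≟ᶠ u)) λ v≢u → v≢u v≡u)))
    cases (no v≢u) with lift-exists v j u v≢u
    ... | k , a = trans (total-unique fibre (λ k → (v , j) ~? (u , k)) k a λ k′ a′ → lift-unique a′ a)
                        (sym (K.adjacency-≢ v≢u))

  degree : ∀ x → total vertices′ (adjacency x) ≡ suc n
  degree x = begin
    total vertices′ (adjacency x)                             ≡⟨ total-× base fibre (adjacency x) ⟩
    (total base λ u → total fibre λ k → adjacency x (u , k)) ≡⟨ total-cong base (fibre-adjacency x) ⟩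
    total base (K.adjacency (proj₁ x))                        ≡⟨ K.degree (proj₁ x) ⟩
    suc n                                                     ∎

  -- Walks lift uniquely, so the walks of length two from `x` into the fibre of `u` correspond to
  -- those from `proj₁ x` to `u` in the base.
  fibre-commonNeighbours : ∀ x u → (total fibre λ k → commonNeighbours x (u , k)) ≡ K.commonNeighbours (proj₁ x) u
  fibre-commonNeighbours x u = begin
    (total fibre λ k → total vertices′ λ z → adjacency x z * adjacency z (u , k))
      ≡⟨ total-comm fibre vertices′ (λ k z → adjacency x z * adjacency z (u , k)) ⟩
    (total vertices′ λ z → total fibre λ k → adjacency x z * adjacency z (u , k))
      ≡⟨ total-cong vertices′ (λ z → trans (total-*ˡ fibre (adjacency x z) (λ k → adjacency z (u , k)))
                                           (cong (adjacency x z *_) (fibre-adjacency z u))) ⟩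
    (total vertices′ λ z → adjacency x z * K.adjacency (proj₁ z) u)
      ≡⟨ total-× base fibre (λ z → adjacency x z * K.adjacency (proj₁ z) u) ⟩
    (total base λ w → total fibre λ l → adjacency x (w , l) * K.adjacency w u)
      ≡⟨ total-cong base (λ w → trans (total-*ʳ fibre (K.adjacency w u) (λ l → adjacency x (w , l)))
                                      (cong (_* K.adjacency w u) (fibre-adjacency x w))) ⟩
    K.commonNeighbours (proj₁ x) u ∎

  commonNeighbours-positive : ∀ {x y z} → x ~ z → z ~ y → commonNeighbours x y ≢ 0
  commonNeighbours-positive {x} {y} {z} x~z z~y eq = contradiction
    (ℕ.≤-trans (ℕ.≤-reflexive (sym (cong₂ _*_ (indicator-true (x ~? z) x~z) (indicator-true (z ~? y) z~y))))
      (ℕ.≤-trans (total-term vertices′ (λ z → adjacency x z * adjacency z y) z) (ℕ.≤-reflexive eq)))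
    λ ()

  commonNeighbours-witness : ∀ {x y} → commonNeighbours x y ≢ 0 → ∃[ z ] (x ~ z × z ~ y)
  commonNeighbours-witness {x} {y} ≢0 with total-witness vertices′ (λ z → adjacency x z * adjacency z y) ≢0
  ... | z , xzy≢0 = z
    , indicator≢0 (x ~? z) (λ eq → xzy≢0 (cong (_* adjacency z y) eq))
    , indicator≢0 (z ~? y) (λ eq → xzy≢0 (trans (cong (adjacency x z *_) eq) (ℕ.*-zeroʳ (adjacency x z))))

  same-fibre⇒≡ : ∀ {x y z} → proj₁ x ≡ proj₁ y → x ~ z → z ~ y → x ≡ y
  same-fibre⇒≡ {v , j} {.v , k} refl x~z z~y = cong (v ,_) (lift-unique (~-sym x~z) z~y)

  commonNeighbours-same-fibre : ∀ {x y} → proj₁ x ≡ proj₁ y → x ≢ y → commonNeighbours x y ≡ 0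
  commonNeighbours-same-fibre {x} {y} same x≢y with commonNeighbours x y ℕ.≟ 0
  ... | yes eq  = eq
  ... | no  ≢0 with commonNeighbours-witness ≢0
  ...   | z , x~z , z~y = contradiction (same-fibre⇒≡ same x~z z~y) x≢y

  pairs : (Vertex → Vertex → ℕ) → ℕ
  pairs h = total vertices′ λ x → total vertices′ (h x)

  pairs-cong : ∀ {g h} → (∀ x y → g x y ≡ h x y) → pairs g ≡ pairs h
  pairs-cong eq = total-cong vertices′ λ x → total-cong vertices′ (eq x)

  pairs-+ : ∀ g h → pairs (λ x y → g x y + h x y) ≡ pairs g + pairs h
  pairs-+ g h = trans (total-cong vertices′ λ x → total-+ vertices′ (g x) (h x))
                      (total-+ vertices′ (λ x → total vertices′ (g x)) (λ x → total vertices′ (h x)))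

  pairs-*ˡ : ∀ c h → pairs (λ x y → c * h x y) ≡ c * pairs h
  pairs-*ˡ c h = trans (total-cong vertices′ λ x → total-*ˡ vertices′ c (h x))
                       (total-*ˡ vertices′ c (λ x → total vertices′ (h x)))

  apart : Vertex → Vertex → ℕ
  apart x y = K.adjacency (proj₁ x) (proj₁ y)

  -- The mixed and second moments, over pairs in distinct fibres. The first is the trace of A³; the
  -- second is the trace of A⁴ without its diagonal part.
  triangles squares : ℕ
  triangles = pairs λ x y → apart x y * (commonNeighbours x y * adjacency x y)
  squares   = pairs λ x y → apart x y * (commonNeighbours x y * commonNeighbours x y)

  -- The number of ordered adjacent pairs, which is also the trace of A².
  darts : ℕ
  darts = suc (suc n) * r * suc n

  apart-same : ∀ {x y} → proj₁ x ≡ proj₁ y → apart x y ≡ 0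
  apart-same {x} {y} same = indicator-false (¬? (proj₁ x ≟ᶠ proj₁ y)) λ ≢ → ≢ same

  -- An affine function of adjacency, freed of its coefficients: adjacency takes only the values 0
  -- and 1, so it is enough that equal adjacency gives equal counts.
  Rigid : Set
  Rigid = ∀ x y x′ y′ → proj₁ x ≢ proj₁ y → proj₁ x′ ≢ proj₁ y′ →
    adjacency x y ≡ adjacency x′ y′ → commonNeighbours x y ≡ commonNeighbours x′ y′

  -- Up to scaling, and with subtracted terms moved across, the variance of the number of
  -- common neighbours given adjacency, over the pairs in distinct fibres; here ρ = r - 1.
  VarianceVanishes : ℕ → Set
  VarianceVanishes ρ =
    suc (suc n) * suc n * ρ * squares + 2 * (suc (suc n) * suc n * n * triangles) ≡
    triangles * triangles + suc (suc n) * suc n * n * (suc (suc n) * suc n * n)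
      + suc (suc n) * suc n * ρ * (suc (suc n) * suc n * (n * n))

  private
    apart*adjacency : ∀ x y → apart x y * adjacency x y ≡ adjacency x y
    apart*adjacency x y = cases (proj₁ x ≟ᶠ proj₁ y)
      where
      cases : Dec (proj₁ x ≡ proj₁ y) → apart x y * adjacency x y ≡ adjacency x y
      cases (yes same) = trans (cong (_* adjacency x y) (apart-same {x} {y} same))
                               (sym (indicator-false (x ~? y) λ a → ~⇒≢ a same))
      cases (no  ≢)    = trans (cong (_* adjacency x y) (K.adjacency-≢ ≢)) (ℕ.*-identityˡ _)

    rows : ∀ (h : Vertex → Vertex → ℕ) c → (∀ x → total vertices′ (h x) ≡ c) → pairs h ≡ suc (suc n) * r * c
    rows h c eq = trans (total-cong vertices′ eq) (total-const vertices′ c)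

  pairs-adjacency : pairs adjacency ≡ darts
  pairs-adjacency = rows adjacency (suc n) degree

  pairs-apart-adjacency : pairs (λ x y → apart x y * adjacency x y) ≡ darts
  pairs-apart-adjacency = trans (pairs-cong apart*adjacency) pairs-adjacency

  pairs-apart : pairs apart ≡ darts * r
  pairs-apart = trans (rows apart (suc n * r) row) (sym (ℕ.*-assoc (suc (suc n) * r) (suc n) r))
    where
    row : ∀ x → total vertices′ (apart x) ≡ suc n * r
    row x = begin
      total vertices′ (apart x)
        ≡⟨ total-× base fibre (apart x) ⟩
      (total base λ u → total fibre λ _ → K.adjacency (proj₁ x) u)
        ≡⟨ total-cong base (λ u → trans (total-const fibre (K.adjacency (proj₁ x) u)) (ℕ.*-comm r _)) ⟩
      (total base λ u → K.adjacency (proj₁ x) u * r)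
        ≡⟨ trans (total-*ʳ base r (K.adjacency (proj₁ x))) (cong (_* r) (K.degree (proj₁ x))) ⟩
      suc n * r ∎

  pairs-apart-commonNeighbours : pairs (λ x y → apart x y * commonNeighbours x y) ≡ darts * n
  pairs-apart-commonNeighbours =
    trans (rows (λ x y → apart x y * commonNeighbours x y) (suc n * n) row) (sym (ℕ.*-assoc (suc (suc n) * r) (suc n) n))
    where
    row : ∀ x → (total vertices′ λ y → apart x y * commonNeighbours x y) ≡ suc n * n
    row x = begin
      (total vertices′ λ y → apart x y * commonNeighbours x y)
        ≡⟨ total-× base fibre (λ y → apart x y * commonNeighbours x y) ⟩
      (total base λ u → total fibre λ k → K.adjacency (proj₁ x) u * commonNeighbours x (u , k))
        ≡⟨ total-cong base (λ u → trans (total-*ˡ fibre (K.adjacency (proj₁ x) u) (λ k → commonNeighbours x (u , k)))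
                                        (cong (K.adjacency (proj₁ x) u *_) (fibre-commonNeighbours x u))) ⟩
      (total base λ u → K.adjacency (proj₁ x) u * K.commonNeighbours (proj₁ x) u)
        ≡⟨ total-cong base term ⟩
      (total base λ u → K.adjacency (proj₁ x) u * n)
        ≡⟨ trans (total-*ʳ base n (K.adjacency (proj₁ x))) (cong (_* n) (K.degree (proj₁ x))) ⟩
      suc n * n ∎
      where
      term : ∀ u → K.adjacency (proj₁ x) u * K.commonNeighbours (proj₁ x) u ≡ K.adjacency (proj₁ x) u * n
      term u with proj₁ x ≟ᶠ u
      ... | yes _  = refl
      ... | no  ≢u = cong (_+ 0) (K.commonNeighbours-≢ ≢u)

  closedWalks-2-value : closedWalks 2 ≡ darts
  closedWalks-2-value = trans closedWalks-2 pairs-adjacency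

  closedWalks-3-value : closedWalks 3 ≡ triangles
  closedWalks-3-value = trans closedWalks-3 (pairs-cong λ x y → sym (begin
    apart x y * (commonNeighbours x y * adjacency x y)
      ≡⟨ solve 3 (λ d m a → d :* (m :* a) := m :* (d :* a)) refl (apart x y) (commonNeighbours x y) (adjacency x y) ⟩
    commonNeighbours x y * (apart x y * adjacency x y)
      ≡⟨ cong (commonNeighbours x y *_) (apart*adjacency x y) ⟩
    commonNeighbours x y * adjacency x y ∎))

  -- A pair of equal vertices contributes the square of the degree, two distinct vertices of one
  -- fibre contribute nothing, and all other pairs make up `squares`.
  closedWalks-4-value : closedWalks 4 ≡ suc (suc n) * r * (suc n * suc n) + squares
  closedWalks-4-value = begin
    closedWalks 4
      ≡⟨ trans closedWalks-4 (pairs-cong term) ⟩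
    pairs (λ x y → indicator (x ≟ y) * (suc n * suc n) + apart x y * (commonNeighbours x y * commonNeighbours x y))
      ≡⟨ pairs-+ (λ x y → indicator (x ≟ y) * (suc n * suc n))
                 (λ x y → apart x y * (commonNeighbours x y * commonNeighbours x y)) ⟩
    pairs (λ x y → indicator (x ≟ y) * (suc n * suc n)) + squares
      ≡⟨ cong (_+ squares) (rows (λ x y → indicator (x ≟ y) * (suc n * suc n)) (suc n * suc n) λ x →
           trans (total-*ʳ vertices′ (suc n * suc n) λ y → indicator (x ≟ y))
             (trans (cong (_* (suc n * suc n)) (total-unique vertices′ (x ≟_) x refl λ _ → sym))
                    (ℕ.*-identityˡ (suc n * suc n)))) ⟩
    suc (suc n) * r * (suc n * suc n) + squares ∎
    where
    term : ∀ x y → commonNeighbours x y * commonNeighbours x y ≡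
      indicator (x ≟ y) * (suc n * suc n) + apart x y * (commonNeighbours x y * commonNeighbours x y)
    term x y = cases (x ≟ y) (proj₁ x ≟ᶠ proj₁ y)
      where
      combination : ∀ {i d m} → indicator (x ≟ y) ≡ i → apart x y ≡ d → commonNeighbours x y ≡ m →
        m * m ≡ i * (suc n * suc n) + d * (m * m) → commonNeighbours x y * commonNeighbours x y ≡
        indicator (x ≟ y) * (suc n * suc n) + apart x y * (commonNeighbours x y * commonNeighbours x y)
      combination refl refl refl eq = eq
      cases : Dec (x ≡ y) → Dec (proj₁ x ≡ proj₁ y) → commonNeighbours x y * commonNeighbours x y ≡
        indicator (x ≟ y) * (suc n * suc n) + apart x y * (commonNeighbours x y * commonNeighbours x y)
      cases (yes refl) _          = combination (indicator-true (x ≟ x) refl) (apart-same {x} {x} refl)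
        (trans (commonNeighbours-diagonal x) (degree x))
        (sym (trans (ℕ.+-identityʳ _) (ℕ.*-identityˡ (suc n * suc n))))
      cases (no x≢y)   (yes same) = combination (indicator-false (x ≟ y) x≢y) (apart-same {x} {y} same)
        (commonNeighbours-same-fibre same x≢y) refl
      cases (no x≢y)   (no ≢)     = combination (indicator-false (x ≟ y) x≢y) (K.adjacency-≢ ≢) refl
        (sym (ℕ.*-identityˡ _))

-- Squares in ℕ and the algebra of the variance.

private
  square-gap : ∀ p k → p * p + (p + k) * (p + k) ≡ 2 * (p * (p + k)) + k * k
  square-gap = solve 2 (λ p k → p :* p :+ (p :+ k) :* (p :+ k) := con 2 :* (p :* (p :+ k)) :+ k :* k) refl

  -- By symmetry the larger number can be written `p + k`, which makes the square of the difference
  -- `k * k` without subtraction.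
  ordered : ∀ (P : ℕ → ℕ → Set) → (∀ {p q} → P p q → P q p) → (∀ p k → P p (p + k)) → ∀ p q → P p q
  ordered P P-sym P-≤ p q with ℕ.≤-total p q
  ... | inj₁ p≤q = subst (P p) (ℕ.m+[n∸m]≡n p≤q) (P-≤ p (q ℕ.∸ p))
  ... | inj₂ q≤p = P-sym (subst (P q) (ℕ.m+[n∸m]≡n q≤p) (P-≤ q (p ℕ.∸ q)))

2*pq≤p²+q² : ∀ p q → 2 * (p * q) ≤ p * p + q * q
2*pq≤p²+q² = ordered _
  (λ {p} {q} → subst₂ _≤_ (cong (2 *_) (ℕ.*-comm p q)) (ℕ.+-comm (p * p) (q * q)))
  (λ p k → subst (2 * (p * (p + k)) ≤_) (sym (square-gap p k)) (ℕ.m≤m+n _ (k * k)))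

p²+q²≡2*pq⇒p≡q : ∀ p q → p * p + q * q ≡ 2 * (p * q) → p ≡ q
p²+q²≡2*pq⇒p≡q = ordered _
  (λ {p} {q} imp eq → sym (imp (trans (ℕ.+-comm (p * p) (q * q)) (trans eq (cong (2 *_) (ℕ.*-comm q p))))))
  (λ p k eq → trans (sym (ℕ.+-identityʳ p)) (cong (p +_) (sym (square≡0 k
    (ℕ.+-cancelˡ-≡ (2 * (p * (p + k))) _ _ (trans (sym (square-gap p k)) (trans eq (sym (ℕ.+-identityʳ _)))))))))
  where
  square≡0 : ∀ k → k * k ≡ 0 → k ≡ 0
  square≡0 zero eq = refl

-- In the application `N` is the number of fibres, `m` the degree, `n` the number of common
-- neighbours of two distinct base vertices and `ρ` is r - 1; `S` and `Q` are `triangles` and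
-- `squares`. Then `d₀` and `d₂` are P_0 and P_2, `t₃` is the trace of B³, and `E` is `darts`.
module _ (N m n ρ S Q : ℕ) where
  private
    d₀ d₂ t₃ E w g h : ℕ
    d₀ = N * ρ
    d₂ = N * m * ρ
    t₃ = N * m * n
    E  = N * suc ρ * m
    w  = E * ρ
    g  = E * n
    h  = suc ρ * S

  -- The diagonal parts cancel: d₂³ = d₀ d₂ N m² ρ joins d₀ d₂ N m² from the base to match d₀ d₂ N
  -- (1 + ρ) m² from the cover. The common factor `d₀` is then removed.
  variance-identity : .{{_ : NonZero d₀}} →
    d₀ * d₂ * (N * suc ρ * (m * m) + Q) + 2 * (d₀ * t₃ * S) ≡
    d₀ * (S * S) + d₀ * (t₃ * t₃) + d₂ * d₂ * d₂ + d₀ * d₂ * (N * (m * m) + N * m * (n * n)) →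
    d₂ * Q + 2 * (t₃ * S) ≡ S * S + t₃ * t₃ + d₂ * (N * m * (n * n))
  variance-identity eq = ℕ.+-cancelˡ-≡ (d₂ * (N * suc ρ * (m * m))) _ _ (ℕ.*-cancelˡ-≡ _ _ d₀ (begin
    d₀ * (d₂ * (N * suc ρ * (m * m)) + (d₂ * Q + 2 * (t₃ * S)))
      ≡⟨ solve 6 (λ N m n ρ S Q → let d₀ = N :* ρ; d₂ = N :* m :* ρ; t₃ = N :* m :* n; r = con 1 :+ ρ in
           d₀ :* (d₂ :* (N :* r :* (m :* m)) :+ (d₂ :* Q :+ con 2 :* (t₃ :* S))) :=
           d₀ :* d₂ :* (N :* r :* (m :* m) :+ Q) :+ con 2 :* (d₀ :* t₃ :* S)) refl N m n ρ S Q ⟩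
    d₀ * d₂ * (N * suc ρ * (m * m) + Q) + 2 * (d₀ * t₃ * S)
      ≡⟨ eq ⟩
    d₀ * (S * S) + d₀ * (t₃ * t₃) + d₂ * d₂ * d₂ + d₀ * d₂ * (N * (m * m) + N * m * (n * n))
      ≡⟨ solve 5 (λ N m n ρ S → let d₀ = N :* ρ; d₂ = N :* m :* ρ; t₃ = N :* m :* n; r = con 1 :+ ρ in
           d₀ :* (S :* S) :+ d₀ :* (t₃ :* t₃) :+ d₂ :* d₂ :* d₂ :+ d₀ :* d₂ :* (N :* (m :* m) :+ N :* m :* (n :* n)) :=
           d₀ :* (d₂ :* (N :* r :* (m :* m)) :+ (S :* S :+ t₃ :* t₃ :+ d₂ :* (N :* m :* (n :* n))))) refl N m n ρ S ⟩
    d₀ * (d₂ * (N * suc ρ * (m * m)) + (S * S + t₃ * t₃ + d₂ * (N * m * (n * n)))) ∎))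

  -- The two sides are the sums of p² + q² and of 2pq over pairs in distinct fibres, with p = w m +
  -- g a + S and q = h a + g, where m now counts common neighbours and a is adjacency. The sums of
  -- m², m a, m, a and 1 are Q, S, E n, E and E (1 + ρ).
  variance-vanishes :
    d₂ * Q + 2 * (t₃ * S) ≡ S * S + t₃ * t₃ + d₂ * (N * m * (n * n)) →
    w * w * Q + 2 * (w * g) * S + 2 * (w * S) * (E * n) + (g * g + h * h + 2 * (g * S) + 2 * (h * g)) * E
      + (S * S + g * g) * (E * suc ρ) ≡
    0 * Q + 2 * (w * h) * S + 2 * (w * g) * (E * n) + 2 * (g * h + g * g + S * h) * E + 2 * (S * g) * (E * suc ρ)
  variance-vanishes eq = begin
    w * w * Q + 2 * (w * g) * S + 2 * (w * S) * (E * n) + (g * g + h * h + 2 * (g * S) + 2 * (h * g)) * E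
      + (S * S + g * g) * (E * suc ρ)
      -- The hypothesis is used E ρ (1 + ρ) times over, because this factor turns the coefficient
      -- `d₂` of `Q` into `w * w`.
      ≡⟨ solve 6 (λ N m n ρ S Q →
           let d₂ = N :* m :* ρ; t₃ = N :* m :* n; r = con 1 :+ ρ; E = N :* r :* m
               w = E :* ρ; g = E :* n; h = r :* S in
           w :* w :* Q :+ con 2 :* (w :* g) :* S :+ con 2 :* (w :* S) :* (E :* n)
             :+ (g :* g :+ h :* h :+ con 2 :* (g :* S) :+ con 2 :* (h :* g)) :* E :+ (S :* S :+ g :* g) :* (E :* r) :=
           E :* ρ :* r :* (d₂ :* Q :+ con 2 :* (t₃ :* S)) :+ (con 2 :* (w :* g :* S)
             :+ (g :* g :+ h :* h :+ con 2 :* (g :* S) :+ con 2 :* (h :* g)) :* E :+ (S :* S :+ g :* g) :* (E :* r)))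
           refl N m n ρ S Q ⟩
    E * ρ * suc ρ * (d₂ * Q + 2 * (t₃ * S)) + rest
      ≡⟨ cong (λ z → E * ρ * suc ρ * z + rest) eq ⟩
    E * ρ * suc ρ * (S * S + t₃ * t₃ + d₂ * (N * m * (n * n))) + rest
      ≡⟨ solve 6 (λ N m n ρ S Q →
           let d₂ = N :* m :* ρ; t₃ = N :* m :* n; r = con 1 :+ ρ; E = N :* r :* m
               w = E :* ρ; g = E :* n; h = r :* S in
           E :* ρ :* r :* (S :* S :+ t₃ :* t₃ :+ d₂ :* (N :* m :* (n :* n))) :+ (con 2 :* (w :* g :* S)
             :+ (g :* g :+ h :* h :+ con 2 :* (g :* S) :+ con 2 :* (h :* g)) :* E :+ (S :* S :+ g :* g) :* (E :* r)) :=
           con 0 :* Q :+ con 2 :* (w :* h) :* S :+ con 2 :* (w :* g) :* (E :* n)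
             :+ con 2 :* (g :* h :+ g :* g :+ S :* h) :* E :+ con 2 :* (S :* g) :* (E :* r))
           refl N m n ρ S Q ⟩
    0 * Q + 2 * (w * h) * S + 2 * (w * g) * (E * n) + 2 * (g * h + g * g + S * h) * E + 2 * (S * g) * (E * suc ρ) ∎
    where
    rest : ℕ
    rest = 2 * (w * g * S) + (g * g + h * h + 2 * (g * S) + 2 * (h * g)) * E + (S * S + g * g) * (E * suc ρ)

-- Rigidity from equality in the sum of squares.

module Rigidity {n ρ} (f : SymmetricArcFunction (complete (suc (suc n))) (suc (suc ρ)))
  (variance : CoverOfComplete.VarianceVanishes f (suc ρ)) where
  open CoverOfComplete f

  private
    -- Let m be the number of common neighbours, a the adjacency and r the index. Over the darts * r
    -- pairs in distinct fibres, a has mean 1/r, m has mean n/r and m a has mean triangles / (darts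
    -- * r). The least-squares line is therefore w m = (h - g) a + (g - triangles); `left` and
    -- `right` are its sides with the subtracted terms moved across.
    w g h : ℕ
    w = darts * suc ρ
    g = darts * n
    h = suc (suc ρ) * triangles

    left right : Vertex → Vertex → ℕ
    left  x y = w * commonNeighbours x y + g * adjacency x y + triangles
    right x y = h * adjacency x y + g

    -- Since a² = a for an indicator, a quadratic in common neighbours and adjacency has only these
    -- five monomials.
    combination : ℕ → ℕ → ℕ → ℕ → ℕ → Vertex → Vertex → ℕ
    combination c₀ c₁ c₂ c₃ c₄ x y =
      c₀ * (apart x y * (commonNeighbours x y * commonNeighbours x y)) +
      c₁ * (apart x y * (commonNeighbours x y * adjacency x y)) +
      c₂ * (apart x y * commonNeighbours x y) + c₃ * (apart x y * adjacency x y) + c₄ * apart x y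

    pairs-combination : ∀ c₀ c₁ c₂ c₃ c₄ → pairs (combination c₀ c₁ c₂ c₃ c₄) ≡
      c₀ * squares + c₁ * triangles + c₂ * (darts * n) + c₃ * darts + c₄ * (darts * suc (suc ρ))
    pairs-combination c₀ c₁ c₂ c₃ c₄ = trans (pairs-+ (λ x y → t₀ x y + t₁ x y + t₂ x y + t₃ x y) t₄) (cong₂ _+_
      (trans (pairs-+ (λ x y → t₀ x y + t₁ x y + t₂ x y) t₃) (cong₂ _+_
        (trans (pairs-+ (λ x y → t₀ x y + t₁ x y) t₂) (cong₂ _+_
          (trans (pairs-+ t₀ t₁) (cong₂ _+_
            (pairs-*ˡ c₀ λ x y → apart x y * (commonNeighbours x y * commonNeighbours x y))
            (pairs-*ˡ c₁ λ x y → apart x y * (commonNeighbours x y * adjacency x y))))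
          (trans (pairs-*ˡ c₂ λ x y → apart x y * commonNeighbours x y) (cong (c₂ *_) pairs-apart-commonNeighbours))))
        (trans (pairs-*ˡ c₃ λ x y → apart x y * adjacency x y) (cong (c₃ *_) pairs-apart-adjacency))))
      (trans (pairs-*ˡ c₄ apart) (cong (c₄ *_) pairs-apart)))
      where
      t₀ t₁ t₂ t₃ t₄ : Vertex → Vertex → ℕ
      t₀ x y = c₀ * (apart x y * (commonNeighbours x y * commonNeighbours x y))
      t₁ x y = c₁ * (apart x y * (commonNeighbours x y * adjacency x y))
      t₂ x y = c₂ * (apart x y * commonNeighbours x y)
      t₃ x y = c₃ * (apart x y * adjacency x y)
      t₄ x y = c₄ * apart x y

    products squared : Vertex → Vertex → ℕ
    products x y = apart x y * (2 * (left x y * right x y))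
    squared  x y = apart x y * (left x y * left x y + right x y * right x y)

    squared-combination : ∀ x y → squared x y ≡
      combination (w * w) (2 * (w * g)) (2 * (w * triangles))
        (g * g + h * h + 2 * (g * triangles) + 2 * (h * g)) (triangles * triangles + g * g) x y
    squared-combination x y = polynomial w g h triangles (apart x y) (commonNeighbours x y) (adjacency x y)
      (indicator-idem (x ~? y))
      where
      polynomial : ∀ w g h S d m a → a * a ≡ a →
        d * ((w * m + g * a + S) * (w * m + g * a + S) + (h * a + g) * (h * a + g)) ≡
        w * w * (d * (m * m)) + 2 * (w * g) * (d * (m * a)) + 2 * (w * S) * (d * m)
          + (g * g + h * h + 2 * (g * S) + 2 * (h * g)) * (d * a) + (S * S + g * g) * d
      polynomial w g h S d m a a²≡a = begin
        d * ((w * m + g * a + S) * (w * m + g * a + S) + (h * a + g) * (h * a + g))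
          ≡⟨ solve 7 (λ w g h S d m a →
               d :* ((w :* m :+ g :* a :+ S) :* (w :* m :+ g :* a :+ S) :+ (h :* a :+ g) :* (h :* a :+ g)) :=
               w :* w :* (d :* (m :* m)) :+ con 2 :* (w :* g) :* (d :* (m :* a)) :+ con 2 :* (w :* S) :* (d :* m)
                 :+ ((g :* g :+ h :* h) :* (d :* (a :* a)) :+ (con 2 :* (g :* S) :+ con 2 :* (h :* g)) :* (d :* a))
                 :+ (S :* S :+ g :* g) :* d) refl w g h S d m a ⟩
        c + ((g * g + h * h) * (d * (a * a)) + (2 * (g * S) + 2 * (h * g)) * (d * a)) + (S * S + g * g) * d
          ≡⟨ cong (λ z → c + ((g * g + h * h) * (d * z) + (2 * (g * S) + 2 * (h * g)) * (d * a)) + (S * S + g * g) * d) a²≡a ⟩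
        c + ((g * g + h * h) * (d * a) + (2 * (g * S) + 2 * (h * g)) * (d * a)) + (S * S + g * g) * d
          ≡⟨ cong (λ z → c + z + (S * S + g * g) * d) (trans (sym (ℕ.*-distribʳ-+ (d * a) (g * g + h * h) _))
               (cong (_* (d * a)) (sym (ℕ.+-assoc (g * g + h * h) _ _)))) ⟩
        c + (g * g + h * h + 2 * (g * S) + 2 * (h * g)) * (d * a) + (S * S + g * g) * d ∎
        where c = w * w * (d * (m * m)) + 2 * (w * g) * (d * (m * a)) + 2 * (w * S) * (d * m)

    products-combination : ∀ x y → products x y ≡
      combination 0 (2 * (w * h)) (2 * (w * g)) (2 * (g * h + g * g + triangles * h)) (2 * (triangles * g)) x y
    products-combination x y = polynomial w g h triangles (apart x y) (commonNeighbours x y) (adjacency x y)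
      (indicator-idem (x ~? y))
      where
      polynomial : ∀ w g h S d m a → a * a ≡ a →
        d * (2 * ((w * m + g * a + S) * (h * a + g))) ≡
        2 * (w * h) * (d * (m * a)) + 2 * (w * g) * (d * m) + 2 * (g * h + g * g + S * h) * (d * a) + 2 * (S * g) * d
      polynomial w g h S d m a a²≡a = begin
        d * (2 * ((w * m + g * a + S) * (h * a + g)))
          ≡⟨ solve 7 (λ w g h S d m a →
               d :* (con 2 :* ((w :* m :+ g :* a :+ S) :* (h :* a :+ g))) :=
               con 2 :* (w :* h) :* (d :* (m :* a)) :+ con 2 :* (w :* g) :* (d :* m)
                 :+ (con 2 :* (g :* h) :* (d :* (a :* a)) :+ con 2 :* (g :* g :+ S :* h) :* (d :* a))
                 :+ con 2 :* (S :* g) :* d) refl w g h S d m a ⟩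
        c + (2 * (g * h) * (d * (a * a)) + 2 * (g * g + S * h) * (d * a)) + 2 * (S * g) * d
          ≡⟨ cong (λ z → c + (2 * (g * h) * (d * z) + 2 * (g * g + S * h) * (d * a)) + 2 * (S * g) * d) a²≡a ⟩
        c + (2 * (g * h) * (d * a) + 2 * (g * g + S * h) * (d * a)) + 2 * (S * g) * d
          ≡⟨ cong (λ z → c + z + 2 * (S * g) * d) (solve 4 (λ x y z u →
               con 2 :* x :* u :+ con 2 :* (y :+ z) :* u := con 2 :* (x :+ y :+ z) :* u) refl (g * h) (g * g) (S * h) (d * a)) ⟩
        c + 2 * (g * h + g * g + S * h) * (d * a) + 2 * (S * g) * d ∎
        where c = 2 * (w * h) * (d * (m * a)) + 2 * (w * g) * (d * m)

    products≤squared : ∀ x y → products x y ≤ squared x y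
    products≤squared x y = ℕ.*-monoʳ-≤ (apart x y) (2*pq≤p²+q² (left x y) (right x y))

    pairs-equal : pairs products ≡ pairs squared
    pairs-equal = trans (pairs-cong products-combination) (trans
      (pairs-combination 0 (2 * (w * h)) (2 * (w * g)) (2 * (g * h + g * g + triangles * h)) (2 * (triangles * g)))
      (trans (sym (variance-vanishes (suc (suc n)) (suc n) n (suc ρ) triangles squares variance))
        (trans (sym (pairs-combination (w * w) (2 * (w * g)) (2 * (w * triangles))
          (g * g + h * h + 2 * (g * triangles) + 2 * (h * g)) (triangles * triangles + g * g))) (sym (pairs-cong squared-combination)))))

    products≡squared : ∀ x y → products x y ≡ squared x y
    products≡squared x = total-tight vertices′ (products x) (squared x) (products≤squared x)
      (total-tight vertices′ (λ x → total vertices′ (products x)) (λ x → total vertices′ (squared x))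
        (λ x → total-mono vertices′ (products x) (squared x) (products≤squared x)) pairs-equal x)

    left≡right : ∀ {x y} → proj₁ x ≢ proj₁ y → left x y ≡ right x y
    left≡right {x} {y} x≢y = p²+q²≡2*pq⇒p≡q (left x y) (right x y) (begin
      left x y * left x y + right x y * right x y ≡⟨ sym (ℕ.*-identityˡ _) ⟩
      1 * (left x y * left x y + right x y * right x y) ≡⟨ cong (_* (left x y * left x y + right x y * right x y)) (sym (K.adjacency-≢ x≢y)) ⟩
      squared x y ≡⟨ sym (products≡squared x y) ⟩
      products x y ≡⟨ cong (_* (2 * (left x y * right x y))) (K.adjacency-≢ x≢y) ⟩
      1 * (2 * (left x y * right x y)) ≡⟨ ℕ.*-identityˡ _ ⟩
      2 * (left x y * right x y) ∎)

  rigid : CoverOfComplete.Rigid f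
  rigid x y x′ y′ x≢y x′≢y′ eq =
    -- `w` is a product of successors: the index is at least 2 and the base has at least two
    -- vertices.
    ℕ.*-cancelˡ-≡ (commonNeighbours x y) (commonNeighbours x′ y′) w
      (ℕ.+-cancelʳ-≡ (g * adjacency x y) (w * commonNeighbours x y) (w * commonNeighbours x′ y′)
      (ℕ.+-cancelʳ-≡ triangles (w * commonNeighbours x y + g * adjacency x y) _ (begin
      left x y                                                           ≡⟨ left≡right x≢y ⟩
      right x y                                                          ≡⟨ cong (λ a → h * a + g) eq ⟩
      right x′ y′                                                        ≡⟨ sym (left≡right x′≢y′) ⟩
      w * commonNeighbours x′ y′ + g * adjacency x′ y′ + triangles      ≡⟨ cong (λ a → w * commonNeighbours x′ y′ + g * a + triangles) (sym eq) ⟩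
      w * commonNeighbours x′ y′ + g * adjacency x y + triangles        ∎)))

-- Distances, intersection numbers and antipodal classes.

module DistanceRegular {n ρ} (f : SymmetricArcFunction (complete (suc (suc n))) (suc (suc ρ)))
  (rigid : CoverOfComplete.Rigid f) (connected : Connected (cover f)) where
  open CoverOfComplete f

  private
    -- Sample pairs from distinct fibres: `x₁` is the neighbour of `x₀` in another fibre, and `x₂` a
    -- second vertex of that fibre, hence not adjacent to `x₀`. By rigidity they determine the
    -- counts `a₁` and `c₂` for all pairs.
    x₀ x₁ x₂ : Vertex
    x₀ = zero , zero
    x₁ = suc zero , proj₁ (lift-exists zero zero (suc zero) λ ())
    x₂ = suc zero , other (proj₂ x₁)
      where
      other : Fin (suc (suc ρ)) → Fin (suc (suc ρ))
      other zero    = suc zero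
      other (suc _) = zero

    x₁≢x₂ : proj₂ x₁ ≢ proj₂ x₂
    x₁≢x₂ with proj₂ x₁
    ... | zero  = λ ()
    ... | suc _ = λ ()

    x₀~x₁ : x₀ ~ x₁
    x₀~x₁ = proj₂ (lift-exists zero zero (suc zero) λ ())

    x₀≁x₂ : ¬ x₀ ~ x₂
    x₀≁x₂ x₀~x₂ = x₁≢x₂ (lift-unique x₀~x₁ x₀~x₂)

    a₁ c₂ : ℕ
    a₁ = commonNeighbours x₀ x₁
    c₂ = commonNeighbours x₀ x₂

    commonNeighbours-adjacent : ∀ {x y} → x ~ y → commonNeighbours x y ≡ a₁
    commonNeighbours-adjacent {x} {y} x~y = rigid x y x₀ x₁ (~⇒≢ x~y) (λ ())
      (trans (indicator-true (x ~? y) x~y) (sym (indicator-true (x₀ ~? x₁) x₀~x₁)))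

    commonNeighbours-nonadjacent : ∀ {x y} → proj₁ x ≢ proj₁ y → ¬ x ~ y → commonNeighbours x y ≡ c₂
    commonNeighbours-nonadjacent {x} {y} x≢y x≁y = rigid x y x₀ x₂ x≢y (λ ())
      (trans (indicator-false (x ~? y) x≁y) (sym (indicator-false (x₀ ~? x₂) x₀≁x₂)))

    -- Otherwise adjacency-or-equality would be transitive, so by connectedness
    -- two vertices of the same fibre would be adjacent.
    c₂≢0 : c₂ ≢ 0
    c₂≢0 c₂≡0 with walk⇒ (proj₂ (connected (zero , zero) (zero , suc zero)))
      where
      walk⇒ : ∀ {x y k} → Walk X x y k → x ≡ y ⊎ x ~ y
      walk⇒ stop = inj₁ refl
      walk⇒ (step {v = z} x~z walk) with walk⇒ walk
      ... | inj₁ refl = inj₂ x~z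
      walk⇒ {x} {y} (step {v = z} x~z walk) | inj₂ z~y with proj₁ x ≟ᶠ proj₁ y | x ~? y
      ... | yes same | _        = inj₁ (same-fibre⇒≡ same x~z z~y)
      ... | no _     | yes x~y  = inj₂ x~y
      ... | no x≢y   | no x≁y   = contradiction
        (trans (commonNeighbours-nonadjacent x≢y x≁y) c₂≡0) (commonNeighbours-positive x~z z~y)
    ... | inj₂ (0≢0 , _) = 0≢0 refl

  -- The distance as read off from fibres and adjacency. Its decidability is immediate, as counting
  -- requires, whereas `AtDistance` quantifies over walks.
  Distance : ℕ → Vertex → Vertex → Set
  Distance 0 x y = x ≡ y
  Distance 1 x y = x ~ y
  Distance 2 x y = proj₁ x ≢ proj₁ y × ¬ x ~ y
  Distance 3 x y = x ≢ y × proj₁ x ≡ proj₁ y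
  Distance _ x y = ⊥

  distance? : ∀ k x y → Dec (Distance k x y)
  distance? 0 x y = x ≟ y
  distance? 1 x y = x ~? y
  distance? 2 x y = ¬? (proj₁ x ≟ᶠ proj₁ y) ×-dec ¬? (x ~? y)
  distance? 3 x y = ¬? (x ≟ y) ×-dec (proj₁ x ≟ᶠ proj₁ y)
  distance? (suc (suc (suc (suc k)))) x y = no λ ()

  classify : ∀ x y → ∃[ k ] (k ≤ 3 × Distance k x y)
  classify x y with x ≟ y | proj₁ x ≟ᶠ proj₁ y | x ~? y
  ... | yes x≡y | _        | _       = 0 , z≤n , x≡y
  ... | no x≢y  | yes same | _       = 3 , ℕ.≤-refl , x≢y , same
  ... | no _    | no _     | yes x~y = 1 , s≤s z≤n , x~y
  ... | no _    | no apart | no x≁y  = 2 , s≤s (s≤s z≤n) , apart , x≁y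

  private
    walk-0 : ∀ {x y} → Walk X x y 0 → x ≡ y
    walk-0 stop = refl

    walk-1 : ∀ {x y} → Walk X x y 1 → x ~ y
    walk-1 (step x~y stop) = x~y

    distance-2⇒walk : ∀ {x y} → Distance 2 x y → Walk X x y 2
    distance-2⇒walk (x≢y , x≁y)
      with commonNeighbours-witness (c₂≢0 ∘ trans (sym (commonNeighbours-nonadjacent x≢y x≁y)))
    ... | z , x~z , z~y = step x~z (step z~y stop)

    neighbour : ∀ x → ∃[ z ] x ~ z
    neighbour (v , j) with lift-exists v j (another v) (λ eq → another-≢ v (sym eq))
      where
      another : Fin (suc (suc n)) → Fin (suc (suc n))
      another zero    = suc zero
      another (suc _) = zero
      another-≢ : ∀ v → another v ≢ v
      another-≢ zero    ()
      another-≢ (suc _) ()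
    ... | k , x~z = _ , x~z

  distance⇒AtDistance : ∀ k {x y} → Distance k x y → AtDistance X k x y
  distance⇒AtDistance 0 refl = stop , λ ()
  distance⇒AtDistance 1 x~y = step x~y stop , λ where
    (s≤s z≤n) walk → ~-irrefl (walk-0 walk) x~y
  distance⇒AtDistance 2 (x≢y , x≁y) = distance-2⇒walk (x≢y , x≁y) , λ where
    (s≤s z≤n)       walk → x≢y (cong proj₁ (walk-0 walk))
    (s≤s (s≤s z≤n)) walk → x≁y (walk-1 walk)
  distance⇒AtDistance 3 {x} {y} (x≢y , same) with neighbour x
  -- Any neighbour `z` of `x` serves: it lies outside the fibre of `y`, and if it were adjacent to
  -- `y`, unique lifting would identify `x` with `y`.
  ... | z , x~z = step x~z (distance-2⇒walk ((λ eq → ~⇒≢ x~z (trans same (sym eq)))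
                                            , λ z~y → x≢y (same-fibre⇒≡ same x~z z~y))) , λ where
    (s≤s z≤n)             walk → x≢y (walk-0 walk)
    (s≤s (s≤s z≤n))       walk → ~⇒≢ (walk-1 walk) same
    (s≤s (s≤s (s≤s z≤n))) (step x~w walk) → x≢y (same-fibre⇒≡ same x~w (walk-1 walk))

  -- `classify` supplies some distance for the pair, and two lengths that are both shortest
  -- coincide.
  AtDistance⇒distance : ∀ k {x y} → AtDistance X k x y → Distance k x y
  AtDistance⇒distance k {x} {y} (walk , shortest) with classify x y
  ... | k′ , _ , dist with ℕ.<-cmp k k′ | distance⇒AtDistance k′ dist
  ...   | tri< k<k′ _ _ | _     , shortest′ = contradiction walk (shortest′ k<k′)
  ...   | tri≈ _ refl _ | _                 = dist
  ...   | tri> _ _ k′<k | walk′ , _         = contradiction walk′ (shortest k′<k)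

  private
    neighboursAt : ℕ → Vertex → Vertex → ℕ
    neighboursAt k v w = total vertices′ λ u → indicator (w ~? u ×-dec distance? k v u)

    all-neighbours : ∀ k {v w} → (∀ u → w ~ u → Distance k v u) → neighboursAt k v w ≡ suc n
    all-neighbours k {v} {w} all = trans
      (total-cong vertices′ λ u → indicator-cong (w ~? u ×-dec distance? k v u) (w ~? u) proj₁ λ w~u → w~u , all u w~u)
      (degree w)

    no-neighbours : ∀ k {v w} → (∀ u → ¬ Distance k v u) → neighboursAt k v w ≡ 0
    no-neighbours k {v} {w} none = trans
      (total-cong vertices′ λ u → indicator-false (w ~? u ×-dec distance? k v u) λ (_ , dist) → none u dist)
      (trans (total-const vertices′ 0) (ℕ.*-zeroʳ (size vertices′)))

    unique-neighbour : ∀ k {v w} u → w ~ u → Distance k v u → (∀ u′ → w ~ u′ → Distance k v u′ → u′ ≡ u) →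
      neighboursAt k v w ≡ 1
    unique-neighbour k {v} {w} u w~u dist unique =
      total-unique vertices′ (λ u → w ~? u ×-dec distance? k v u) u (w~u , dist) λ u′ (w~u′ , dist′) → unique u′ w~u′ dist′

    -- The `n + 1` neighbours of `w` are `v`, the `a₁` common neighbours with `v`, and those at
    -- distance 2 from `v`. None is at distance 3, as `v` is the only neighbour of `w` in its fibre.
    neighbours-1-2 : ∀ {v w} → v ~ w → neighboursAt 2 v w ≡ n ∸ a₁
    neighbours-1-2 {v} {w} v~w = begin
      neighboursAt 2 v w                     ≡⟨ sym (ℕ.m+n∸n≡m _ (suc a₁)) ⟩
      (neighboursAt 2 v w + suc a₁) ∸ suc a₁ ≡⟨ cong (_∸ suc a₁) count ⟩
      n ∸ a₁                                 ∎
      where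
      split : ∀ u → indicator (w ~? u ×-dec distance? 2 v u) + (indicator (v ≟ u) + adjacency v u * adjacency u w) ≡
                    adjacency w u
      split u = cases (w ~? u) (v ≟ u) (v ~? u)
        where
        values : ∀ {i j k l m} → indicator (w ~? u ×-dec distance? 2 v u) ≡ i → indicator (v ≟ u) ≡ j →
          adjacency v u ≡ k → adjacency u w ≡ l → adjacency w u ≡ m → i + (j + k * l) ≡ m →
          indicator (w ~? u ×-dec distance? 2 v u) + (indicator (v ≟ u) + adjacency v u * adjacency u w) ≡ adjacency w u
        values refl refl refl refl refl eq = eq
        P? = w ~? u ×-dec distance? 2 v u
        cases : Dec (w ~ u) → Dec (v ≡ u) → Dec (v ~ u) →
          indicator (w ~? u ×-dec distance? 2 v u) + (indicator (v ≟ u) + adjacency v u * adjacency u w) ≡ adjacency w u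
        cases (no w≁u) _ _ = values (indicator-false P? (w≁u ∘ proj₁))
          (indicator-false (v ≟ u) λ { refl → w≁u (~-sym v~w) }) refl (indicator-false (u ~? w) (w≁u ∘ ~-sym))
          (indicator-false (w ~? u) w≁u) (ℕ.*-zeroʳ (adjacency v u))
        cases (yes w~u) (yes refl) _ = values (indicator-false P? λ (_ , v≢v , _) → v≢v refl)
          (indicator-true (v ≟ v) refl) (adjacency-irrefl v) refl (indicator-true (w ~? v) w~u) refl
        cases (yes w~u) (no v≢u) (yes v~u) = values (indicator-false P? λ (_ , _ , v≁u) → v≁u v~u)
          (indicator-false (v ≟ u) v≢u) (indicator-true (v ~? u) v~u) (indicator-true (u ~? w) (~-sym w~u))
          (indicator-true (w ~? u) w~u) refl
        cases (yes w~u) (no v≢u) (no v≁u) = values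
          (indicator-true P? (w~u , (λ same → v≢u (same-fibre⇒≡ same v~w w~u)) , v≁u))
          (indicator-false (v ≟ u) v≢u) (indicator-false (v ~? u) v≁u) refl (indicator-true (w ~? u) w~u) refl
      count : neighboursAt 2 v w + suc a₁ ≡ suc n
      count = begin
        neighboursAt 2 v w + suc a₁
          ≡⟨ cong₂ (λ i j → neighboursAt 2 v w + (i + j))
               (sym (total-unique vertices′ (v ≟_) v refl λ _ → sym)) (sym (commonNeighbours-adjacent v~w)) ⟩
        neighboursAt 2 v w + (total vertices′ (λ u → indicator (v ≟ u)) + commonNeighbours v w)
          ≡⟨ cong (neighboursAt 2 v w +_) (sym (total-+ vertices′ (λ u → indicator (v ≟ u)) (λ u → adjacency v u * adjacency u w))) ⟩
        neighboursAt 2 v w + total vertices′ (λ u → indicator (v ≟ u) + adjacency v u * adjacency u w)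
          ≡⟨ sym (total-+ vertices′ (λ u → indicator (w ~? u ×-dec distance? 2 v u))
                                    (λ u → indicator (v ≟ u) + adjacency v u * adjacency u w)) ⟩
        total vertices′ (λ u → indicator (w ~? u ×-dec distance? 2 v u) + (indicator (v ≟ u) + adjacency v u * adjacency u w))
          ≡⟨ total-cong vertices′ split ⟩
        total vertices′ (adjacency w)
          ≡⟨ degree w ⟩
        suc n ∎

    neighbours-2-1 : ∀ {v w} → Distance 2 v w → neighboursAt 1 v w ≡ c₂
    neighbours-2-1 {v} {w} (v≢w , v≁w) = trans (total-cong vertices′ product) (commonNeighbours-nonadjacent v≢w v≁w)
      where
      product : ∀ u → indicator (w ~? u ×-dec v ~? u) ≡ adjacency v u * adjacency u w
      product u = trans (indicator-× (w ~? u) (v ~? u))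
        (trans (ℕ.*-comm (adjacency w u) (adjacency v u)) (cong (adjacency v u *_) (adjacency-sym w u)))
        where
        indicator-× : {P Q : Set} (P? : Dec P) (Q? : Dec Q) → indicator (P? ×-dec Q?) ≡ indicator P? * indicator Q?
        indicator-× P? Q? with does P?
        ... | true  = sym (ℕ.*-identityˡ (indicator Q?))
        ... | false = refl

    -- The one vertex counted is the neighbour of `w` in the fibre of `v`; it is not `v` because `v`
    -- and `w` are not adjacent.
    neighbours-2-3 : ∀ {v w} → Distance 2 v w → neighboursAt 3 v w ≡ 1
    neighbours-2-3 {v} {w} (v≢w , v≁w) with lift-exists (proj₁ w) (proj₂ w) (proj₁ v) (v≢w ∘ sym)
    ... | k , w~u = unique-neighbour 3 (proj₁ v , k) w~u ((λ { refl → v≁w (~-sym w~u) }) , refl)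
      λ { (_ , k′) w~u′ (_ , refl) → cong (proj₁ v ,_) (lift-unique w~u′ w~u) }

  -- The intersection array {n + 1, n - a₁, 1; 1, c₂, n + 1}, continued by zeros.
  b c : ℕ → ℕ
  b 0 = suc n
  b 1 = n ∸ a₁
  b 2 = 1
  b _ = 0
  c 1 = 1
  c 2 = c₂
  c 3 = suc n
  c _ = 0

  neighbours-further : ∀ i {v w} → Distance i v w → neighboursAt (suc i) v w ≡ b i
  neighbours-further 0 {v} refl    = all-neighbours 1 {v} {v} λ u v~u → v~u
  neighbours-further 1 v~w         = neighbours-1-2 v~w
  neighbours-further 2 dist        = neighbours-2-3 dist
  neighbours-further 3 {v} {w} _   = no-neighbours 4 {v} {w} λ u ()

  neighbours-closer : ∀ i {v w} → Distance (suc i) v w → neighboursAt i v w ≡ c (suc i)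
  neighbours-closer 0 {v} v~w      = unique-neighbour 0 v (~-sym v~w) refl λ u _ → sym
  neighbours-closer 1 dist         = neighbours-2-1 dist
  neighbours-closer 2 (v≢w , same) = all-neighbours 2 λ u w~u →
    (λ eq → ~⇒≢ w~u (trans (sym same) eq)) , λ v~u → v≢w (same-fibre⇒≡ same v~u (~-sym w~u))

  isDistanceRegular : IsDistanceRegular X 3
  isDistanceRegular = connected , (distances , (zero , zero) , (zero , suc zero) , distance⇒AtDistance 3 ((λ ()) , refl))
    , b , c , λ i v w at → further i v w (AtDistance⇒distance i at) , closer i v w (AtDistance⇒distance i at)
    where
    distances : ∀ x y → ∃[ k ] (k ≤ 3 × AtDistance X k x y)
    distances x y with classify x y
    ... | k , k≤3 , dist = k , k≤3 , distance⇒AtDistance k dist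
    further : ∀ i v w → Distance i v w → HasCardinality (λ u → w ~ u × AtDistance X (suc i) v u) (b i)
    further i v w dist = HasCardinality-≐ vertices′ (λ u → w ~? u ×-dec distance? (suc i) v u)
      (λ u (w~u , d) → w~u , distance⇒AtDistance (suc i) d) (λ u (w~u , at) → w~u , AtDistance⇒distance (suc i) at)
      (neighbours-further i dist)
    closer : ∀ i v w → Distance i v w →
      HasCardinality (λ u → w ~ u × (∃[ k ] (suc k ≡ i × AtDistance X k v u))) (c i)
    closer zero    v w dist = [] , [] , (λ x → mk⇔ (λ ()) λ { (_ , _ , () , _) }) , refl
    closer (suc i) v w dist = HasCardinality-≐ vertices′ (λ u → w ~? u ×-dec distance? i v u)
      (λ u (w~u , d) → w~u , i , refl , distance⇒AtDistance i d)
      (λ { u (w~u , _ , refl , at) → w~u , AtDistance⇒distance i at })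
      (neighbours-closer i dist)

  sameFibre⇒ : ∀ x y → proj₁ x ≡ proj₁ y → EqualOrAtDistance X 3 x y
  sameFibre⇒ x y same with x ≟ y
  ... | yes x≡y = inj₁ x≡y
  ... | no  x≢y = inj₂ (distance⇒AtDistance 3 (x≢y , same))

  sameFibre⇐ : ∀ x y → EqualOrAtDistance X 3 x y → proj₁ x ≡ proj₁ y
  sameFibre⇐ x y (inj₁ x≡y) = cong proj₁ x≡y
  sameFibre⇐ x y (inj₂ at)  = proj₂ (AtDistance⇒distance 3 at)

  -- The antipodal classes are the fibres, so the quotient is the base and `f` itself exhibits the
  -- cover.
  isDrackn : IsDrackn X (suc (suc n))
  isDrackn = record
    { diameter          = 3
    ; isDistanceRegular = isDistanceRegular
    ; isAntipodal       = record
      { refl  = inj₁ refl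
      ; sym   = λ {x} {y} e → sameFibre⇒ y x (sym (sameFibre⇐ x y e))
      ; trans = λ {x} {y} {z} e e′ → sameFibre⇒ x z (trans (sameFibre⇐ x y e) (sameFibre⇐ y z e′))
      }
    ; class               = proj₁
    ; isAntipodalQuotient = record
      { surjective = λ v → (v , zero) , refl
      ; classes    = λ x y → mk⇔ (sameFibre⇒ x y) (sameFibre⇐ x y)
      ; adjacency  = λ v u → mk⇔
          (λ v≢u → v≢u , (v , zero) , _ , refl , refl , proj₂ (lift-exists v zero u v≢u)) proj₁
      }
    ; isCover = record
      { index       = suc (suc ρ)
      ; arcFunction = f
      ; bijection   = ↔-id _
      ; adjacency   = λ _ _ → ⇔-id _
      ; projection  = λ _ → refl
      }
    }

-- From the spectral hypothesis to the theorem.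

module _ {c ℓ₁ ℓ₂ : Level} (K : HeytingField c ℓ₁ ℓ₂) (char0 : CharacteristicZero K) where
  private
    R = HeytingCommutativeRing.commutativeRing (HeytingField.heytingCommutativeRing K)
    module R = CommutativeRing R
  open TwoEigenvalues R using (ι; trace-power-0; trace-hankel)
  open Spectra K using (adjacencyMatrix)
  open Walks using (closedWalks; closedWalks-0; closedWalks-1)

  adjacencyMatrix≈ι : ∀ {V} (X : Graph V) i j → adjacencyMatrix X i j R.≈ ι (natAdjacency X i j)
  adjacencyMatrix≈ι {V} X i j
    with does (Graph._~?_ X (Inverse.to (enumeration V) i) (Inverse.to (enumeration V) j))
  ... | true  = R.sym (R.+-identityʳ R.1#)
  ... | false = R.refl

  module _ {V} {Y : Graph V} {r} (f : SymmetricArcFunction Y r) (two : IsTwoEigenvalueCover K f) where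
    open IsTwoEigenvalueCover two

    -- Zeroth powers compare the numbers of vertices, and a list with two distinct members is not
    -- empty. This excludes an empty base and an index below 2.
    cover-larger : ∃[ d ] size V * r ≡ size V + suc d
    cover-larger with difference in eq | twoEigenvalues
    ... | []     | _ , _ , _ , () , _
    ... | _ ∷ ds | _ = length ds , trans (sym (closedWalks-0 (cover f)))
      (trans (trace-power-0 (adjacencyMatrix (cover f)) (adjacencyMatrix Y)
               (natAdjacency (cover f)) (natAdjacency Y) (adjacencyMatrix≈ι (cover f)) (adjacencyMatrix≈ι Y)
               spectrumCover spectrumY difference isSpectrumCover isSpectrumY isDifference char0)
        (cong₂ _+_ (closedWalks-0 Y) (cong length eq)))

    closedWalks-hankel : ∀ d₀ d₂ → closedWalks (cover f) 0 ≡ closedWalks Y 0 + d₀ →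
      closedWalks (cover f) 2 ≡ closedWalks Y 2 + d₂ →
      d₀ * d₂ * closedWalks (cover f) 4 + 2 * (d₀ * closedWalks Y 3 * closedWalks (cover f) 3) ≡
      d₀ * (closedWalks (cover f) 3 * closedWalks (cover f) 3) + d₀ * (closedWalks Y 3 * closedWalks Y 3)
        + d₂ * d₂ * d₂ + d₀ * d₂ * closedWalks Y 4
    closedWalks-hankel d₀ d₂ eq₀ eq₂ with twoEigenvalues
    ... | θ , τ , _ , _ , _ , two-valued =
      trace-hankel (adjacencyMatrix (cover f)) (adjacencyMatrix Y)
        (natAdjacency (cover f)) (natAdjacency Y) (adjacencyMatrix≈ι (cover f)) (adjacencyMatrix≈ι Y)
        spectrumCover spectrumY difference isSpectrumCover isSpectrumY isDifference char0
        θ τ two-valued d₀ d₂ eq₀ (trans (closedWalks-1 (cover f)) (sym (closedWalks-1 Y))) eq₂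

  -- The closed walks of lengths 0 and 2 give P_0 = N (r - 1) and P_2 = N (n + 1) (r - 1), where N =
  -- n + 2 and r is the index; both are natural numbers, as `closedWalks-hankel` requires.
  cover-variance : ∀ {n ρ} (f : SymmetricArcFunction (complete (suc (suc n))) (suc (suc ρ))) →
    IsTwoEigenvalueCover K f → CoverOfComplete.VarianceVanishes f (suc ρ)
  cover-variance {n} {ρ} f two = variance-identity N (suc n) n (suc ρ) triangles squares
    (values closedWalks-4-value closedWalks-3-value K.closedWalks-3-value K.closedWalks-4-value
      (closedWalks-hankel f two (N * suc ρ) (N * suc n * suc ρ)
        (trans (Walks.closedWalks-0 (cover f)) (trans (ℕ.*-suc N (suc ρ)) (cong (_+ N * suc ρ) (sym K.closedWalks-0))))
        (trans closedWalks-2-value (trans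
          (solve 3 (λ N m r → N :* (con 1 :+ r) :* m := N :* m :+ N :* m :* r) refl N (suc n) (suc ρ))
          (cong (_+ N * suc n * suc ρ) (sym K.closedWalks-2-value))))))
    where
    open CoverOfComplete f hiding (closedWalks)
    N = suc (suc n)
    d₀ = N * suc ρ
    d₂ = N * suc n * suc ρ
    values : ∀ {s₃ s₄ t₃ t₄ s₃′ s₄′ t₃′ t₄′} → s₄ ≡ s₄′ → s₃ ≡ s₃′ → t₃ ≡ t₃′ → t₄ ≡ t₄′ →
      d₀ * d₂ * s₄ + 2 * (d₀ * t₃ * s₃) ≡ d₀ * (s₃ * s₃) + d₀ * (t₃ * t₃) + d₂ * d₂ * d₂ + d₀ * d₂ * t₄ →
      d₀ * d₂ * s₄′ + 2 * (d₀ * t₃′ * s₃′) ≡ d₀ * (s₃′ * s₃′) + d₀ * (t₃′ * t₃′) + d₂ * d₂ * d₂ + d₀ * d₂ * t₄′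
    values refl refl refl refl eq = eq

  -- The main argument needs two base vertices and index at least 2. An empty base and the indices 0
  -- and 1 contradict `cover-larger`; a single base vertex with larger index has an edgeless cover
  -- with several vertices, which is not connected.
  connected-2ev-cover-isDrackn : ∀ n r (f : SymmetricArcFunction (complete n) r) →
    Connected (cover f) → IsTwoEigenvalueCover K f → IsDrackn (cover f) n
  connected-2ev-cover-isDrackn zero          r f connected two with cover-larger f two
  ... | d , ()
  connected-2ev-cover-isDrackn (suc n) zero f connected two with cover-larger f two
  ... | d , eq = contradiction (trans (sym (ℕ.*-zeroʳ n)) eq) λ ()
  connected-2ev-cover-isDrackn (suc n) (suc zero) f connected two with cover-larger f two
  ... | d , eq = contradiction (ℕ.+-cancelˡ-≡ (suc n) 0 (suc d)
    (trans (ℕ.+-identityʳ (suc n)) (trans (sym (ℕ.*-identityʳ (suc n))) eq))) λ ()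
  connected-2ev-cover-isDrackn (suc zero) (suc (suc ρ)) f connected two
    with connected (zero , zero) (zero , suc zero)
  ... | _ , step {v = zero , _} (0≢0 , _) _ = contradiction refl 0≢0
  connected-2ev-cover-isDrackn (suc (suc n)) (suc (suc ρ)) f connected two =
    DistanceRegular.isDrackn f (Rigidity.rigid f (cover-variance f two)) connected

theorem6p2 : ∀ {c ℓ₁ ℓ₂ : Level} (K : HeytingField c ℓ₁ ℓ₂) → CharacteristicZero K →
    ∀ (n r : ℕ) (f : SymmetricArcFunction (complete n) r) →
    IsNormalized f → ActsRegularly ⟨ Values f ⟩ → IsCyclic ⟨ Values f ⟩ →
    Connected (cover f) → IsTwoEigenvalueCover K f →
    IsDrackn (cover f) n
theorem6p2 K char0 n r f _ _ _ = connected-2ev-cover-isDrackn K char0 n r f
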